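{- Let $\lambda\in\operatorname{Val}(n)$ and $d=(n-\lambda_1,n-\lambda_2,\dots,n-\lambda_{\operatorname{length}(\lambda)})$. Then there is a bijection $f:\operatorname{MLQ}(w(\lambda;n))\to\operatorname{SSYT}(\lambda,d)$ such that for every $Q\in\operatorname{MLQ}(w(\lambda;n))$ and all $i,r$, the number of $i$-covered vacancies in row $r$ of $Q$ equals the number of entries equal to $r$ in row $i$ of $f(Q)$.
   Context: $\operatorname{Val}(n)$: partitions $\lambda$ contained in a $\operatorname{length}(\lambda)\times(n-\operatorname{length}(\lambda))$ rectangle that are neither empty nor equal to this full rectangle. $w(\lambda;n)$: in the rectangle with $\lambda_1$ columns and $n-\lambda_1$ rows, containing the Young diagram of $\lambda$ (English convention, top-left justified), follow the boundary lattice path of the diagram from the upper right corner to the lower left corner. Label its $n-\lambda_1$ vertical steps $1,\dots,n-\lambda_1$ from top to bottom and its $\lambda_1$ horizontal steps $n-\lambda_1+1,\dots,n$ from right to left; $w(\lambda;n)$ is the sequence of labels in the order the steps are traversed (a permutation of $\{1,\dots,n\}$; e.g. $w((6,6,4,4,2,2);13)=(1,2,8,9,3,4,10,11,5,6,12,13,7)$). $\operatorname{SSYT}(\lambda,d)$: semistandard Young tableaux of shape $\lambda$ whose entries in row $i$ are at most $d_i$. Multiline queues: for a sequence $w=(w_1,\dots,w_n)$ of positive integers with maximum $L+1$, a multiline queue is an array with rows $1,\dots,L$ (top to bottom) and $n$ columns, indexed $1,\dots,n$ from right to left and considered cyclically, each cell being a ball or a vacancy. Bully path labeling: for $\ell=1,\dots,L$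 in turn, the balls of row $\ell$ not yet labeled receive label $\ell$ (in row $1$ all balls get label 1); then for each ball of label $\ell$ in row $\ell$, from left to right, build its $\ell$-bully path: from a ball $b$ in row $r$, look at the cell of row $r+1$ directly below $b$ and move rightward (cyclically wrapping around) until the first ball of row $r+1$ not yet matched; that ball is matched to $b$, receives label $\ell$, and the path continues from it to row $r+2$, and so on down to row $L$. The cells of row $r+1$ scanned in this process (from the cell below $b$ up to, not including, the matched ball) are traversed by the path. The type of the multiline queue is the sequence of labels of row $L$ read from right to left, a vacancy contributing $L+1$. $\operatorname{MLQ}(w)$ is the set of multiline queues with $L=\max(w)-1$ rows of type $w$ (row $r$ then necessarily contains $\#\{i:w_i\le r\}$ balls). A vacancy is $i$-covered if it is traversed by some $i$-bully path but by no $i'$-bully path with $i'<i$.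
   Formalization: The equality of counts is claimed for r ≠ i only: no vacancy in row i is i-covered, while row i of a tableau may contain entries equal to i (λ=(1), n=3 is a counterexample at i=r=1). -}

module Defs where

open import Data.Nat using (ℕ; zero; suc; _+_; _∸_; _≤_; _<_; _≥_; _⊔_; _≡ᵇ_; _<ᵇ_)
open import Data.Nat.Properties using (_≟_)
open import Data.Bool using (Bool; true; false; _∧_; not; if_then_else_)
open import Data.Maybe using (Maybe; just; nothing)
open import Data.Bool.ListAction using (any)
open import Data.List using (List; []; _∷_; _++_; map; length; foldr; foldl; filter; filterᵇ; applyUpTo; applyDownFrom; replicate)
open import Data.List.Relation.Unary.All using (All)
open import Data.List.Relation.Unary.Linked using (Linked)
open import Data.Product using (Σ; _×_; _,_; proj₁; proj₂)
open import Relation.Binary.PropositionalEquality using (_≡_; _≢_)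
open import Function.Definitions using (Bijective)

at : {A : Set} → A → List A → ℕ → A
at d []       _       = d
at d (x ∷ xs) zero    = x
at d (x ∷ xs) (suc k) = at d xs k

maxL : List ℕ → ℕ
maxL = foldr _⊔_ 0

IsPartition : List ℕ → Set
IsPartition p = Linked _≥_ p × All (λ x → 1 ≤ x) p

-- the i-th part λ_i (1-indexed), 0 beyond the length
part : List ℕ → ℕ → ℕ
part p i = at 0 p (i ∸ 1)

Val : ℕ → List ℕ → Set
Val n p = IsPartition p
        × 1 ≤ length p
        × part p 1 ≤ n ∸ length p
        × p ≢ replicate (length p) (n ∸ length p)

-- labels of k consecutive horizontal (leftward) steps starting at the
-- vertical line x = c; the step from x = c to x = c - 1 is the
-- (λ₁ - c + 1)-th horizontal step from the right, so has label n + 1 - c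
hsteps : ℕ → ℕ → ℕ → List ℕ
hsteps n c zero    = []
hsteps n c (suc k) = (suc n ∸ c) ∷ hsteps n (c ∸ 1) k

-- walk the boundary path: c = current x-coordinate, i = index of the
-- next row (= label of the next vertical step), ms = lengths of the
-- remaining rows of the rectangle (λ_i, padded with zeros)
wgo : ℕ → ℕ → ℕ → List ℕ → List ℕ
wgo n c i []       = hsteps n c c
wgo n c i (m ∷ ms) = hsteps n c (c ∸ m) ++ (i ∷ wgo n m (suc i) ms)

-- w(λ;n), rectangle with λ₁ columns and n - λ₁ rows
wperm : ℕ → List ℕ → List ℕ
wperm n p = wgo n (part p 1) 1 (applyUpTo (λ k → part p (suc k)) (n ∸ part p 1))

-- Multiline queues
--
-- A multiline queue with L rows and N columns is a list of L rows, each a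
-- list of N booleans (true = ball, false = vacancy).  Rows are 1-indexed
-- from top to bottom; columns are 1-indexed from RIGHT to LEFT, and the
-- j-th element of a row list (1-based) is column j.

ball : List (List Bool) → ℕ → ℕ → Bool
ball Q r j = at false (at [] Q (r ∸ 1)) (j ∸ 1)

leftToRight : ℕ → List ℕ
leftToRight N = applyDownFrom suc N

-- cyclic rightward scan starting at column j: j, j-1, ..., 1, N, ..., j+1
rightwardFrom : ℕ → ℕ → List ℕ
rightwardFrom N j = applyDownFrom suc j ++ applyDownFrom (λ k → j + suc k) (N ∸ j)

-- state of the bully path labeling:
--   labs : labeled (= matched) balls as triples (row , column , label)
--   trav : traversed cells as triples (label of path , row , column)
record St : Set where
  constructor st
  field
    labs : List (ℕ × ℕ × ℕ)
    trav : List (ℕ × ℕ × ℕ)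
open St public

labelOf : List (ℕ × ℕ × ℕ) → ℕ → ℕ → Maybe ℕ
labelOf []                  r j = nothing
labelOf ((r' , j' , l) ∷ t) r j = if (r' ≡ᵇ r) ∧ (j' ≡ᵇ j) then just l else labelOf t r j

isLabeled : List (ℕ × ℕ × ℕ) → ℕ → ℕ → Bool
isLabeled ls r j with labelOf ls r j
... | just _  = true
... | nothing = false

scan : (ℕ → Bool) → List ℕ → List ℕ × Maybe ℕ
scan free []       = [] , nothing
scan free (x ∷ xs) with free x
... | true  = [] , just x
... | false = x ∷ proj₁ (scan free xs) , proj₂ (scan free xs)

pathFrom : List (List Bool) → ℕ → ℕ → ℕ → ℕ → ℕ → St → St
pathFrom Q N l zero    r j s = s
pathFrom Q N l (suc k) r j (st ls tr) with
  scan (λ x → ball Q (suc r) x ∧ not (isLabeled ls (suc r) x)) (rightwardFrom N j)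
... | (t , nothing) = st ls (tr ++ map (λ x → l , suc r , x) t)
... | (t , just x)  = pathFrom Q N l k (suc r) x
                        (st ((suc r , x , l) ∷ ls) (tr ++ map (λ y → l , suc r , y) t))

stage : List (List Bool) → ℕ → ℕ → St → ℕ → St
stage Q L N s l =
  foldl (λ s' j → pathFrom Q N l (L ∸ l) l j s')
        (st (map (λ j → l , j , l) starts ++ labs s) (trav s))
        starts
  where
  starts : List ℕ
  starts = filterᵇ (λ j → ball Q l j ∧ not (isLabeled (labs s) l j)) (leftToRight N)

bully : List (List Bool) → ℕ → ℕ → St
bully Q L N = foldl (stage Q L N) (st [] []) (applyUpTo suc L)

rowsOf : List ℕ → ℕ
rowsOf w = maxL w ∸ 1

colsOf : List ℕ → ℕ
colsOf w = length w

typeOf : List ℕ → List (List Bool) → List ℕ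
typeOf w Q = map lab (applyUpTo suc (colsOf w))
  where
  L = rowsOf w
  lab : ℕ → ℕ
  lab j with ball Q L j | labelOf (labs (bully Q L (colsOf w))) L j
  ... | false | _       = suc L
  ... | true  | just l  = l
  ... | true  | nothing = 0   -- (never happens for an actual labeling)

IsMLQ : List ℕ → List (List Bool) → Set
IsMLQ w Q = length Q ≡ rowsOf w
          × All (λ row → length row ≡ colsOf w) Q
          × typeOf w Q ≡ w

MLQ : List ℕ → Set
MLQ w = Σ (List (List Bool)) (IsMLQ w)

iCovered : List ℕ → List (List Bool) → ℕ → ℕ → ℕ → Bool
iCovered w Q i r j =
  not (ball Q r j)
  ∧ any (λ { (l , r' , j') → (l ≡ᵇ i) ∧ (r' ≡ᵇ r) ∧ (j' ≡ᵇ j) }) tr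
  ∧ not (any (λ { (l , r' , j') → (l <ᵇ i) ∧ (r' ≡ᵇ r) ∧ (j' ≡ᵇ j) }) tr)
  where
  tr = trav (bully Q (rowsOf w) (colsOf w))

numCovered : List ℕ → List (List Bool) → ℕ → ℕ → ℕ
numCovered w Q i r = length (filterᵇ (iCovered w Q i r) (applyUpTo suc (colsOf w)))

-- Semistandard Young tableaux with row bounds
--
-- A tableau is a list of rows (top to bottom), each a list of entries
-- (left to right).

ColStrict : List ℕ → List ℕ → Set
ColStrict R R' = ∀ j → j < length R' → at 0 R j < at 0 R' j

IsSSYT : List ℕ → List ℕ → List (List ℕ) → Set
IsSSYT p d T = map length T ≡ p
             × All (Linked _≤_) T
             × Linked ColStrict T
             × (∀ i → i < length T → All (λ e → 1 ≤ e × e ≤ at 0 d i) (at [] T i))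

SSYT : List ℕ → List ℕ → Set
SSYT p d = Σ (List (List ℕ)) (IsSSYT p d)

numEntries : List (List ℕ) → ℕ → ℕ → ℕ
numEntries T i r = length (filter (_≟ r) (at [] T (i ∸ 1)))

-- bijections between such subtypes, equality being equality of the
-- underlying data (first components)

_≈₁_ : {A : Set} {P : A → Set} → Σ A P → Σ A P → Set
x ≈₁ y = proj₁ x ≡ proj₁ y

IsBijection : {A B : Set} {P : A → Set} {Q : B → Set} → (Σ A P → Σ B Q) → Set
IsBijection f = Bijective _≈₁_ _≈₁_ f

{-# OPTIONS --safe #-}
module Submission where

-- Let k = n − λ₁.  Exactly one bully path starts in every row and none of them
-- stops early: otherwise some row would have all its balls labeled before its
-- own stage, and its label would be missing from the type w(λ;n).  A multiline
-- queue of this type is therefore the array of columns pos i r of label i in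
-- row r (i ≤ r < n), whose last row is the inverse permutation of w(λ;n).
-- Going up from the last row, the horizontal labels j > k never move, no path
-- wraps around, and the vertical labels i ≤ k interlace,
--     pos i (r + 1) ≤ pos i r < pos (i + 1) (r + 1),
-- with pos i r constant for r ≥ n − λᵢ.  Putting
--     i + λ₁ − pos i r  =  number of entries ≤ r in row i
-- turns this array into the Gelfand–Tsetlin pattern of a semistandard tableau
-- whose row i is bounded by n − λᵢ, and pos i (r − 1) − pos i r, the number of
-- i-covered vacancies of row r, into the number of entries r of row i.

open import Defs
open import Data.Nat
open import Data.Nat.Properties
open import Data.Bool using (Bool; true; false; _∧_; not; T)
open import Data.Bool.Properties using (T?)
open import Data.Bool.ListAction using (any)
open import Data.Empty using (⊥; ⊥-elim)
open import Data.Maybe using (Maybe; just; nothing)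
open import Data.List using (List; []; _∷_; _++_; map; length; filter; filterᵇ; applyUpTo; applyDownFrom; foldl; replicate; upTo)
open import Data.List.Properties using (++-assoc; applyUpTo-∷ʳ; filter-++; length-++; length-applyUpTo; filter-accept; filter-reject; filter-none; filter-all; length-replicate; length-filter; map-applyUpTo; length-map)
open import Data.List.Membership.Propositional using (_∈_; _∉_)
open import Data.List.Membership.Propositional.Properties using (∈-++⁺ˡ; ∈-++⁺ʳ; ∈-++⁻; ∈-applyDownFrom⁺; ∈-applyDownFrom⁻; ∈-filter⁺; ∈-filter⁻; ∈-map⁺; ∈-map⁻; ∈-upTo⁺; ∈-upTo⁻)
open import Data.List.Relation.Unary.Any using (here; there)
open import Data.List.Relation.Unary.All as All using (All; []; _∷_)
open import Data.List.Relation.Unary.AllPairs using (AllPairs; []; _∷_)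
import Data.List.Relation.Unary.AllPairs.Properties as AllPairs
import Data.List.Relation.Unary.All.Properties as All
open import Data.List.Relation.Unary.Unique.Propositional using (Unique)
import Data.List.Relation.Unary.Unique.Propositional.Properties as Unique
open import Data.Product using (Σ; ∃; _×_; _,_; proj₁; proj₂)
open import Data.Sum using (_⊎_; inj₁; inj₂)
open import Function using (_∘_)
open import Relation.Binary.PropositionalEquality
open import Relation.Nullary using (¬_; yes; no; contradiction)
open import Data.Maybe.Properties using (just-injective)
open import Relation.Binary.Definitions using (tri<; tri≈; tri>)
open import Data.List.Relation.Unary.Linked as Linked using (Linked; []; [-]; _∷_)
import Data.List.Relation.Unary.Linked.Properties as Linked

-- The type constrains the last row only, so the columns are recovered by induction from row `r + 1`
-- up to row `r`. The one lever is that path `i` may skip balls of smaller labels but none of a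
-- larger label, as these are still unmatched. Among vertical labels, whose columns increase with
-- the label, this is enough. The obstacle is wrapping around, and it is excluded by crowding: in a
-- row `r + 1 > k` no vacancy lies to the right of the ball of label `r + 1`, the balls over there
-- do not move, and a wrapping path would have to start in row `r` from a column that one of them
-- occupies.
--
-- Columns are numbered from right to left, so an unwrapped path never increases its column. The
-- constant `i + λ₁` is the sum of `λᵢ` and the final column of label `i`; a vertical label moves by
-- at most `λᵢ` in all.
--
-- Path `i` starts in row `i` and covers no vacancy there. The entries `i` in row `i` of the tableau
-- therefore count no vacancies: they fill the row up to length `λᵢ`, and the two statistics are
-- compared for `r ≢ i`.

private variable
  A A' : Set
  a b c d e i j l m q r t x y ρ : ℕ
  R R' : List ℕ

-- Booleans and counting in an interval

∧-true⁻ : ∀ {p q} → p ∧ q ≡ true → p ≡ true × q ≡ true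
∧-true⁻ {true} {true} _ = refl , refl

∧-true⁺ : ∀ {p q} → p ≡ true → q ≡ true → p ∧ q ≡ true
∧-true⁺ refl refl = refl

not-true⁻ : ∀ {p} → not p ≡ true → p ≡ false
not-true⁻ {false} _ = refl

not-true⁺ : ∀ {p} → ¬ (p ≡ true) → not p ≡ true
not-true⁺ {false} _ = refl
not-true⁺ {true} p = contradiction refl p

true⇒T : ∀ {p} → p ≡ true → T p
true⇒T refl = _

T⇒true : ∀ {p} → T p → p ≡ true
T⇒true {true} _ = refl

true-ext : ∀ {p q} → (p ≡ true → q ≡ true) → (q ≡ true → p ≡ true) → p ≡ q
true-ext {false} {false} _ _ = refl
true-ext {false} {true}  _ g with () ← g refl
true-ext {true}  {q}     f _ = sym (f refl)

≡ᵇ-true⁻ : (x ≡ᵇ y) ≡ true → x ≡ y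
≡ᵇ-true⁻ {x} {y} = ≡ᵇ⇒≡ x y ∘ true⇒T

≡ᵇ-true⁺ : x ≡ y → (x ≡ᵇ y) ≡ true
≡ᵇ-true⁺ {x} {y} = T⇒true ∘ ≡⇒≡ᵇ x y

<ᵇ-true⁻ : (x <ᵇ y) ≡ true → x < y
<ᵇ-true⁻ {x} {y} = <ᵇ⇒< x y ∘ true⇒T

any-true⁻ : (p : A → Bool) (xs : List A) → any p xs ≡ true → ∃ λ x → x ∈ xs × p x ≡ true
any-true⁻ p (x ∷ xs) eq with p x in px
... | true  = x , here refl , px
... | false with y , y∈ , py ← any-true⁻ p xs eq = y , there y∈ , py

any-true⁺ : (p : A → Bool) {xs : List A} {x : A} → x ∈ xs → p x ≡ true → any p xs ≡ true
any-true⁺ p (here refl) px rewrite px = refl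
any-true⁺ p {y ∷ _} (there x∈) px with p y
... | true  = refl
... | false = any-true⁺ p x∈ px

∈-filterᵇ⁺ : (p : A → Bool) {xs : List A} {x : A} → x ∈ xs → p x ≡ true → x ∈ filterᵇ p xs
∈-filterᵇ⁺ p x∈ px = ∈-filter⁺ (T? ∘ p) x∈ (true⇒T px)

∈-filterᵇ⁻ : (p : A → Bool) {xs : List A} {x : A} → x ∈ filterᵇ p xs → x ∈ xs × p x ≡ true
∈-filterᵇ⁻ p {xs} x∈ with y , q ← ∈-filter⁻ (T? ∘ p) {xs = xs} x∈ = y , T⇒true q

count-suc : (p : ℕ → Bool) → ∀ n → length (filterᵇ p (applyUpTo suc (suc n))) ≡
  length (filterᵇ p (applyUpTo suc n)) + length (filterᵇ p (suc n ∷ []))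
count-suc p n = trans (cong (length ∘ filterᵇ p) (sym (applyUpTo-∷ʳ suc n)))
  (trans (cong length (filter-++ (T? ∘ p) (applyUpTo suc n) (suc n ∷ [])))
         (length-++ (filterᵇ p (applyUpTo suc n))))

-- Truncated subtraction makes `(n ⊓ b) ∸ a` the right count of `(a , b]` among `1, …, n` also while
-- `n ≤ a`.
interval-suc : (p : ℕ → Bool) → a ≤ b →
  (∀ {y} → p y ≡ true → a < y × y ≤ b) → (∀ {y} → a < y → y ≤ b → p y ≡ true) →
  ∀ n → ((n ⊓ b) ∸ a) + length (filterᵇ p (suc n ∷ [])) ≡ (suc n ⊓ b) ∸ a
interval-suc {a} {b} p a≤b p⁻ p⁺ n with p (suc n) in eq
... | true  with a<n , n<b ← p⁻ eq
            rewrite m≤n⇒m⊓n≡m n<b | m≤n⇒m⊓n≡m (≤-trans (n≤1+n n) n<b)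
            = trans (+-comm (n ∸ a) 1) (sym (+-∸-assoc 1 (s≤s⁻¹ a<n)))
... | false with suc n ≤? a | suc n ≤? b
...   | yes n<a | yes n<b rewrite m≤n⇒m⊓n≡m n<b | m≤n⇒m⊓n≡m (≤-trans (n≤1+n n) n<b)
        | m≤n⇒m∸n≡0 n<a | m≤n⇒m∸n≡0 (≤-trans (n≤1+n n) n<a) = refl
...   | yes n<a | no ¬n<b = contradiction (≤-trans n<a a≤b) ¬n<b
...   | no ¬n<a | yes n<b with () ← trans (sym eq) (p⁺ (≰⇒> ¬n<a) n<b)
...   | no ¬n<a | no ¬n<b
        rewrite m≥n⇒m⊓n≡n (≤-trans (s≤s⁻¹ (≰⇒> ¬n<b)) (n≤1+n n)) | m≥n⇒m⊓n≡n (s≤s⁻¹ (≰⇒> ¬n<b))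
        = +-identityʳ _

count-interval : (p : ℕ → Bool) → a ≤ b →
  (∀ {y} → p y ≡ true → a < y × y ≤ b) → (∀ {y} → a < y → y ≤ b → p y ≡ true) →
  ∀ n → length (filterᵇ p (applyUpTo suc n)) ≡ (n ⊓ b) ∸ a
count-interval {a} p a≤b p⁻ p⁺ zero = sym (0∸n≡0 a)
count-interval {a} {b} p a≤b p⁻ p⁺ (suc n) =
  trans (count-suc p n)
  (trans (cong (_+ length (filterᵇ p (suc n ∷ []))) (count-interval p a≤b p⁻ p⁺ n))
         (interval-suc p a≤b p⁻ p⁺ n))

-- The cyclic scan

-- A scan from column b meets u before v.
Before : ℕ → ℕ → ℕ → Set
Before b u v = (u ≤ b × v < u) ⊎ (u ≤ b × b < v) ⊎ (b < u × b < v × v < u)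

-- The scan is `b, …, 1` followed by `N, …, b + 1`. Ordering all pairs reduces the question whether
-- a column is scanned before another to inequalities.
rightwardFrom-sorted : ∀ N b → AllPairs (Before b) (rightwardFrom N b)
rightwardFrom-sorted N b = AllPairs.++⁺
  (AllPairs.applyDownFrom⁺₁ suc b (λ j<i i<b → inj₁ (i<b , s≤s j<i)))
  (AllPairs.applyDownFrom⁺₁ _ (N ∸ b) (λ {i} {j} j<i _ →
    inj₂ (inj₂ (m<m+n b z<s , m<m+n b z<s , +-monoʳ-< b (s≤s j<i)))))
  (All.applyDownFrom⁺₁ suc b (λ i<b → All.applyDownFrom⁺₂ _ (N ∸ b) (λ j →
    inj₂ (inj₁ (i<b , m<m+n b z<s)))))

∈-rightwardFrom⁺ : ∀ {N} b → 1 ≤ y → y ≤ N → y ∈ rightwardFrom N b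
∈-rightwardFrom⁺ {suc y} {N} b _ y<N with suc y ≤? b
... | yes y<b = ∈-++⁺ˡ (∈-applyDownFrom⁺ suc y<b)
... | no ¬y<b = ∈-++⁺ʳ (applyDownFrom suc b)
  (subst (_∈ applyDownFrom (λ k → b + suc k) (N ∸ b))
         (trans (+-suc b _) (cong suc (m+[n∸m]≡n (s≤s⁻¹ (≰⇒> ¬y<b)))))
         (∈-applyDownFrom⁺ (λ k → b + suc k) (∸-monoˡ-< y<N (s≤s⁻¹ (≰⇒> ¬y<b)))))

∈-rightwardFrom⁻ : ∀ {N} b → b ≤ N → y ∈ rightwardFrom N b → 1 ≤ y × y ≤ N
∈-rightwardFrom⁻ {y} {N} b b≤N y∈ with ∈-++⁻ (applyDownFrom suc b) y∈
... | inj₁ y∈₁ with i , i<b , refl ← ∈-applyDownFrom⁻ suc y∈₁ = s≤s z≤n , ≤-trans i<b b≤N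
... | inj₂ y∈₂ with i , i<c , refl ← ∈-applyDownFrom⁻ (λ k → b + suc k) y∈₂
  = subst (1 ≤_) (sym (+-suc b i)) (s≤s z≤n)
  , subst (b + suc i ≤_) (m+[n∸m]≡n b≤N) (+-monoʳ-≤ b i<c)

sorted-split : ∀ {R : ℕ → ℕ → Set} t {rest} → AllPairs R (t ++ a ∷ rest) → y ∈ t ++ a ∷ rest →
  y ∈ t ⊎ y ≡ a ⊎ R a y
sorted-split [] (_ ∷ _) (here refl) = inj₂ (inj₁ refl)
sorted-split [] (Ra ∷ _) (there y∈) = inj₂ (inj₂ (All.lookup Ra y∈))
sorted-split (u ∷ t) (_ ∷ _) (here refl) = inj₁ (here refl)
sorted-split (u ∷ t) (_ ∷ ap) (there y∈) with sorted-split t ap y∈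
... | inj₁ y∈t = inj₁ (there y∈t)
... | inj₂ z   = inj₂ z

-- A scan from column b to column a passes over y.
Between : ℕ → ℕ → ℕ → Set
Between b a y = (a ≤ b × a < y × y ≤ b) ⊎ (b < a × (y ≤ b ⊎ a < y))

-- Every column occurs in the scan, hence before, at or after `a`; `Between` contradicts the last
-- two possibilities.
scanned-between : ∀ {N} t {rest} → rightwardFrom N b ≡ t ++ a ∷ rest → 1 ≤ y → y ≤ N →
  Between b a y → y ∈ t
scanned-between {b} {a} {y} {N} t {rest} eq 1≤y y≤N btw
  with sorted-split t (subst (AllPairs (Before b)) eq (rightwardFrom-sorted N b))
                      (subst (y ∈_) eq (∈-rightwardFrom⁺ b 1≤y y≤N))
... | inj₁ y∈t = y∈t
... | inj₂ (inj₁ refl) with btw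
...   | inj₁ (_ , a<a , _)      = contradiction a<a (<-irrefl refl)
...   | inj₂ (b<a , inj₁ a≤b)   = contradiction (<-≤-trans b<a a≤b) (<-irrefl refl)
...   | inj₂ (_ , inj₂ a<a)     = contradiction a<a (<-irrefl refl)
scanned-between t eq 1≤y y≤N btw | inj₂ (inj₂ bef) with btw | bef
... | inj₁ (_ , a<y , _) | inj₁ (_ , y<a)               = contradiction y<a (<-asym a<y)
... | inj₁ (_ , _ , y≤b) | inj₂ (inj₁ (_ , b<y))        = contradiction (<-≤-trans b<y y≤b) (<-irrefl refl)
... | inj₁ (a≤b , _)     | inj₂ (inj₂ (b<a , _))        = contradiction (<-≤-trans b<a a≤b) (<-irrefl refl)
... | inj₂ (b<a , _)     | inj₁ (a≤b , _)               = contradiction (<-≤-trans b<a a≤b) (<-irrefl refl)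
... | inj₂ (b<a , _)     | inj₂ (inj₁ (a≤b , _))        = contradiction (<-≤-trans b<a a≤b) (<-irrefl refl)
... | inj₂ (_ , inj₁ y≤b) | inj₂ (inj₂ (_ , b<y , _))   = contradiction (<-≤-trans b<y y≤b) (<-irrefl refl)
... | inj₂ (_ , inj₂ a<y) | inj₂ (inj₂ (_ , _ , y<a))   = contradiction y<a (<-asym a<y)

-- The cells traversed by a path that comes from column `a + d` and ends at `a` without wrapping.
down : ℕ → ℕ → List ℕ
down a d = applyDownFrom (λ k → a + suc k) d

∈-down⁻ : ∀ d → y ∈ down a d → a < y × y ≤ a + d
∈-down⁻ {a = a} d y∈ with i , i<d , refl ← ∈-applyDownFrom⁻ (λ k → a + suc k) y∈ = m<m+n a z<s , +-monoʳ-≤ a i<d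

∈-down⁺ : ∀ d → a < y → y ≤ a + d → y ∈ down a d
∈-down⁺ {a} {y} d a<y y≤a+d with k , refl ← m≤n⇒∃[o]m+o≡n a<y =
  subst (_∈ down a d) (+-suc a k) (∈-applyDownFrom⁺ (λ k → a + suc k) (+-cancelˡ-≤ a _ _ (subst (_≤ a + d) (sym (+-suc a k)) y≤a+d)))

applyDownFrom-suc-split : ∀ a d →
  applyDownFrom suc (suc a + d) ≡ down (suc a) d ++ suc a ∷ applyDownFrom suc a
applyDownFrom-suc-split a zero rewrite +-identityʳ a = refl
applyDownFrom-suc-split a (suc d) rewrite +-suc a d = cong (suc (suc (a + d)) ∷_) (applyDownFrom-suc-split a d)

rightwardFrom-split : ∀ N → 1 ≤ a → a ≤ b →
  ∃ λ rest → rightwardFrom N b ≡ down a (b ∸ a) ++ a ∷ rest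
rightwardFrom-split {suc a} {b} N _ a≤b =
  let ys = applyDownFrom (λ k → b + suc k) (N ∸ b) in
  applyDownFrom suc a ++ ys ,
  trans (cong (λ z → applyDownFrom suc z ++ ys) (sym (m+[n∸m]≡n a≤b)))
  (trans (cong (_++ ys) (applyDownFrom-suc-split a (b ∸ suc a)))
         (++-assoc (down (suc a) (b ∸ suc a)) _ ys))

scan-just⁻ : ∀ free xs {t} → scan free xs ≡ (t , just x) →
  ∃ λ rest → xs ≡ t ++ x ∷ rest × free x ≡ true × (∀ {y} → y ∈ t → free y ≡ false)
scan-just⁻ free (z ∷ xs) eq with free z in fz
scan-just⁻ free (z ∷ xs) refl | true = xs , refl , fz , λ ()
scan-just⁻ free (z ∷ xs) eq | false with scan free xs in sc
scan-just⁻ free (z ∷ xs) refl | false | t , just x with rest , p , q , nf ← scan-just⁻ free xs sc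
  = rest , cong (z ∷_) p , q , λ { (here refl) → fz ; (there y∈) → nf y∈ }

scan-nothing⁻ : ∀ free xs {t} → scan free xs ≡ (t , nothing) → y ∈ xs → free y ≡ false
scan-nothing⁻ free (z ∷ xs) eq y∈ with free z in fz
scan-nothing⁻ free (z ∷ xs) eq (here refl) | false = fz
scan-nothing⁻ free (z ∷ xs) eq (there y∈)  | false = scan-nothing⁻ free xs (cong₂ _,_ refl (cong proj₂ eq)) y∈

scan-just⁺ : ∀ free t {rest} → free x ≡ true → (∀ {y} → y ∈ t → free y ≡ false) →
  scan free (t ++ x ∷ rest) ≡ (t , just x)
scan-just⁺ free [] fx nf rewrite fx = refl
scan-just⁺ {x} free (z ∷ t) {rest} fx nf rewrite nf (here {x = z} {xs = t} refl) =
  cong (λ (t' , x') → z ∷ t' , x') (scan-just⁺ free t {rest} fx (nf ∘ there))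

-- Labeled balls

Labels : Set
Labels = List (ℕ × ℕ × ℕ)

labelOf-here : ∀ (ls : Labels) → labelOf ((r , x , l) ∷ ls) r x ≡ just l
labelOf-here {r} {x} ls rewrite ≡ᵇ-true⁺ {r} refl | ≡ᵇ-true⁺ {x} refl = refl

labelOf-there : ∀ (ls : Labels) {r x r' x'} → ¬ (r' ≡ r × x' ≡ x) →
  labelOf ((r' , x' , l) ∷ ls) r x ≡ labelOf ls r x
labelOf-there ls {r} {x} {r'} {x'} ne with (r' ≡ᵇ r) ∧ (x' ≡ᵇ x) in eq
... | false = refl
... | true with p , q ← ∧-true⁻ {r' ≡ᵇ r} eq = contradiction (≡ᵇ-true⁻ p , ≡ᵇ-true⁻ q) ne

labelOf-cons⁻ : ∀ (ls : Labels) {r x r' x'} → labelOf ((r' , x' , l) ∷ ls) r x ≡ just m →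
  (r' ≡ r × x' ≡ x × l ≡ m) ⊎ labelOf ls r x ≡ just m
labelOf-cons⁻ ls {r} {x} {r'} {x'} h with (r' ≡ᵇ r) ∧ (x' ≡ᵇ x) in eq
labelOf-cons⁻ ls h | false = inj₂ h
labelOf-cons⁻ ls {r} {x} {r'} {x'} refl | true
  with p , q ← ∧-true⁻ {r' ≡ᵇ r} eq = inj₁ (≡ᵇ-true⁻ p , ≡ᵇ-true⁻ q , refl)

-- `labelOf` reads the newest entry of a cell, so an old label is safe only because new labels go to
-- unlabeled cells.
labelOf-persists : ∀ (ls : Labels) {r x r' x'} → labelOf ls r' x' ≡ nothing → labelOf ls r x ≡ just m →
  labelOf ((r' , x' , l) ∷ ls) r x ≡ just m
labelOf-persists ls {r} {x} {r'} {x'} un h =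
  trans (labelOf-there ls {r} {x} {r'} {x'} (λ { (refl , refl) → contradiction (trans (sym un) h) (λ ()) })) h

labelOf-uncons : ∀ (ls : Labels) {r x r' x'} → labelOf ls r' x' ≡ nothing →
  labelOf ((r' , x' , l) ∷ ls) r x ≡ nothing → labelOf ls r x ≡ nothing
labelOf-uncons ls {r} {x} {r'} {x'} un un' = go (labelOf ls r x) refl
  where
  go : ∀ v → labelOf ls r x ≡ v → v ≡ nothing
  go nothing  _ = refl
  go (just m) e = contradiction (trans (sym un') (labelOf-persists ls {r} {x} {r'} {x'} un e)) (λ ())

-- Definitionally the predicate scanned by `pathFrom` and used by `stage` to choose its starts, now
-- with a name.
free : List (List Bool) → Labels → ℕ → ℕ → Bool
free Q ls r x = ball Q r x ∧ not (isLabeled ls r x)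

free-true⁻ : ∀ Q ls r x → free Q ls r x ≡ true → ball Q r x ≡ true × labelOf ls r x ≡ nothing
free-true⁻ Q ls r x eq with ball Q r x | labelOf ls r x
... | true | nothing = refl , refl

free-true⁺ : ∀ Q ls r x → ball Q r x ≡ true → labelOf ls r x ≡ nothing → free Q ls r x ≡ true
free-true⁺ Q ls r x b n with ball Q r x | labelOf ls r x
... | true | nothing = refl

free-false⁻ : ∀ Q ls r x → free Q ls r x ≡ false → ball Q r x ≡ false ⊎ ∃ λ m → labelOf ls r x ≡ just m
free-false⁻ Q ls r x eq with ball Q r x | labelOf ls r x
... | false | _      = inj₁ refl
... | true  | just m = inj₂ (m , refl)

free-false⁺ : ∀ Q ls r x → (ball Q r x ≡ true → labelOf ls r x ≡ nothing → ⊥) → free Q ls r x ≡ false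
free-false⁺ Q ls r x h with ball Q r x | labelOf ls r x
... | false | _       = refl
... | true  | just m  = refl
... | true  | nothing = ⊥-elim (h refl refl)

starts : List (List Bool) → ℕ → Labels → ℕ → List ℕ
starts Q N ls l = filterᵇ (free Q ls l) (leftToRight N)

∈-leftToRight⁺ : ∀ {N} → 1 ≤ x → x ≤ N → x ∈ leftToRight N
∈-leftToRight⁺ {suc x} _ x<N = ∈-applyDownFrom⁺ suc x<N

∈-starts⁺ : ∀ Q N ls l → 1 ≤ x → x ≤ N → ball Q l x ≡ true → labelOf ls l x ≡ nothing → x ∈ starts Q N ls l
∈-starts⁺ {x} Q N ls l 1≤x x≤N b un = ∈-filterᵇ⁺ (free Q ls l) (∈-leftToRight⁺ 1≤x x≤N) (free-true⁺ Q ls l x b un)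

∈-starts⁻ : ∀ Q N ls l → x ∈ starts Q N ls l → (1 ≤ x × x ≤ N) × ball Q l x ≡ true × labelOf ls l x ≡ nothing
∈-starts⁻ {x} Q N ls l x∈ with x∈₁ , f ← ∈-filterᵇ⁻ (free Q ls l) {leftToRight N} x∈
  with i , i<N , refl ← ∈-applyDownFrom⁻ suc x∈₁ = (s≤s z≤n , i<N) , free-true⁻ Q ls l _ f

starts-unique : ∀ Q N ls l → Unique (starts Q N ls l)
starts-unique Q N ls l = Unique.filter⁺ (T? ∘ free Q ls l)
  (Unique.applyDownFrom⁺₁ suc N (λ j<i _ eq → <-irrefl (sym (suc-injective eq)) j<i))

-- Unfolding `applyUpTo suc L` changes the function at every step; here the number of the next stage
-- is plainly the head.
upFrom : ℕ → ℕ → List ℕ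
upFrom l zero    = []
upFrom l (suc d) = l ∷ upFrom (suc l) d

applyUpTo-upFrom : ∀ l d (f : ℕ → ℕ) → (∀ i → f i ≡ l + i) → applyUpTo f d ≡ upFrom l d
applyUpTo-upFrom l zero    f eq = refl
applyUpTo-upFrom l (suc d) f eq = cong₂ _∷_ (trans (eq 0) (+-identityʳ l))
  (applyUpTo-upFrom (suc l) d (f ∘ suc) (λ i → trans (eq (suc i)) (+-suc l i)))

-- Cells labeled once stage l has reached row ρ.
Cell : ℕ → ℕ → ℕ → ℕ → ℕ → Set
Cell L l ρ m r = 1 ≤ m × m ≤ r × r ≤ L × (m < l ⊎ (m ≡ l × r ≤ ρ))

module _ {L : ℕ} where

  cell-suc⁻ : Cell L l (suc ρ) m r → Cell L l ρ m r ⊎ (m ≡ l × r ≡ suc ρ)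
  cell-suc⁻ (p , q , s , inj₁ m<l) = inj₁ (p , q , s , inj₁ m<l)
  cell-suc⁻ {ρ = ρ} {r = r} (p , q , s , inj₂ (m≡l , r≤)) with r ≤? ρ
  ... | yes r≤ρ = inj₁ (p , q , s , inj₂ (m≡l , r≤ρ))
  ... | no ¬r≤ρ = inj₂ (m≡l , ≤-antisym r≤ (≰⇒> ¬r≤ρ))

  cell-suc⁺ : Cell L l ρ m r → Cell L l (suc ρ) m r
  cell-suc⁺ (p , q , s , inj₁ m<l) = p , q , s , inj₁ m<l
  cell-suc⁺ (p , q , s , inj₂ (m≡l , r≤)) = p , q , s , inj₂ (m≡l , ≤-trans r≤ (n≤1+n _))

  cell-not-new : Cell L l ρ m r → ¬ (m ≡ l × r ≡ suc ρ)
  cell-not-new (_ , _ , _ , inj₁ m<l)      (refl , _) = <-irrefl refl m<l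
  cell-not-new (_ , _ , _ , inj₂ (_ , r≤)) (_ , refl) = <-irrefl refl r≤

  cell-in-new-row : Cell L l ρ m (suc ρ) → m < l
  cell-in-new-row (_ , _ , _ , inj₁ m<l)      = m<l
  cell-in-new-row (_ , _ , _ , inj₂ (_ , r≤)) = contradiction r≤ (<-irrefl refl)

  cell-up : m ≤ r → Cell L l ρ m (suc r) → Cell L l ρ m r
  cell-up m≤r (p , _ , s , inj₁ m<l) = p , m≤r , ≤-trans (n≤1+n _) s , inj₁ m<l
  cell-up m≤r (p , _ , s , inj₂ (e , r<)) = p , m≤r , ≤-trans (n≤1+n _) s , inj₂ (e , ≤-trans (n≤1+n _) r<)

  cell-label≤ : Cell L l ρ m r → m ≤ l
  cell-label≤ (_ , _ , _ , inj₁ m<l) = <⇒≤ m<l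
  cell-label≤ (_ , _ , _ , inj₂ (refl , _)) = ≤-refl

  -- Stage `suc l` begins at height `ρ = l`: a cell of label `suc l` lies in row `suc l` or later,
  -- so none is labeled yet.
  cell-next-stage⁺ : Cell L l L m r → Cell L (suc l) l m r
  cell-next-stage⁺ c@(p , q , s , _) = p , q , s , inj₁ (s≤s (cell-label≤ c))

  cell-next-stage⁻ : Cell L (suc l) l m r → Cell L l L m r
  cell-next-stage⁻ {l} {m} (p , q , s , inj₁ m≤l) with m ≟ l
  ... | yes e = p , q , s , inj₂ (e , s)
  ... | no ne = p , q , s , inj₁ (≤∧≢⇒< (s≤s⁻¹ m≤l) ne)
  cell-next-stage⁻ (p , q , s , inj₂ (refl , r≤l)) = contradiction (≤-trans q r≤l) (<-irrefl refl)

upd : (ℕ → ℕ → ℕ) → ℕ → ℕ → ℕ → ℕ → ℕ → ℕ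
upd pos l ρ x m r with m ≟ l | r ≟ ρ
... | yes _ | yes _ = x
... | _     | _     = pos m r

upd-new : ∀ pos l ρ x → upd pos l ρ x l ρ ≡ x
upd-new pos l ρ x with l ≟ l | ρ ≟ ρ
... | yes _ | yes _ = refl
... | no ne | _     = contradiction refl ne
... | yes _ | no ne = contradiction refl ne

upd-old : ∀ pos l ρ x → ¬ (m ≡ l × r ≡ ρ) → upd pos l ρ x m r ≡ pos m r
upd-old {m} {r} pos l ρ x ne with m ≟ l | r ≟ ρ
... | yes e | yes e' = contradiction (e , e') ne
... | no _  | _      = refl
... | yes _ | no _   = refl

-- Invariants of the bully path labeling

module Labeling (Q : List (List Bool)) (L N : ℕ) where

  runPaths : ℕ → St → List ℕ → St
  runPaths l = foldl (λ s j → pathFrom Q N l (L ∸ l) l j s)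

  stageOn : ℕ → St → List ℕ → St
  stageOn l s xs = runPaths l (st (map (λ j → l , j , l) xs ++ labs s) (trav s)) xs

  -- Paths and stages change the labels only by such additions, so a stable predicate passes through
  -- all of them.
  Stable : ℕ → (Labels → Set) → Set
  Stable l P = ∀ ls r x → labelOf ls r x ≡ nothing → P ls → P ((r , x , l) ∷ ls)

  pathFrom-pres : ∀ P → Stable l P → ∀ k r j s → P (labs s) → P (labs (pathFrom Q N l k r j s))
  pathFrom-pres P S zero    r j s p = p
  pathFrom-pres P S (suc k) r j (st ls tr) p with scan (free Q ls (suc r)) (rightwardFrom N j) in eq
  ... | t , nothing = p
  ... | t , just x with _ , _ , fx , _ ← scan-just⁻ _ (rightwardFrom N j) eq =
    pathFrom-pres P S k (suc r) x _ (S ls (suc r) x (proj₂ (free-true⁻ Q ls (suc r) x fx)) p)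

  runPaths-pres : ∀ P → Stable l P → ∀ s xs → P (labs s) → P (labs (runPaths l s xs))
  runPaths-pres P S s []       p = p
  runPaths-pres {l} P S s (x ∷ xs) p = runPaths-pres P S _ xs (pathFrom-pres P S (L ∸ l) l x s p)

  labelOf-starts : ∀ {ls} xs → All (λ z → x ≢ z) xs → labelOf ls l x ≡ nothing →
    labelOf (map (λ j → l , j , l) xs ++ ls) l x ≡ nothing
  labelOf-starts [] _ un = un
  labelOf-starts {x} {l} {ls} (z ∷ xs) (ne ∷ nes) un =
    trans (labelOf-there (map (λ j → l , j , l) xs ++ ls) {l} {x} {l} {z} (λ (_ , e) → ne (sym e)))
          (labelOf-starts xs nes un)

  -- `stage` labels all its starts in one go. Adding them one by one from the end, uniqueness keeps
  -- each unlabeled until its turn.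
  starts-pres : ∀ P {ls} → Stable l P → ∀ xs → Unique xs → (∀ {x} → x ∈ xs → labelOf ls l x ≡ nothing) →
    P ls → P (map (λ j → l , j , l) xs ++ ls)
  starts-pres P S [] _ un p = p
  starts-pres P S (x ∷ xs) (x≢ ∷ u) un p =
    S _ _ x (labelOf-starts xs x≢ (un (here refl))) (starts-pres P S xs u (un ∘ there) p)

  stage-pres : ∀ P → Stable l P → ∀ s → P (labs s) → P (labs (stage Q L N s l))
  stage-pres {l} P S s p = runPaths-pres P S _ (starts Q N (labs s) l)
    (starts-pres P S _ (starts-unique Q N (labs s) l) (proj₂ ∘ proj₂ ∘ ∈-starts⁻ Q N (labs s) l) p)

  stages-pres : ∀ P → (∀ {l} → Stable l P) → ∀ s xs → P (labs s) → P (labs (foldl (stage Q L N) s xs))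
  stages-pres P S s []       p = p
  stages-pres P S s (l ∷ xs) p = stages-pres P S _ xs (stage-pres P S s p)

  Full : ℕ → Labels → Set
  Full r ls = ∀ {x} → 1 ≤ x → x ≤ N → ball Q r x ≡ true → ∃ λ m → labelOf ls r x ≡ just m

  Absent : ℕ → Labels → Set
  Absent m ls = ∀ {r x} → labelOf ls r x ≢ just m

  full-stable : Stable l (Full r)
  full-stable {l} {r} ls r' x' un full 1≤x x≤N b with m , e ← full 1≤x x≤N b =
    m , labelOf-persists ls {r} {_} {r'} {x'} un e

  absent-stable : l ≢ m → Stable l (Absent m)
  absent-stable l≢m ls r' x' un abs {r} {x} e with labelOf-cons⁻ ls {r} {x} {r'} {x'} e
  ... | inj₁ (_ , _ , l≡m) = l≢m l≡m
  ... | inj₂ e'            = abs e'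

  label-stable : Stable l (λ ls → labelOf ls r x ≡ just m)
  label-stable {l} {r} {x} ls r' x' un e = labelOf-persists ls {r} {x} {r'} {x'} un e

  -- A row without unlabeled balls starts no path, so its label never occurs.
  Dead : ℕ → Labels → Set
  Dead r ls = Full r ls × Absent r ls

  -- At stage `r` a full row offers no start and nothing changes; every other stage adds only labels
  -- different from `r`.
  dead-stage : ∀ s l → Dead r (labs s) → Dead r (labs (stage Q L N s l))
  dead-stage {r} s l (full , abs) with l ≟ r
  ... | no l≢r   = stage-pres (Full r) full-stable s full , stage-pres (Absent r) (absent-stable l≢r) s abs
  ... | yes refl = subst (λ xs → Dead l (labs (stageOn l s xs))) (sym (no-starts _ refl)) (full , abs)
    where
    no-starts : ∀ xs → xs ≡ starts Q N (labs s) l → xs ≡ []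
    no-starts []       _  = refl
    no-starts (x ∷ xs) eq
      with (1≤x , x≤N) , b , un ← ∈-starts⁻ {x} Q N (labs s) l (subst (x ∈_) eq (here refl))
      with m , e ← full 1≤x x≤N b = contradiction (trans (sym un) e) (λ ())

  dead-stages : ∀ s xs → Dead r (labs s) → Dead r (labs (foldl (stage Q L N) s xs))
  dead-stages s []       d = d
  dead-stages s (l ∷ xs) d = dead-stages (stage Q L N s l) xs (dead-stage s l d)

  -- The cyclic scan visits every column, so its failure testifies for the whole row.
  scan-nothing⇒full : ∀ {t} ls r j → scan (free Q ls r) (rightwardFrom N j) ≡ (t , nothing) → Full r ls
  scan-nothing⇒full ls r j eq {x} 1≤x x≤N b
    with free-false⁻ Q ls r x (scan-nothing⁻ _ _ eq (∈-rightwardFrom⁺ j 1≤x x≤N))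
  ... | inj₁ nb = contradiction (trans (sym nb) b) (λ ())
  ... | inj₂ e  = e

  -- The last conjunct, that the final ball was unlabeled before, separates the ends of two paths of
  -- the same stage.
  path-outcome : ∀ l k ρ j s {R} → ρ + suc k ≡ R → j ≤ N →
    let s' = pathFrom Q N l (suc k) ρ j s in
    (∃ λ r → ρ < r × r ≤ R × Full r (labs s')) ⊎
    (∃ λ x → (1 ≤ x × x ≤ N) × ball Q R x ≡ true × labelOf (labs s') R x ≡ just l × labelOf (labs s) R x ≡ nothing)
  path-outcome l k ρ j (st ls tr) R≡ j≤N with scan (free Q ls (suc ρ)) (rightwardFrom N j) in eq
  ... | t , nothing = inj₁ (suc ρ , ≤-refl , subst (suc ρ ≤_) R≡ (m<m+n ρ z<s) , scan-nothing⇒full ls (suc ρ) j eq)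
  path-outcome l zero ρ j (st ls tr) R≡ j≤N | t , just x
    with rest , sp , fx , _ ← scan-just⁻ _ (rightwardFrom N j) eq
    with b , un ← free-true⁻ Q ls (suc ρ) x fx
    rewrite trans (sym R≡) (trans (+-suc ρ 0) (cong suc (+-identityʳ ρ)))
    = inj₂ (x , ∈-rightwardFrom⁻ j j≤N (subst (x ∈_) (sym sp) (∈-++⁺ʳ t (here refl))) , b , labelOf-here {suc ρ} {x} {l} ls , un)
  path-outcome l (suc k) ρ j (st ls tr) {R} R≡ j≤N | t , just x
    with rest , sp , fx , _ ← scan-just⁻ _ (rightwardFrom N j) eq
    with b , un ← free-true⁻ Q ls (suc ρ) x fx
    with path-outcome l k (suc ρ) x (st ((suc ρ , x , l) ∷ ls) (tr ++ map (λ y → l , suc ρ , y) t)) {R}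
           (trans (sym (+-suc ρ (suc k))) R≡) (proj₂ (∈-rightwardFrom⁻ j j≤N (subst (x ∈_) (sym sp) (∈-++⁺ʳ t (here refl)))))
  ... | inj₁ (r , lt , le , full) = inj₁ (r , <⇒≤ lt , le , full)
  ... | inj₂ (x' , rg , b' , e , un') = inj₂ (x' , rg , b' , e , labelOf-uncons ls {R} {x'} {suc ρ} {x} un un')

  -- At stage `m` a ball already matched in row `suc r` has an earlier label; hence the bound
  -- `m' < m` on the skipped balls.
  Step : (ℕ → ℕ → ℕ) → ℕ → ℕ → Set
  Step pos m r = ∃ λ t → ∃ λ rest → rightwardFrom N (pos m r) ≡ t ++ pos m (suc r) ∷ rest ×
    (∀ {y} → y ∈ t → ball Q (suc r) y ≡ false ⊎ ∃ λ m' → 1 ≤ m' × m' < m × y ≡ pos m' (suc r))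

  record Invariant (l ρ : ℕ) (pos : ℕ → ℕ → ℕ) (ls : Labels) : Set where
    field
      label : ∀ {m r} → Cell L l ρ m r → labelOf ls r (pos m r) ≡ just m
      cell  : ∀ {m r x} → labelOf ls r x ≡ just m → Cell L l ρ m r × x ≡ pos m r
      range : ∀ {m r} → Cell L l ρ m r → 1 ≤ pos m r × pos m r ≤ N
      balls : ∀ {m r} → Cell L l ρ m r → ball Q r (pos m r) ≡ true
      step  : ∀ {m r} → m ≤ r → Cell L l ρ m (suc r) → Step pos m r
  open Invariant public

  -- Serves both the start of a path, where `l ≡ suc ρ` and no step leads to the ball, and its
  -- continuation, where `l ≤ ρ` and the scan is recorded.
  extend : ∀ {pos ls} → 1 ≤ l → l ≤ suc ρ → suc ρ ≤ L → Invariant l ρ pos ls →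
    labelOf ls (suc ρ) x ≡ nothing → 1 ≤ x × x ≤ N → ball Q (suc ρ) x ≡ true →
    (l ≤ ρ → ∃ λ t → ∃ λ rest → rightwardFrom N (pos l ρ) ≡ t ++ x ∷ rest ×
      (∀ {y} → y ∈ t → ball Q (suc ρ) y ≡ false ⊎ ∃ λ m → labelOf ls (suc ρ) y ≡ just m)) →
    Invariant l (suc ρ) (upd pos l (suc ρ) x) ((suc ρ , x , l) ∷ ls)
  extend {l} {ρ} {x} {pos} {ls} 1≤l l≤ρ ρ≤L inv un rg b stp = record
    { label = label' ; cell = cell' ; range = range' ; balls = balls' ; step = step' }
    where
    pos' = upd pos l (suc ρ) x

    old : ∀ {m r} → ¬ (m ≡ l × r ≡ suc ρ) → pos' m r ≡ pos m r
    old = upd-old pos l (suc ρ) x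

    new : pos' l (suc ρ) ≡ x
    new = upd-new pos l (suc ρ) x

    label' : ∀ {m r} → Cell L l (suc ρ) m r → labelOf ((suc ρ , x , l) ∷ ls) r (pos' m r) ≡ just m
    label' {m} {r} c with cell-suc⁻ c
    ... | inj₁ c'            = subst (λ z → labelOf ((suc ρ , x , l) ∷ ls) r z ≡ just m) (sym (old (cell-not-new c')))
                                 (labelOf-persists ls {r} {pos m r} {suc ρ} {x} un (label inv c'))
    ... | inj₂ (refl , refl) = subst (λ z → labelOf ((suc ρ , x , l) ∷ ls) r z ≡ just m) (sym new)
                                 (labelOf-here {suc ρ} {x} {l} ls)

    cell' : ∀ {m r y} → labelOf ((suc ρ , x , l) ∷ ls) r y ≡ just m → Cell L l (suc ρ) m r × y ≡ pos' m r
    cell' {m} {r} {y} e with labelOf-cons⁻ ls {r} {y} {suc ρ} {x} e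
    ... | inj₁ (refl , refl , refl) = (1≤l , l≤ρ , ρ≤L , inj₂ (refl , ≤-refl)) , sym new
    ... | inj₂ e' with c , y≡ ← cell inv e' = cell-suc⁺ c , trans y≡ (sym (old (cell-not-new c)))

    range' : ∀ {m r} → Cell L l (suc ρ) m r → 1 ≤ pos' m r × pos' m r ≤ N
    range' c with cell-suc⁻ c
    ... | inj₁ c'            = subst (λ z → 1 ≤ z × z ≤ N) (sym (old (cell-not-new c'))) (range inv c')
    ... | inj₂ (refl , refl) = subst (λ z → 1 ≤ z × z ≤ N) (sym new) rg

    balls' : ∀ {m r} → Cell L l (suc ρ) m r → ball Q r (pos' m r) ≡ true
    balls' {m} {r} c with cell-suc⁻ c
    ... | inj₁ c'            = trans (cong (ball Q r) (old (cell-not-new c'))) (balls inv c')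
    ... | inj₂ (refl , refl) = trans (cong (ball Q r) new) b

    step' : ∀ {m r} → m ≤ r → Cell L l (suc ρ) m (suc r) → Step pos' m r
    step' {m} {r} m≤r c with cell-suc⁻ c
    ... | inj₁ c' with t , rest , sp , h ← step inv m≤r c' =
          t , rest ,
          subst₂ (λ u v → rightwardFrom N u ≡ t ++ v ∷ rest)
            (sym (old (cell-not-new (cell-up m≤r c')))) (sym (old (cell-not-new c'))) sp ,
          λ y∈ → earlier (h y∈)
      where
      earlier : ∀ {y} → ball Q (suc r) y ≡ false ⊎ (∃ λ m' → 1 ≤ m' × m' < m × y ≡ pos m' (suc r)) →
                ball Q (suc r) y ≡ false ⊎ (∃ λ m' → 1 ≤ m' × m' < m × y ≡ pos' m' (suc r))
      earlier (inj₁ nb) = inj₁ nb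
      earlier (inj₂ (m' , p , m'<m , e)) = inj₂ (m' , p , m'<m ,
        trans e (sym (old (λ (m'≡l , _) → <⇒≢ (<-≤-trans m'<m (cell-label≤ c')) m'≡l))))
    ... | inj₂ (refl , refl) with t , rest , sp , h ← stp m≤r =
          t , rest ,
          subst₂ (λ u v → rightwardFrom N u ≡ t ++ v ∷ rest)
            (sym (old (λ (_ , e) → <-irrefl e ≤-refl))) (sym new) sp ,
          λ y∈ → labeled (h y∈)
      where
      labeled : ∀ {y} → ball Q (suc r) y ≡ false ⊎ (∃ λ m → labelOf ls (suc r) y ≡ just m) →
                ball Q (suc r) y ≡ false ⊎ (∃ λ m' → 1 ≤ m' × m' < m × y ≡ pos' m' (suc r))
      labeled (inj₁ nb) = inj₁ nb
      labeled (inj₂ (m' , e)) with c' , y≡ ← cell inv e =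
        inj₂ (m' , proj₁ c' , cell-in-new-row c' ,
              trans y≡ (sym (old (λ (e' , _) → <⇒≢ (cell-in-new-row c') e'))))

  next-stage : ∀ {pos ls} → Invariant l L pos ls → Invariant (suc l) l pos ls
  next-stage inv = record
    { label = label inv ∘ cell-next-stage⁻
    ; cell  = λ e → let c , p = cell inv e in cell-next-stage⁺ c , p
    ; range = range inv ∘ cell-next-stage⁻
    ; balls = balls inv ∘ cell-next-stage⁻
    ; step  = λ m≤r → step inv m≤r ∘ cell-next-stage⁻ }

  -- A stuck path cannot be refuted from the labeling alone. The full row that it leaves behind is
  -- passed on, to be refuted by means of the type.
  path-invariant : ∀ k {ρ j pos ls} tr → 1 ≤ l → l ≤ ρ → ρ + k ≡ L → j ≡ pos l ρ → Invariant l ρ pos ls →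
    let s' = pathFrom Q N l k ρ j (st ls tr) in
    (∃ λ r → l < r × r ≤ L × Full r (labs s')) ⊎ (∃ λ pos' → Invariant l L pos' (labs s'))
  path-invariant {l} zero {ρ} {pos = pos} {ls} tr 1≤l l≤ρ L≡ j≡ inv =
    inj₂ (pos , subst (λ z → Invariant l z pos ls) (trans (sym (+-identityʳ ρ)) L≡) inv)
  path-invariant {l} (suc k) {ρ} {j} {pos} {ls} tr 1≤l l≤ρ L≡ j≡ inv
    with scan (free Q ls (suc ρ)) (rightwardFrom N j) in eq
  ... | t , nothing = inj₁ (suc ρ , s≤s l≤ρ , ρ<L , scan-nothing⇒full ls (suc ρ) j eq)
    where
    ρ<L : ρ < L
    ρ<L = subst (ρ <_) L≡ (m<m+n ρ z<s)
  ... | t , just x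
    with rest , sp , fx , nf ← scan-just⁻ _ (rightwardFrom N j) eq
    with b , un ← free-true⁻ Q ls (suc ρ) x fx =
    path-invariant k (tr ++ map (λ y → l , suc ρ , y) t) 1≤l (≤-trans l≤ρ (n≤1+n ρ))
      (trans (sym (+-suc ρ k)) L≡) (sym (upd-new pos l (suc ρ) x))
      (extend 1≤l (≤-trans l≤ρ (n≤1+n ρ)) ρ<L inv un
        (∈-rightwardFrom⁻ j (subst (_≤ N) (sym j≡) (proj₂ (range inv (1≤l , l≤ρ , <⇒≤ ρ<L , inj₂ (refl , ≤-refl)))))
          (subst (x ∈_) (sym sp) (∈-++⁺ʳ t (here refl))))
        b
        (λ _ → t , rest , subst (λ z → rightwardFrom N z ≡ t ++ x ∷ rest) j≡ sp ,
               λ {y} y∈ → free-false⁻ Q ls (suc ρ) y (nf y∈)))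
    where
    ρ<L : ρ < L
    ρ<L = subst (ρ <_) L≡ (m<m+n ρ z<s)

-- pos i r is the column of the ball labeled i in row r.
record LabeledTable (Q : List (List Bool)) (L N : ℕ) (pos : ℕ → ℕ → ℕ) : Set where
  field
    in-range  : ∀ {i r} → 1 ≤ i → i ≤ r → r ≤ L → 1 ≤ pos i r × pos i r ≤ N
    is-ball   : ∀ {i r} → 1 ≤ i → i ≤ r → r ≤ L → ball Q r (pos i r) ≡ true
    all-balls : ∀ {r x} → 1 ≤ r → r ≤ L → 1 ≤ x → x ≤ N → ball Q r x ≡ true →
                ∃ λ i → 1 ≤ i × i ≤ r × x ≡ pos i r
    injective : ∀ {i j r} → 1 ≤ i → i ≤ r → 1 ≤ j → j ≤ r → r ≤ L → pos i r ≡ pos j r → i ≡ j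
    stepping  : ∀ {i r} → 1 ≤ i → i ≤ r → suc r ≤ L → ∃ λ t → ∃ λ rest →
                rightwardFrom N (pos i r) ≡ t ++ pos i (suc r) ∷ rest ×
                (∀ {j} → i < j → j ≤ suc r → pos j (suc r) ∉ t)

-- One complete path from every row, forced by the type

module FromType (Q : List (List Bool)) (L N : ℕ) (c : ℕ → ℕ)
  (typed⁺ : ∀ {j} → 1 ≤ j → j ≤ L → labelOf (labs (bully Q L N)) L (c j) ≡ just j)
  (typed⁻ : ∀ {j x} → 1 ≤ x → x ≤ N → ball Q L x ≡ true → labelOf (labs (bully Q L N)) L x ≡ just j → x ≡ c j)
  where

  open Labeling Q L N

  private
    final : Labels
    final = labs (bully Q L N)

    -- The list holds the stages still to come; the equation carries a conflict found midway to the
    -- final labels, which the type describes.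
    Completes : St → List ℕ → Set
    Completes s xs = labs (foldl (stage Q L N) s xs) ≡ final

  -- Label `r` ends up at column `c r` of the last row, whereas deadness would keep it absent
  -- throughout.
  not-dead : ∀ {s} xs → Completes s xs → 1 ≤ r → r ≤ L → ¬ Dead r (labs s)
  not-dead {r} {s} xs compl 1≤r r≤L dead =
    proj₂ (dead-stages s xs dead) {L} {c r} (trans (cong (λ ls → labelOf ls L (c r)) compl) (typed⁺ 1≤r r≤L))

  not-twice : ∀ {s} xs → Completes s xs → (1 ≤ x × x ≤ N) → (1 ≤ y × y ≤ N) → ball Q L x ≡ true → ball Q L y ≡ true →
    labelOf (labs s) L x ≡ just l → labelOf (labs s) L y ≡ just l → x ≡ y
  not-twice {x} {y} {l} {s} xs compl (1≤x , x≤N) (1≤y , y≤N) bx by ex ey =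
    trans (typed⁻ 1≤x x≤N bx (survives ex)) (sym (typed⁻ 1≤y y≤N by (survives ey)))
    where
    survives : ∀ {z} → labelOf (labs s) L z ≡ just l → labelOf final L z ≡ just l
    survives {z} e = trans (cong (λ ls → labelOf ls L z) (sym compl))
      (stages-pres (λ ls → labelOf ls L z ≡ just l) (λ {l'} → label-stable {l'} {L} {z} {l}) s xs e)

  path-outcome-L : ∀ j s → l < L → j ≤ N →
    let s' = pathFrom Q N l (L ∸ l) l j s in
    (∃ λ r → l < r × r ≤ L × Full r (labs s')) ⊎
    (∃ λ x → (1 ≤ x × x ≤ N) × ball Q L x ≡ true × labelOf (labs s') L x ≡ just l × labelOf (labs s) L x ≡ nothing)
  path-outcome-L {l} j s l<L j≤N with k , refl ← m≤n⇒∃[o]m+o≡n l<L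
    rewrite trans (cong (_∸ l) (sym (+-suc l k))) (m+n∸m≡n l (suc k)) = path-outcome l k l j s (+-suc l k) j≤N

  -- If one of the first two paths gets stuck, a later row ends dead. If both reach row `L`, label
  -- `l` occurs there twice; for `l ≡ L` the two starts themselves are these occurrences.
  no-second-start : ∀ {ls tr} x y zs xs → 1 ≤ l → l ≤ L → (∀ {r} → l < r → Absent r ls) →
    x ∷ y ∷ zs ≡ starts Q N ls l → ¬ Completes (stageOn l (st ls tr) (x ∷ y ∷ zs)) xs
  no-second-start {l} {ls} {tr} x y zs xs 1≤l l≤L abs eq compl with l ≟ L
  ... | yes refl = All.lookup x≢ (here refl)
                     (not-twice xs compl (rg-x) (rg-y) (proj₁ bu-x) (proj₁ bu-y)
                       (kept x e-x) (kept y e-y))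
    where
    ss = x ∷ y ∷ zs
    in-starts : ∀ {z} → z ∈ ss → (1 ≤ z × z ≤ N) × ball Q l z ≡ true × labelOf ls l z ≡ nothing
    in-starts {z} z∈ = ∈-starts⁻ Q N ls l (subst (z ∈_) eq z∈)
    uniq : Unique ss
    uniq = subst Unique (sym eq) (starts-unique Q N ls l)
    x≢ : All (x ≢_) (y ∷ zs)
    x≢ with p ∷ _ ← uniq = p
    rg-x = proj₁ (in-starts (here refl))
    rg-y = proj₁ (in-starts (there (here refl)))
    bu-x = proj₂ (in-starts (here refl))
    bu-y = proj₂ (in-starts (there (here refl)))
    s₀ = st (map (λ j → l , j , l) ss ++ ls) tr
    e-x : labelOf (labs s₀) l x ≡ just l
    e-x = labelOf-here {l} {x} {l} ((l , y , l) ∷ map (λ j → l , j , l) zs ++ ls)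
    e-y : labelOf (labs s₀) l y ≡ just l
    e-y = trans (labelOf-there ((l , y , l) ∷ map (λ j → l , j , l) zs ++ ls) {l} {y} {l} {x} (λ (_ , e) → All.lookup x≢ (here refl) e))
                (labelOf-here {l} {y} {l} (map (λ j → l , j , l) zs ++ ls))
    kept : ∀ z → labelOf (labs s₀) l z ≡ just l → labelOf (labs (runPaths l s₀ ss)) l z ≡ just l
    kept z = runPaths-pres (λ ls' → labelOf ls' l z ≡ just l) (label-stable {l} {l} {z} {l}) s₀ ss
  ... | no l≢L = second (path-outcome-L x s₀ l<L (proj₂ (proj₁ (in-starts (here refl)))))
    where
    l<L = ≤∧≢⇒< l≤L l≢L
    ss = x ∷ y ∷ zs
    in-starts : ∀ {z} → z ∈ ss → (1 ≤ z × z ≤ N) × ball Q l z ≡ true × labelOf ls l z ≡ nothing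
    in-starts {z} z∈ = ∈-starts⁻ Q N ls l (subst (z ∈_) eq z∈)
    s₀ = st (map (λ j → l , j , l) ss ++ ls) tr
    s₁ = pathFrom Q N l (L ∸ l) l x s₀
    s₂ = pathFrom Q N l (L ∸ l) l y s₁
    s₃ = runPaths l s₂ zs
    Outcome : ℕ → St → St → Set
    Outcome j s s' = (∃ λ r → l < r × r ≤ L × Full r (labs s')) ⊎
      (∃ λ x → (1 ≤ x × x ≤ N) × ball Q L x ≡ true × labelOf (labs s') L x ≡ just l × labelOf (labs s) L x ≡ nothing)
    absent : ∀ {r} → l < r → Absent r (labs s₃)
    absent {r} l<r = runPaths-pres (Absent r) (absent-stable (<⇒≢ l<r)) s₀ ss
      (starts-pres (Absent r) (absent-stable (<⇒≢ l<r)) ss (subst Unique (sym eq) (starts-unique Q N ls l))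
        (proj₂ ∘ proj₂ ∘ in-starts) (abs l<r))
    dies : ∀ {r} → l < r → r ≤ L → Full r (labs s₂) → ⊥
    dies {r} l<r r≤L full = not-dead xs compl (≤-trans 1≤l (<⇒≤ l<r)) r≤L
      (runPaths-pres {l} (Full r) full-stable s₂ zs full , absent l<r)
    second : Outcome x s₀ s₁ → ⊥
    second (inj₁ (r , l<r , r≤L , full)) = dies l<r r≤L (pathFrom-pres (Full r) full-stable (L ∸ l) l y s₁ full)
    second (inj₂ (x' , rx , bx , ex , _)) with path-outcome-L y s₁ l<L (proj₂ (proj₁ (in-starts (there (here refl)))))
    ... | inj₁ (r , l<r , r≤L , full) = dies l<r r≤L full
    ... | inj₂ (y' , ry , by , ey , uy)
      with refl ← not-twice {x'} {y'} xs compl rx ry bx by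
        (runPaths-pres (λ ls' → labelOf ls' L x' ≡ just l) (label-stable {l} {L} {x'} {l}) s₂ zs
          (pathFrom-pres (λ ls' → labelOf ls' L x' ≡ just l) (label-stable {l} {L} {x'} {l}) (L ∸ l) l y s₁ ex))
        (runPaths-pres (λ ls' → labelOf ls' L y' ≡ just l) (label-stable {l} {L} {y'} {l}) s₂ zs ey)
      = contradiction (trans (sym ex) uy) (λ ())

  absent-later : ∀ {pos ls} → Invariant (suc l) l pos ls → l < r → Absent r ls
  absent-later inv l<r {r'} {x} e with proj₁ (cell inv e)
  ... | _ , _ , _ , inj₁ r≤l           = contradiction (<-≤-trans l<r (s≤s⁻¹ r≤l)) (<-irrefl refl)
  ... | _ , r≤r' , _ , inj₂ (_ , r'≤l) = contradiction (≤-trans l<r (≤-trans r≤r' r'≤l)) (<-irrefl refl)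

  -- Without a start, row `suc l` is full and lacks its own label, hence dead; a single path that
  -- gets stuck makes a later row dead; two starts are excluded above.
  stage-outcome : ∀ {pos ls tr} ss xs → suc l ≤ L → Invariant (suc l) l pos ls →
    ss ≡ starts Q N ls (suc l) → Completes (stageOn (suc l) (st ls tr) ss) xs →
    (∃ λ pos' → Invariant (suc l) L pos' (labs (stageOn (suc l) (st ls tr) ss))) ×
    Full (suc l) (labs (stageOn (suc l) (st ls tr) ss))
  stage-outcome {l} {pos} {ls} {tr} [] xs l<L inv eq compl =
    ⊥-elim (not-dead xs compl (s≤s z≤n) l<L (full , absent-later inv ≤-refl))
    where
    full : Full (suc l) ls
    full {x} 1≤x x≤N b with labelOf ls (suc l) x in e
    ... | just m  = m , refl
    ... | nothing with () ← subst (x ∈_) (sym eq) (∈-starts⁺ Q N ls (suc l) 1≤x x≤N b e)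
  stage-outcome {l} {pos} {ls} {tr} (x ∷ []) xs l<L inv eq compl
    with path-invariant (L ∸ suc l) tr (s≤s z≤n) ≤-refl (m+[n∸m]≡n l<L) (sym (upd-new pos (suc l) (suc l) x)) inv₁
    where
    in-start = ∈-starts⁻ {x} Q N ls (suc l) (subst (x ∈_) eq (here refl))
    inv₁ : Invariant (suc l) (suc l) (upd pos (suc l) (suc l) x) ((suc l , x , suc l) ∷ ls)
    inv₁ = extend (s≤s z≤n) ≤-refl l<L inv (proj₂ (proj₂ in-start)) (proj₁ in-start) (proj₁ (proj₂ in-start))
      (λ l<l → contradiction l<l (<-irrefl refl))
  ... | inj₁ (r , l<r , r≤L , full) = ⊥-elim (not-dead xs compl (≤-trans (s≤s z≤n) (<⇒≤ l<r)) r≤L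
          (full , pathFrom-pres (Absent r) (absent-stable (<⇒≢ l<r)) (L ∸ suc l) (suc l) x (st ((suc l , x , suc l) ∷ ls) tr)
                    (absent-stable (<⇒≢ l<r) ls (suc l) x
                      (proj₂ (proj₂ (∈-starts⁻ {x} Q N ls (suc l) (subst (x ∈_) eq (here refl)))))
                      (absent-later inv (<⇒≤ l<r)))))
  ... | inj₂ (pos' , inv') = (pos' , inv') ,
          pathFrom-pres (Full (suc l)) full-stable (L ∸ suc l) (suc l) x (st ((suc l , x , suc l) ∷ ls) tr) full
    where
    full : Full (suc l) ((suc l , x , suc l) ∷ ls)
    full {y} 1≤y y≤N b = by-label (labelOf ls (suc l) y) refl
      where
      by-label : ∀ v → labelOf ls (suc l) y ≡ v → ∃ λ m → labelOf ((suc l , x , suc l) ∷ ls) (suc l) y ≡ just m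
      by-label (just m) e = m , labelOf-persists ls {suc l} {y} {suc l} {x}
        (proj₂ (proj₂ (∈-starts⁻ {x} Q N ls (suc l) (subst (x ∈_) eq (here refl))))) e
      by-label nothing  e with subst (y ∈_) (sym eq) (∈-starts⁺ Q N ls (suc l) 1≤y y≤N b e)
      ... | here refl = suc l , labelOf-here {suc l} {x} {suc l} ls
  stage-outcome {l} {pos} {ls} {tr} (x ∷ y ∷ zs) xs l<L inv eq compl =
    ⊥-elim (no-second-start x y zs xs (s≤s z≤n) l<L (λ l<r → absent-later inv (<⇒≤ l<r)) eq compl)

  all-stages : ∀ d {l pos} s → l + d ≡ L → Invariant (suc l) l pos (labs s) →
    (∀ {r} → 1 ≤ r → r ≤ l → Full r (labs s)) → Completes s (upFrom (suc l) d) →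
    ∃ λ pos' → Invariant (suc L) L pos' final × (∀ {r} → 1 ≤ r → r ≤ L → Full r final)
  all-stages zero {l} {pos} s eq inv full compl rewrite trans (sym eq) (+-identityʳ l) | sym compl = pos , inv , full
  all-stages (suc d) {l} s eq inv full compl
    with (pos' , inv') , full' ← stage-outcome {tr = trav s} _ (upFrom (suc (suc l)) d) (subst (l <_) eq (m<m+n l z<s)) inv refl compl =
    all-stages d (stage Q L N s (suc l)) (trans (sym (+-suc l d)) eq) (next-stage inv') full″ compl
    where
    full″ : ∀ {r} → 1 ≤ r → r ≤ suc l → Full r (labs (stage Q L N s (suc l)))
    full″ {r} 1≤r r≤l with r ≟ suc l
    ... | yes refl = full'
    ... | no ne    = stage-pres (Full r) full-stable s (full 1≤r (s≤s⁻¹ (≤∧≢⇒< r≤l ne)))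

  private
    cl : ∀ {m r} → 1 ≤ m → m ≤ r → r ≤ L → Cell L (suc L) L m r
    cl p q s = p , q , s , inj₁ (s≤s (≤-trans q s))
    start : Invariant 1 0 (λ _ _ → 0) []
    start = record { label = λ c → ⊥-elim (none c) ; cell = λ () ; range = λ c → ⊥-elim (none c)
                   ; balls = λ c → ⊥-elim (none c) ; step = λ _ c → ⊥-elim (none c) }
      where
      none : Cell L 1 0 m r → ⊥
      none (p , _ , _ , inj₁ (s≤s m≤0))   = <-irrefl refl (≤-trans p m≤0)
      none (p , q , _ , inj₂ (refl , r≤0)) = <-irrefl refl (≤-trans (≤-trans p q) r≤0)
    module _ {pos} (inv : Invariant (suc L) L pos final) where
      inj : ∀ {i j r} → 1 ≤ i → i ≤ r → 1 ≤ j → j ≤ r → r ≤ L → pos i r ≡ pos j r → i ≡ j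
      inj {i} {j} {r} p q p' q' s e = just-injective
        (trans (sym (label inv (cl p q s))) (trans (cong (labelOf final r) e) (label inv (cl p' q' s))))
      stepping : ∀ {i r} → 1 ≤ i → i ≤ r → suc r ≤ L → ∃ λ t → ∃ λ rest →
                 rightwardFrom N (pos i r) ≡ t ++ pos i (suc r) ∷ rest ×
                 (∀ {j} → i < j → j ≤ suc r → pos j (suc r) ∉ t)
      stepping {i} {r} p q s with t , rest , sp , h ← step inv q (cl p (≤-trans q (n≤1+n r)) s) =
        t , rest , sp , λ {j} i<j j≤r j∈ → later i<j j≤r (h j∈)
        where
        later : ∀ {j} → i < j → j ≤ suc r →
          ¬ (ball Q (suc r) (pos j (suc r)) ≡ false ⊎ ∃ λ m' → 1 ≤ m' × m' < i × pos j (suc r) ≡ pos m' (suc r))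
        later i<j j≤r (inj₁ nb) = contradiction (trans (sym nb) (balls inv (cl (≤-trans p (<⇒≤ i<j)) j≤r s))) (λ ())
        later i<j j≤r (inj₂ (m' , 1≤m' , m'<i , e)) =
          <⇒≢ (<-trans m'<i i<j) (sym (inj (≤-trans p (<⇒≤ i<j)) j≤r 1≤m' (≤-trans (<⇒≤ (<-trans m'<i i<j)) j≤r) s e))

  table : ∃ λ pos → LabeledTable Q L N pos × (∀ {i} → 1 ≤ i → i ≤ L → pos i L ≡ c i)
  table with pos , inv , full ← all-stages L {0} {λ _ _ → 0} (st [] []) refl start (λ 1≤r r≤0 → contradiction (≤-trans 1≤r r≤0) (<-irrefl refl))
               (cong (λ xs → labs (foldl (stage Q L N) (st [] []) xs)) (sym (applyUpTo-upFrom 1 L suc (λ _ → refl)))) =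
    pos , record
      { in-range  = λ p q s → range inv (cl p q s)
      ; is-ball   = λ p q s → balls inv (cl p q s)
      ; all-balls = λ 1≤r r≤L 1≤x x≤N b → let m , e = full 1≤r r≤L 1≤x x≤N b
                                              (p , q , _) , x≡ = cell inv e in m , p , q , x≡
      ; injective = inj inv
      ; stepping  = stepping inv
      } , λ {i} 1≤i i≤L → sym (proj₂ (cell inv (typed⁺ 1≤i i≤L)))

-- Interlacing columns

-- c j is the position of j in w(λ;n); the labels j ≤ k are those of vertical steps.
record BoundaryWord (L k : ℕ) (lam c : ℕ → ℕ) : Set where
  field
    total      : lam 1 + k ≡ suc L
    lam-anti   : 1 ≤ i → i ≤ j → lam j ≤ lam i
    -- Vertical step `i` is preceded by `i - 1` vertical and `lam 1 - lam i` horizontal steps; the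
    -- equation avoids subtraction.
    c-vertical : 1 ≤ i → i ≤ k → c i + lam i ≡ i + lam 1
    c-range    : 1 ≤ j → j ≤ suc L → 1 ≤ c j × c j ≤ suc L
    c-horiz    : k < i → i < j → j ≤ suc L → c i < c j
    -- Vertical step `i` lies at abscissa `lam i`, and horizontal step `j` starts at abscissa
    -- `suc (suc L) - j`; comparing the two decides which comes first.
    c-before   : 1 ≤ i → i ≤ k → k < j → j ≤ suc L → suc L < j + lam i → c i < c j
    c-after    : 1 ≤ i → i ≤ k → k < j → j ≤ suc L → j + lam i ≤ suc L → c j < c i
    c-onto     : 1 ≤ x → x ≤ suc L → ∃ λ j → 1 ≤ j × j ≤ suc L × x ≡ c j

-- The common ground of both directions: a labeled queue yields it, a tableau yields it, and it is
-- enough to predict the labeling.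
record Interlacing (L k : ℕ) (lam c : ℕ → ℕ) (pos : ℕ → ℕ → ℕ) : Set where
  field
    bottom  : 1 ≤ i → i ≤ L → pos i L ≡ c i
    weak    : 1 ≤ i → i ≤ r → suc r ≤ L → pos i (suc r) ≤ pos i r
    strict  : 1 ≤ i → i < k → i ≤ r → suc r ≤ L → pos i r < pos (suc i) (suc r)
    fixed   : 1 ≤ i → i ≤ k → i ≤ r → r ≤ L → suc L ≤ r + lam i → pos i r ≡ c i
    horiz   : k < j → j ≤ r → r ≤ L → pos j r ≡ c j
    bounded : 1 ≤ i → i ≤ r → r ≤ L → pos i r ≤ suc L

module Combinatorics {L k : ℕ} {lam c : ℕ → ℕ} (W : BoundaryWord L k lam c) where
  open BoundaryWord W

  c-incr : 1 ≤ i → i < j → j ≤ k → c i < c j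
  c-incr {i} {j} 1≤i i<j j≤k = +-cancelʳ-< (lam i) (c i) (c j) (begin-strict
    c i + lam i ≡⟨ c-vertical 1≤i (≤-trans (<⇒≤ i<j) j≤k) ⟩
    i + lam 1   <⟨ +-monoˡ-< (lam 1) i<j ⟩
    j + lam 1   ≡⟨ c-vertical (≤-trans 1≤i (<⇒≤ i<j)) j≤k ⟨
    c j + lam j ≤⟨ +-monoʳ-≤ (c j) (lam-anti 1≤i (<⇒≤ i<j)) ⟩
    c j + lam i ∎)
    where open ≤-Reasoning

  c-before⁻ : 1 ≤ i → i ≤ k → k < j → j ≤ suc L → c i < c j → suc L < j + lam i
  c-before⁻ p q s u lt = ≰⇒> (λ le → <-asym lt (c-after p q s u le))

  c-vert≢horiz : 1 ≤ i → i ≤ k → k < j → j ≤ suc L → c i ≢ c j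
  c-vert≢horiz {i} {j} p q s u e with j + lam i ≤? suc L
  ... | yes le = <-irrefl (sym e) (c-after p q s u le)
  ... | no ¬le = <-irrefl e (c-before p q s u (≰⇒> ¬le))

  c-injective : 1 ≤ i → i ≤ suc L → 1 ≤ j → j ≤ suc L → c i ≡ c j → i ≡ j
  c-injective {i} {j} p q p' q' e with i ≤? k | j ≤? k | <-cmp i j
  ... | _       | _       | tri≈ _ i≡j _ = i≡j
  ... | yes i≤k | no ¬j≤k | _            = contradiction e (c-vert≢horiz p i≤k (≰⇒> ¬j≤k) q')
  ... | no ¬i≤k | yes j≤k | _            = contradiction (sym e) (c-vert≢horiz p' j≤k (≰⇒> ¬i≤k) q)
  ... | yes i≤k | yes j≤k | tri< lt _ _  = contradiction e (<⇒≢ (c-incr p lt j≤k))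
  ... | yes i≤k | yes j≤k | tri> _ _ gt  = contradiction (sym e) (<⇒≢ (c-incr p' gt i≤k))
  ... | no ¬i≤k | no ¬j≤k | tri< lt _ _  = contradiction e (<⇒≢ (c-horiz (≰⇒> ¬i≤k) lt q'))
  ... | no ¬i≤k | no ¬j≤k | tri> _ _ gt  = contradiction (sym e) (<⇒≢ (c-horiz (≰⇒> ¬j≤k) gt q))

  -- From labeled queues to interlacing columns

  module Forward {Q : List (List Bool)} {pos : ℕ → ℕ → ℕ} (lt : LabeledTable Q L (suc L) pos)
    (pos-bottom : ∀ {i} → 1 ≤ i → i ≤ L → pos i L ≡ c i) where
    open LabeledTable lt

    -- Ball `j` is unmatched while path `i` runs, so the scan must not pass it. A wrapped scan
    -- passes every column left of its end, and an unwrapped one every column from its start to its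
    -- end; avoiding `j` in both cases gives the two inequalities.
    interlace : 1 ≤ i → i ≤ r → suc r ≤ L → i < j → j ≤ suc r → pos i (suc r) < pos j (suc r) →
      pos i (suc r) ≤ pos i r × pos i r < pos j (suc r)
    interlace {i} {r} {j} 1≤i i≤r r<L i<j j≤r a<a
      with t , rest , sp , later ← stepping 1≤i i≤r r<L
      with 1≤a , a≤N ← in-range (≤-trans 1≤i (<⇒≤ i<j)) j≤r r<L =
      a≤b , ≰⇒> (λ a'≤b → blocked (inj₁ (a≤b , a<a , a'≤b)))
      where
      blocked : ¬ Between (pos i r) (pos i (suc r)) (pos j (suc r))
      blocked = later i<j j≤r ∘ scanned-between t sp 1≤a a≤N
      a≤b : pos i (suc r) ≤ pos i r
      a≤b = ≮⇒≥ (λ b<a → blocked (inj₂ (b<a , inj₂ a<a)))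

    -- A wrapped scan passes all columns up to its start, so the ball `j`, which it must avoid, lies
    -- farther left.
    unwrapped : 1 ≤ i → i ≤ r → suc r ≤ L → i < j → j ≤ suc r → pos i r < pos i (suc r) → pos i r < pos j (suc r)
    unwrapped {i} {r} {j} 1≤i i≤r r<L i<j j≤r b<a
      with t , rest , sp , later ← stepping 1≤i i≤r r<L
      with 1≤a , a≤N ← in-range (≤-trans 1≤i (<⇒≤ i<j)) j≤r r<L =
      ≰⇒> (λ a'≤b → later i<j j≤r (scanned-between t sp 1≤a a≤N (inj₂ (b<a , inj₁ a'≤b))))

    -- The claims that climb together. By `filled` no vacancy lies to the right of the ball with the
    -- largest label `r`, which leaves no room for wrapping in the row above.
    record Row (r : ℕ) : Set where
      field
        incr   : 1 ≤ i → i < j → j ≤ k → j ≤ r → pos i r < pos j r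
        hor    : k < j → j ≤ r → pos j r ≡ c j
        filled : k < r → 1 ≤ x → x ≤ c r → ∃ λ i → 1 ≤ i × i ≤ r × x ≡ pos i r
        stuck  : 1 ≤ i → i ≤ k → i ≤ r → suc L ≤ r + lam i → pos i r ≡ c i
    open Row

    Descends : ℕ → Set
    Descends r = ∀ {i} → 1 ≤ i → i ≤ r → pos i (suc r) ≤ pos i r

    incr-up : Row (suc r) → suc r ≤ L → Descends r →
      1 ≤ i → i < j → j ≤ k → j ≤ r → pos i r < pos j r
    incr-up {r} row r<L desc 1≤i i<j j≤k j≤r = <-≤-trans
      (proj₂ (interlace 1≤i (≤-trans (<⇒≤ i<j) j≤r) r<L i<j (m≤n⇒m≤1+n j≤r) (incr row 1≤i i<j j≤k (m≤n⇒m≤1+n j≤r))))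
      (desc (≤-trans 1≤i (<⇒≤ i<j)) j≤r)

    -- All labels of row `suc r` are vertical, so their columns increase and each path need only be
    -- compared with the next label. The claims about horizontal or arrived labels are vacuous here.
    row-up-top : suc r ≤ L → suc r ≤ k → Row (suc r) → Descends r × Row r
    row-up-top {r} r<L r<k row = desc , record
      { incr   = incr-up row r<L desc
      ; hor    = λ k<j j≤r → contradiction (<-≤-trans k<j (≤-trans j≤r (<⇒≤ r<k))) (<-irrefl refl)
      ; filled = λ k<r → contradiction (<-trans k<r r<k) (<-irrefl refl)
      ; stuck  = λ {i} 1≤i _ _ L≤ → contradiction (begin-strict
                   suc L     ≤⟨ L≤ ⟩
                   r + lam i ≤⟨ +-monoʳ-≤ r (lam-anti ≤-refl 1≤i) ⟩
                   r + lam 1 <⟨ +-monoˡ-< (lam 1) r<k ⟩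
                   k + lam 1 ≡⟨ +-comm k (lam 1) ⟩
                   lam 1 + k ≡⟨ total ⟩
                   suc L     ∎) (<-irrefl refl) }
      where
      open ≤-Reasoning
      desc : Descends r
      desc {i} 1≤i i≤r = proj₁ (interlace 1≤i i≤r r<L ≤-refl (s≤s i≤r) (incr row 1≤i ≤-refl (≤-trans (s≤s i≤r) r<k) (s≤s i≤r)))

    -- Everything to the right of the ball of label suc r stays in place.
    row-up-bottom : suc r ≤ L → k ≤ r → Row (suc r) → Descends r × Row r
    row-up-bottom {r} r<L k≤r row = desc , record
      { incr   = incr-up row r<L desc
      ; hor    = λ k<j j≤r → trans (hor-stays k<j j≤r) (hor row k<j (m≤n⇒m≤1+n j≤r))
      ; filled = filled'
      ; stuck  = λ {i} 1≤i i≤k i≤r L≤ →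
          let s = stuck row 1≤i i≤k (m≤n⇒m≤1+n i≤r) (m≤n⇒m≤1+n L≤) in
          trans (vert-stays 1≤i i≤k (subst₂ _<_ (sym s) (sym C≡) (c-before 1≤i i≤k (s≤s k≤r) (m≤n⇒m≤1+n r<L) (s≤s L≤)))) s }
      where
      C = pos (suc r) (suc r)
      C≡ : C ≡ c (suc r)
      C≡ = hor row (s≤s k≤r) ≤-refl
      fill : ∀ {x} → 1 ≤ x → x ≤ C → ∃ λ i → 1 ≤ i × i ≤ suc r × x ≡ pos i (suc r)
      fill 1≤x x≤C = filled row (s≤s k≤r) 1≤x (subst (_ ≤_) C≡ x≤C)

      -- The cell just left of ball `i` is still in the filled range and carries some `m`, larger
      -- than `i` by monotonicity. Interlacing with `m` leaves `pos i r` a single value.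
      vert-stays : ∀ {i} → 1 ≤ i → i ≤ k → pos i (suc r) < C → pos i r ≡ pos i (suc r)
      vert-stays {i} 1≤i i≤k a<C with m , 1≤m , m≤r , e ← fill (s≤s z≤n) a<C =
        ≤-antisym (s≤s⁻¹ (subst (pos i r <_) (sym e) (proj₂ il))) (proj₁ il)
        where
        a<a : pos i (suc r) < pos m (suc r)
        a<a = subst (pos i (suc r) <_) e ≤-refl
        i<m : i < m
        i<m with <-cmp i m
        ... | tri< i<m _ _  = i<m
        ... | tri≈ _ refl _ = contradiction a<a (<-irrefl refl)
        ... | tri> _ _ m<i  = contradiction a<a (<-asym (incr row 1≤m m<i i≤k (m≤n⇒m≤1+n (≤-trans i≤k k≤r))))
        il = interlace 1≤i (≤-trans i≤k k≤r) r<L i<m m≤r a<a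

      -- Otherwise `pos j r` lies strictly between `c j` and `c (suc j)`, in a column that row
      -- `suc r` fills with some `m`. A vertical `m` stays and would share a cell of row `r` with
      -- `j`; a horizontal `m` does not fit between two consecutive horizontal labels.
      hor-stays : ∀ {j} → k < j → j ≤ r → pos j r ≡ pos j (suc r)
      hor-stays {j} k<j j≤r with pos j r ≟ pos j (suc r)
      ... | yes e = e
      ... | no ne = ⊥-elim bad
        where
        j<r = s≤s j≤r
        aj : pos j (suc r) ≡ c j
        aj = hor row k<j (m≤n⇒m≤1+n j≤r)
        aj' : pos (suc j) (suc r) ≡ c (suc j)
        aj' = hor row (m≤n⇒m≤1+n k<j) j<r
        1≤j = ≤-trans (s≤s z≤n) k<j
        il = interlace 1≤j j≤r r<L ≤-refl j<r
               (subst₂ _<_ (sym aj) (sym aj') (c-horiz k<j ≤-refl (≤-trans j<r (m≤n⇒m≤1+n r<L))))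
        a<b = ≤∧≢⇒< (proj₁ il) (ne ∘ sym)
        c≤C : c (suc j) ≤ c (suc r)
        c≤C with suc j ≟ suc r
        ... | yes refl = ≤-refl
        ... | no ne'   = <⇒≤ (c-horiz (m≤n⇒m≤1+n k<j) (≤∧≢⇒< j<r ne') (m≤n⇒m≤1+n r<L))
        b<C : pos j r < C
        b<C = <-≤-trans (proj₂ il) (subst₂ _≤_ (sym aj') (sym C≡) c≤C)
        bad : ⊥
        bad with m , 1≤m , m≤r , e ← fill (proj₁ (in-range 1≤j j≤r (<⇒≤ r<L))) (<⇒≤ b<C) with m ≤? k
        ... | yes m≤k = <⇒≢ (≤-<-trans m≤k k<j) (injective 1≤m (≤-trans m≤k k≤r) 1≤j j≤r (<⇒≤ r<L)
                          (trans (vert-stays 1≤m m≤k (subst (_< C) e b<C)) (sym e)))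
        ... | no ¬m≤k with <-cmp m j | hor row (≰⇒> ¬m≤k) m≤r
        ...   | tri≈ _ refl _ | _  = ne e
        ...   | tri< m<j _ _ | am = <-asym a<b (subst₂ _<_ (trans (sym am) (sym e)) (sym aj)
                                      (c-horiz (≰⇒> ¬m≤k) m<j (m≤n⇒m≤1+n (≤-trans j≤r (<⇒≤ r<L)))))
        ...   | tri> _ _ j<m | am with suc j ≟ m
        ...     | yes refl = <-irrefl e (proj₂ il)
        ...     | no ne'   = <-asym (proj₂ il) (subst₂ _<_ (sym aj') (trans (sym am) (sym e))
                               (c-horiz (m≤n⇒m≤1+n k<j) (≤∧≢⇒< j<m ne') (≤-trans m≤r (m≤n⇒m≤1+n r<L))))

      stays : ∀ {m} → 1 ≤ m → m ≤ r → pos m (suc r) < C → pos m r ≡ pos m (suc r)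
      stays {m} 1≤m m≤r a<C with m ≤? k
      ... | yes m≤k = vert-stays 1≤m m≤k a<C
      ... | no ¬m≤k = hor-stays (≰⇒> ¬m≤k) m≤r

      right-filled : ∀ {x} → 1 ≤ x → x < C → ∃ λ i → 1 ≤ i × i ≤ r × x ≡ pos i (suc r) × x ≡ pos i r
      right-filled 1≤x x<C with m , 1≤m , m≤r , refl ← fill 1≤x (<⇒≤ x<C) with m ≟ suc r
      ... | yes refl = contradiction x<C (<-irrefl refl)
      ... | no ne    = m , 1≤m , s≤s⁻¹ (≤∧≢⇒< m≤r ne) , refl , sym (stays 1≤m (s≤s⁻¹ (≤∧≢⇒< m≤r ne)) x<C)

      desc : Descends r
      desc {i} 1≤i i≤r with i ≤? k
      ... | no ¬i≤k = ≤-reflexive (sym (hor-stays (≰⇒> ¬i≤k) i≤r))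
      ... | yes i≤k with pos i (suc r) <? C
      ...   | yes a<C = ≤-reflexive (sym (vert-stays 1≤i i≤k a<C))
      -- A wrapping path would start to the right of `C`, where each cell of row `r` belongs to a
      -- ball that does not move.
      ...   | no ¬a<C = ≮⇒≥ λ b<a → wrap b<a (unwrapped 1≤i i≤r r<L (s≤s i≤r) ≤-refl b<a)
        where
        wrap : pos i r < pos i (suc r) → pos i r < C → ⊥
        wrap b<a b<C with m , 1≤m , m≤r , e , e' ← right-filled (proj₁ (in-range 1≤i i≤r (<⇒≤ r<L))) b<C
          with refl ← injective 1≤i i≤r 1≤m m≤r (<⇒≤ r<L) e' = <-irrefl e b<a

      filled' : ∀ {x} → k < r → 1 ≤ x → x ≤ c r → ∃ λ i → 1 ≤ i × i ≤ r × x ≡ pos i r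
      filled' k<r 1≤x x≤c with m , 1≤m , m≤r , _ , e ←
        right-filled 1≤x (subst (_ <_) (sym C≡) (≤-<-trans x≤c (c-horiz k<r ≤-refl (m≤n⇒m≤1+n r<L)))) = m , 1≤m , m≤r , e

    row-up : suc r ≤ L → Row (suc r) → Descends r × Row r
    row-up {r} r<L row with suc r ≤? k
    ... | yes r<k = row-up-top r<L r<k row
    ... | no ¬r<k = row-up-bottom r<L (s≤s⁻¹ (≰⇒> ¬r<k)) row

    row-L : k ≤ L → Row L
    row-L k≤L = record
      { incr = λ 1≤i i<j j≤k j≤L → subst₂ _<_ (sym (pos-bottom 1≤i (≤-trans (<⇒≤ i<j) j≤L)))
                 (sym (pos-bottom (≤-trans 1≤i (<⇒≤ i<j)) j≤L)) (c-incr 1≤i i<j j≤k)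
      ; hor = λ k<j j≤L → pos-bottom (≤-trans (s≤s z≤n) k<j) j≤L
      ; filled = filled'
      ; stuck = λ 1≤i _ i≤L _ → pos-bottom 1≤i i≤L }
      where
      filled' : ∀ {x} → k < L → 1 ≤ x → x ≤ c L → ∃ λ i → 1 ≤ i × i ≤ L × x ≡ pos i L
      -- The only column without a label up to `L` is `c (suc L)`, which lies to the left of `c L`.
      filled' k<L 1≤x x≤c
        with j , 1≤j , j≤N , refl ← c-onto 1≤x (≤-trans x≤c (proj₂ (c-range (≤-trans (s≤s z≤n) k<L) (n≤1+n L))))
        with j ≟ suc L
      ... | yes refl = contradiction (<-≤-trans (c-horiz k<L ≤-refl ≤-refl) x≤c) (<-irrefl refl)
      ... | no ne    = j , 1≤j , s≤s⁻¹ (≤∧≢⇒< j≤N ne) , sym (pos-bottom 1≤j (s≤s⁻¹ (≤∧≢⇒< j≤N ne)))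

    rows : k ≤ L → ∀ d r → r + d ≡ L → Row r
    rows k≤L zero    r eq = subst Row (trans (sym eq) (+-identityʳ r)) (row-L k≤L)
    rows k≤L (suc d) r eq = proj₂ (row-up (subst (r <_) eq (m<m+n r z<s)) (rows k≤L d (suc r) (trans (sym (+-suc r d)) eq)))

    row : k ≤ L → r ≤ L → Row r
    row k≤L r≤L = rows k≤L _ _ (m+[n∸m]≡n r≤L)

    interlacing : k ≤ L → Interlacing L k lam c pos
    interlacing k≤L = record
      { bottom  = pos-bottom
      ; weak    = λ 1≤i i≤r r<L → proj₁ (row-up r<L (row k≤L r<L)) 1≤i i≤r
      ; strict  = λ 1≤i i<k i≤r r<L → proj₂ (interlace 1≤i i≤r r<L ≤-refl (s≤s i≤r)
                    (incr (row k≤L r<L) 1≤i ≤-refl i<k (s≤s i≤r)))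
      ; fixed   = λ 1≤i i≤k i≤r r≤L → stuck (row k≤L r≤L) 1≤i i≤k i≤r
      ; horiz   = λ k<j j≤r r≤L → hor (row k≤L r≤L) k<j j≤r
      ; bounded = λ 1≤i i≤r r≤L → proj₂ (in-range 1≤i i≤r r≤L) }

  -- From interlacing columns to unwrapped paths

  module Backward {pos : ℕ → ℕ → ℕ} (I : Interlacing L k lam c pos) where
    open Interlacing I

    lower : 1 ≤ i → ∀ d {r} → i ≤ r → r + d ≡ L → c i ≤ pos i r
    lower 1≤i zero    {r} i≤r eq with refl ← trans (sym eq) (+-identityʳ r) = ≤-reflexive (sym (bottom 1≤i i≤r))
    lower 1≤i (suc d) {r} i≤r eq = ≤-trans (lower 1≤i d (m≤n⇒m≤1+n i≤r) (trans (sym (+-suc r d)) eq))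
      (weak 1≤i i≤r (subst (r <_) eq (m<m+n r z<s)))

    c≤pos : 1 ≤ i → i ≤ r → r ≤ L → c i ≤ pos i r
    c≤pos 1≤i i≤r r≤L = lower 1≤i _ i≤r (m+[n∸m]≡n r≤L)

    pos-range : 1 ≤ i → i ≤ r → r ≤ L → 1 ≤ pos i r × pos i r ≤ suc L
    pos-range 1≤i i≤r r≤L = ≤-trans (proj₁ (c-range 1≤i (m≤n⇒m≤1+n (≤-trans i≤r r≤L)))) (c≤pos 1≤i i≤r r≤L) , bounded 1≤i i≤r r≤L

    pos-suc : 1 ≤ i → suc i ≤ k → suc i ≤ r → r ≤ L → pos i r < pos (suc i) r
    pos-suc {i} {r} 1≤i i<k i<r r≤L with r ≟ L
    ... | yes refl = subst₂ _<_ (sym (bottom 1≤i (<⇒≤ i<r))) (sym (bottom (s≤s z≤n) i<r)) (c-incr 1≤i ≤-refl i<k)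
    ... | no ne    = <-≤-trans (strict 1≤i i<k (<⇒≤ i<r) (≤∧≢⇒< r≤L ne)) (weak (s≤s z≤n) i<r (≤∧≢⇒< r≤L ne))

    pos-incr : 1 ≤ i → i < j → j ≤ k → j ≤ r → r ≤ L → pos i r < pos j r
    pos-incr {i} {suc j} 1≤i i<j j≤k j≤r r≤L with i ≟ j
    ... | yes refl = pos-suc 1≤i j≤k j≤r r≤L
    ... | no ne    = <-trans (pos-incr 1≤i i<j' (<⇒≤ j≤k) (<⇒≤ j≤r) r≤L) (pos-suc (≤-trans 1≤i (<⇒≤ i<j')) j≤k j≤r r≤L)
      where i<j' = ≤∧≢⇒< (s≤s⁻¹ i<j) ne

    -- Preceding a horizontal `j ≤ suc r` in the word means `suc L < j + lam i`, so row `r` already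
    -- belongs to the range of `fixed`.
    stays-right : 1 ≤ i → i ≤ k → k < j → j ≤ suc r → i ≤ r → r ≤ L → c i < c j → pos i r ≡ c i
    stays-right {i} {j} {r} 1≤i i≤k k<j j≤r i≤r r≤L ci<cj = fixed 1≤i i≤k i≤r r≤L
      (s≤s⁻¹ (<-≤-trans (c-before⁻ 1≤i i≤k k<j (≤-trans j≤r (s≤s r≤L)) ci<cj) (+-monoˡ-≤ (lam i) j≤r)))

    -- If `c i` is to the right of `c j`, label `i` has already arrived in row `r`; if it is to the
    -- left, so is `pos i r`, which is never below `c i`.
    pos-vert≢horiz : 1 ≤ i → i ≤ k → k < j → i ≤ r → j ≤ r → r ≤ L → pos i r ≢ pos j r
    pos-vert≢horiz {i} {j} 1≤i i≤k k<j i≤r j≤r r≤L e with <-cmp (c i) (c j)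
    ... | tri≈ _ e' _ = c-vert≢horiz 1≤i i≤k k<j (m≤n⇒m≤1+n (≤-trans j≤r r≤L)) e'
    ... | tri< lt _ _ = <⇒≢ lt (trans (sym (stays-right 1≤i i≤k k<j (m≤n⇒m≤1+n j≤r) i≤r r≤L lt)) (trans e (horiz k<j j≤r r≤L)))
    ... | tri> _ _ gt = <⇒≢ (<-≤-trans gt (c≤pos 1≤i i≤r r≤L)) (sym (trans e (horiz k<j j≤r r≤L)))

    pos-injective : 1 ≤ i → i ≤ r → 1 ≤ j → j ≤ r → r ≤ L → pos i r ≡ pos j r → i ≡ j
    pos-injective {i} {r} {j} p q p' q' s e with i ≤? k | j ≤? k | <-cmp i j
    ... | _       | _       | tri≈ _ i≡j _ = i≡j
    ... | yes i≤k | no ¬j≤k | _            = contradiction e (pos-vert≢horiz p i≤k (≰⇒> ¬j≤k) q q' s)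
    ... | no ¬i≤k | yes j≤k | _            = contradiction (sym e) (pos-vert≢horiz p' j≤k (≰⇒> ¬i≤k) q' q s)
    ... | yes i≤k | yes j≤k | tri< lt _ _  = contradiction e (<⇒≢ (pos-incr p lt j≤k q' s))
    ... | yes i≤k | yes j≤k | tri> _ _ gt  = contradiction (sym e) (<⇒≢ (pos-incr p' gt i≤k q s))
    ... | no ¬i≤k | no ¬j≤k | _            = c-injective p (≤-trans q s') p' (≤-trans q' s')
                                               (trans (sym (horiz (≰⇒> ¬i≤k) q s)) (trans e (horiz (≰⇒> ¬j≤k) q' s)))
      where s' = m≤n⇒m≤1+n s

    -- A horizontal `i` does not move, and a vertical `i` right of a horizontal `j` has arrived. For
    -- two vertical labels `strict` handles the neighbor, and monotonicity the labels beyond it.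
    gap : 1 ≤ i → i ≤ r → suc r ≤ L → 1 ≤ j → j ≤ suc r → pos i (suc r) < pos j (suc r) → pos i r < pos j (suc r)
    gap {i} {r} {j} 1≤i i≤r r<L 1≤j j≤r a<a with i ≤? k | j ≤? k
    ... | no ¬i≤k | _ = subst (_< pos j (suc r)) (trans (horiz (≰⇒> ¬i≤k) (m≤n⇒m≤1+n i≤r) r<L) (sym (horiz (≰⇒> ¬i≤k) i≤r (<⇒≤ r<L)))) a<a
    ... | yes i≤k | no ¬j≤k =
      subst (_< pos j (suc r)) (trans (stays-right 1≤i i≤k (≰⇒> ¬j≤k) (m≤n⇒m≤1+n j≤r) (m≤n⇒m≤1+n i≤r) r<L lt)
                                      (sym (stays-right 1≤i i≤k (≰⇒> ¬j≤k) j≤r i≤r (<⇒≤ r<L) lt))) a<a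
      where
      lt : c i < c j
      lt = ≤-<-trans (c≤pos 1≤i (m≤n⇒m≤1+n i≤r) r<L) (subst (_ <_) (horiz (≰⇒> ¬j≤k) j≤r r<L) a<a)
    ... | yes i≤k | yes j≤k with <-cmp i j
    ...   | tri≈ _ refl _ = contradiction a<a (<-irrefl refl)
    ...   | tri> _ _ j<i  = contradiction a<a (<-asym (pos-incr 1≤j j<i i≤k (m≤n⇒m≤1+n i≤r) r<L))
    ...   | tri< i<j _ _ with suc i ≟ j
    ...     | yes refl = strict 1≤i j≤k i≤r r<L
    ...     | no ne    = <-trans (strict 1≤i (≤-trans i<j j≤k) i≤r r<L) (pos-incr (s≤s z≤n) (≤∧≢⇒< i<j ne) j≤k j≤r r<L)

-- The labeling run on unwrapped columns

record UnwrappedTable (Q : List (List Bool)) (L N : ℕ) (pos : ℕ → ℕ → ℕ) : Set where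
  field
    in-range  : 1 ≤ i → i ≤ r → r ≤ L → 1 ≤ pos i r × pos i r ≤ N
    is-ball   : 1 ≤ i → i ≤ r → r ≤ L → ball Q r (pos i r) ≡ true
    all-balls : 1 ≤ r → r ≤ L → 1 ≤ x → x ≤ N → ball Q r x ≡ true → ∃ λ i → 1 ≤ i × i ≤ r × x ≡ pos i r
    injective : 1 ≤ i → i ≤ r → 1 ≤ j → j ≤ r → r ≤ L → pos i r ≡ pos j r → i ≡ j
    weak      : 1 ≤ i → i ≤ r → suc r ≤ L → pos i (suc r) ≤ pos i r
    -- As `j` may also be smaller than `i`, the cells between start and end of a path contain no
    -- ball at all: the path stops at the first ball, matched or not, that it meets.
    gap       : 1 ≤ i → i ≤ r → suc r ≤ L → 1 ≤ j → j ≤ suc r → pos i (suc r) < pos j (suc r) → pos i r < pos j (suc r)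

unique-singleton : ∀ {A : Set} {xs : List A} {x} → Unique xs → x ∈ xs → (∀ {y} → y ∈ xs → y ≡ x) → xs ≡ x ∷ []
unique-singleton {xs = x ∷ []}     _        _  h = cong (_∷ []) (h (here refl))
unique-singleton {xs = x ∷ y ∷ _} ((x≢y ∷ _) ∷ _) _ h = contradiction (trans (h (here refl)) (sym (h (there (here refl))))) x≢y

module Simulation {Q : List (List Bool)} {L N : ℕ} {pos : ℕ → ℕ → ℕ} (U : UnwrappedTable Q L N pos) where
  open UnwrappedTable U
  open Labeling Q L N using (stageOn)

  vacant : 1 ≤ i → i ≤ r → suc r ≤ L → pos i (suc r) < y → y ≤ pos i r → ball Q (suc r) y ≢ true
  vacant 1≤i i≤r r<L a<y y≤b bl
    with j , 1≤j , j≤r , refl ← all-balls (s≤s z≤n) r<L (≤-trans (s≤s z≤n) a<y) (≤-trans y≤b (proj₂ (in-range 1≤i i≤r (<⇒≤ r<L)))) bl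
    = <-irrefl refl (<-≤-trans (gap 1≤i i≤r r<L 1≤j j≤r a<y) y≤b)

  -- Unlike in `Invariant`, the columns are given in advance, and the traversed cells are known
  -- exactly because they will be counted.
  record State (l ρ : ℕ) (s : St) : Set where
    field
      label   : Cell L l ρ m r → labelOf (labs s) r (pos m r) ≡ just m
      cell    : labelOf (labs s) r x ≡ just m → Cell L l ρ m r × x ≡ pos m r
      trav⁺ : m ≤ r → Cell L l ρ m (suc r) → pos m (suc r) < y → y ≤ pos m r → (m , suc r , y) ∈ trav s
      trav⁻ : (m , r , y) ∈ trav s → ∃ λ r' → r ≡ suc r' × m ≤ r' × Cell L l ρ m r × pos m r < y × y ≤ pos m r'
  open State

  unlabeled : ∀ {s} → State l ρ s → 1 ≤ l → l ≤ suc ρ → suc ρ ≤ L → labelOf (labs s) (suc ρ) (pos l (suc ρ)) ≡ nothing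
  unlabeled {l} {ρ} {s} S 1≤l l≤ρ ρ<L = go (labelOf (labs s) (suc ρ) (pos l (suc ρ))) refl
    where
    go : ∀ v → labelOf (labs s) (suc ρ) (pos l (suc ρ)) ≡ v → v ≡ nothing
    go nothing  _ = refl
    go (just m) e with c@(1≤m , m≤ρ , _) , p ← cell S e
      with refl ← injective 1≤l l≤ρ 1≤m m≤ρ ρ<L p = contradiction (cell-in-new-row c) (<-irrefl refl)

  -- Covers the start of a stage as well, where `l ≡ suc ρ` and `tr'` is `tr`; hence the guards
  -- `l ≤ ρ`.
  extend-state : ∀ {ls tr tr'} → State l ρ (st ls tr) → 1 ≤ l → l ≤ suc ρ → suc ρ ≤ L →
    (∀ {m r y} → (m , r , y) ∈ tr → (m , r , y) ∈ tr') →
    (∀ {y} → l ≤ ρ → pos l (suc ρ) < y → y ≤ pos l ρ → (l , suc ρ , y) ∈ tr') →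
    (∀ {m r y} → (m , r , y) ∈ tr' → (m , r , y) ∈ tr ⊎ (l ≤ ρ × m ≡ l × r ≡ suc ρ × pos l (suc ρ) < y × y ≤ pos l ρ)) →
    State l (suc ρ) (st ((suc ρ , pos l (suc ρ) , l) ∷ ls) tr')
  extend-state {l} {ρ} {ls} {tr} {tr'} S 1≤l l≤ρ ρ<L old new only = record { label = label' ; cell = cell' ; trav⁺ = t⁺ ; trav⁻ = t⁻ }
    where
    x₀ = pos l (suc ρ)
    ls' = (suc ρ , x₀ , l) ∷ ls
    new-cell : Cell L l (suc ρ) l (suc ρ)
    new-cell = 1≤l , l≤ρ , ρ<L , inj₂ (refl , ≤-refl)
    label' : ∀ {m r} → Cell L l (suc ρ) m r → labelOf ls' r (pos m r) ≡ just m
    label' {m} {r} c with cell-suc⁻ c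
    ... | inj₁ c'            = labelOf-persists ls {r} {pos m r} {suc ρ} {x₀} (unlabeled S 1≤l l≤ρ ρ<L) (label S c')
    ... | inj₂ (refl , refl) = labelOf-here {suc ρ} {x₀} {l} ls
    cell' : ∀ {r y m} → labelOf ls' r y ≡ just m → Cell L l (suc ρ) m r × y ≡ pos m r
    cell' {r} {y} e with labelOf-cons⁻ ls {r} {y} {suc ρ} {x₀} e
    ... | inj₁ (refl , refl , refl) = new-cell , refl
    ... | inj₂ e' with c , p ← cell S e' = cell-suc⁺ c , p
    t⁺ : ∀ {m r y} → m ≤ r → Cell L l (suc ρ) m (suc r) → pos m (suc r) < y → y ≤ pos m r → (m , suc r , y) ∈ tr'
    t⁺ m≤r c a<y y≤b with cell-suc⁻ c
    ... | inj₁ c'            = old (trav⁺ S m≤r c' a<y y≤b)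
    ... | inj₂ (refl , refl) = new m≤r a<y y≤b
    t⁻ : ∀ {m r y} → (m , r , y) ∈ tr' → ∃ λ r' → r ≡ suc r' × m ≤ r' × Cell L l (suc ρ) m r × pos m r < y × y ≤ pos m r'
    t⁻ y∈ with only y∈
    ... | inj₁ y∈' with r' , e , m≤r' , c , bd ← trav⁻ S y∈' = r' , e , m≤r' , cell-suc⁺ c , bd
    ... | inj₂ (l≤ρ' , refl , refl , bd) = ρ , refl , l≤ρ' , new-cell , bd

  pathFrom-suc : ∀ {k ρ j ls tr t x} → scan (free Q ls (suc ρ)) (rightwardFrom N j) ≡ (t , just x) →
    pathFrom Q N l (suc k) ρ j (st ls tr) ≡
    pathFrom Q N l k (suc ρ) x (st ((suc ρ , x , l) ∷ ls) (tr ++ map (λ y → l , suc ρ , y) t))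
  pathFrom-suc {l} {k} {ρ} {j} {ls} eq with scan (free Q ls (suc ρ)) (rightwardFrom N j) | eq
  ... | _ | refl = refl

  path-state : ∀ k {ρ s} → ρ + k ≡ L → 1 ≤ l → l ≤ ρ → State l ρ s → State l L (pathFrom Q N l k ρ (pos l ρ) s)
  path-state {l} zero {ρ} {s} eq 1≤l l≤ρ S = subst (λ z → State l z s) (trans (sym (+-identityʳ ρ)) eq) S
  path-state {l} (suc k) {ρ} {st ls tr} eq 1≤l l≤ρ S =
    subst (State l L) (sym (pathFrom-suc {l} {k} {ρ} {b₀} found))
      (path-state k (trans (sym (+-suc ρ k)) eq) 1≤l (m≤n⇒m≤1+n l≤ρ)
        (extend-state S 1≤l (m≤n⇒m≤1+n l≤ρ) ρ<L ∈-++⁺ˡ new only))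
    where
    ρ<L : ρ < L
    ρ<L = subst (ρ <_) eq (m<m+n ρ z<s)
    a₀ = pos l (suc ρ)
    b₀ = pos l ρ
    a≤b = weak 1≤l l≤ρ ρ<L
    t₀ = down a₀ (b₀ ∸ a₀)
    f = λ y → l , suc ρ , y
    sp = rightwardFrom-split N (proj₁ (in-range 1≤l (m≤n⇒m≤1+n l≤ρ) ρ<L)) a≤b
    bounds : ∀ {y} → y ∈ t₀ → a₀ < y × y ≤ b₀
    bounds {y} y∈ with p , q ← ∈-down⁻ {a = a₀} (b₀ ∸ a₀) y∈ = p , subst (y ≤_) (m+[n∸m]≡n a≤b) q
    found : scan (free Q ls (suc ρ)) (rightwardFrom N b₀) ≡ (t₀ , just a₀)
    found = trans (cong (scan (free Q ls (suc ρ))) (proj₂ sp))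
      (scan-just⁺ (free Q ls (suc ρ)) t₀
        (free-true⁺ Q ls (suc ρ) a₀ (is-ball 1≤l (m≤n⇒m≤1+n l≤ρ) ρ<L) (unlabeled S 1≤l (m≤n⇒m≤1+n l≤ρ) ρ<L))
        (λ {y} y∈ → free-false⁺ Q ls (suc ρ) y (λ bl _ →
          let p , q = bounds y∈ in vacant 1≤l l≤ρ ρ<L p q bl)))
    new : ∀ {y} → l ≤ ρ → a₀ < y → y ≤ b₀ → (l , suc ρ , y) ∈ tr ++ map f t₀
    new {y} _ a<y y≤b = ∈-++⁺ʳ tr (∈-map⁺ f (∈-down⁺ (b₀ ∸ a₀) a<y (subst (y ≤_) (sym (m+[n∸m]≡n a≤b)) y≤b)))
    only : ∀ {m r y} → (m , r , y) ∈ tr ++ map f t₀ → (m , r , y) ∈ tr ⊎ (l ≤ ρ × m ≡ l × r ≡ suc ρ × a₀ < y × y ≤ b₀)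
    only y∈ with ∈-++⁻ tr y∈
    ... | inj₁ y∈' = inj₁ y∈'
    ... | inj₂ y∈' with y , y∈t , refl ← ∈-map⁻ f y∈' = inj₂ (l≤ρ , refl , refl , bounds y∈t)

  -- Of the `suc l` balls in row `suc l`, earlier stages have labeled all but one, so the stage
  -- consists of a single path.
  stage-state : ∀ {s} → suc l ≤ L → State (suc l) l s → State (suc l) L (stage Q L N s (suc l))
  stage-state {l} {s} l<L S = subst (λ xs → State (suc l) L (stageOn (suc l) s xs)) (sym single)
    (path-state (L ∸ suc l) (m+[n∸m]≡n l<L) (s≤s z≤n) ≤-refl
      (extend-state S (s≤s z≤n) ≤-refl l<L (λ z → z) (λ l<l _ _ → contradiction l<l (<-irrefl refl)) inj₁))
    where
    x₀ = pos (suc l) (suc l)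
    x-range = in-range (s≤s z≤n) ≤-refl l<L
    x∈ : x₀ ∈ starts Q N (labs s) (suc l)
    x∈ = ∈-starts⁺ Q N (labs s) (suc l) (proj₁ x-range) (proj₂ x-range) (is-ball (s≤s z≤n) ≤-refl l<L)
           (unlabeled S (s≤s z≤n) ≤-refl l<L)
    only : ∀ {y} → y ∈ starts Q N (labs s) (suc l) → y ≡ x₀
    only y∈ with (1≤y , y≤N) , bl , un ← ∈-starts⁻ Q N (labs s) (suc l) y∈
      with i , 1≤i , i≤l , refl ← all-balls (s≤s z≤n) l<L 1≤y y≤N bl
      with i ≟ suc l
    ... | yes refl = refl
    ... | no ne    = contradiction (trans (sym un) (label S (1≤i , i≤l , l<L , inj₁ (≤∧≢⇒< i≤l ne)))) (λ ())
    single : starts Q N (labs s) (suc l) ≡ x₀ ∷ []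
    single = unique-singleton (starts-unique Q N (labs s) (suc l)) x∈ only

  next-stage-state : ∀ {s} → State l L s → State (suc l) l s
  next-stage-state S = record
    { label = label S ∘ cell-next-stage⁻
    ; cell  = λ e → let c , p = cell S e in cell-next-stage⁺ c , p
    ; trav⁺ = λ m≤r c → trav⁺ S m≤r (cell-next-stage⁻ c)
    ; trav⁻ = λ y∈ → let r' , e , m≤r' , c , bd = trav⁻ S y∈ in r' , e , m≤r' , cell-next-stage⁺ c , bd }

  stages-state : ∀ d {l} s → l + d ≡ L → State (suc l) l s → State (suc L) L (foldl (stage Q L N) s (upFrom (suc l) d))
  stages-state zero    {l} s eq S = subst (λ z → State (suc z) z s) (trans (sym (+-identityʳ l)) eq) S
  stages-state (suc d) {l} s eq S = stages-state d (stage Q L N s (suc l)) (trans (sym (+-suc l d)) eq)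
    (next-stage-state (stage-state (subst (l <_) eq (m<m+n l z<s)) S))

  initial-state : State 1 0 (st [] [])
  initial-state = record { label = λ c → ⊥-elim (none c) ; cell = λ () ; trav⁺ = λ _ c → ⊥-elim (none c) ; trav⁻ = λ () }
    where
    none : ∀ {m r} → Cell L 1 0 m r → ⊥
    none (p , _ , _ , inj₁ (s≤s m≤0))    = <-irrefl refl (≤-trans p m≤0)
    none (p , q , _ , inj₂ (refl , r≤0)) = <-irrefl refl (≤-trans (≤-trans p q) r≤0)

  final-state : State (suc L) L (bully Q L N)
  final-state = subst (λ xs → State (suc L) L (foldl (stage Q L N) (st [] []) xs))
    (sym (applyUpTo-upFrom 1 L suc (λ _ → refl))) (stages-state L (st [] []) refl initial-state)

  final-label : 1 ≤ i → i ≤ L → labelOf (labs (bully Q L N)) L (pos i L) ≡ just i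
  final-label 1≤i i≤L = label final-state (1≤i , i≤L , ≤-refl , inj₁ (s≤s i≤L))

  traversed⁺ : 1 ≤ i → i ≤ r → suc r ≤ L → pos i (suc r) < y → y ≤ pos i r → (i , suc r , y) ∈ trav (bully Q L N)
  traversed⁺ 1≤i i≤r r<L = trav⁺ final-state i≤r (1≤i , m≤n⇒m≤1+n i≤r , r<L , inj₁ (s≤s (≤-trans i≤r (<⇒≤ r<L))))

  traversed⁻ : (i , r , y) ∈ trav (bully Q L N) →
    ∃ λ r' → r ≡ suc r' × 1 ≤ i × i ≤ r' × suc r' ≤ L × pos i (suc r') < y × y ≤ pos i r'
  traversed⁻ y∈ with r' , refl , i≤r' , (1≤i , _ , r<L , _) , bd ← trav⁻ final-state y∈ = r' , refl , 1≤i , i≤r' , r<L , bd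

-- Covered vacancies as intervals of columns

module Covering {w : List ℕ} {Q : List (List Bool)} {pos : ℕ → ℕ → ℕ} (U : UnwrappedTable Q (rowsOf w) (colsOf w) pos) where
  open UnwrappedTable U
  open Simulation U
  private
    L = rowsOf w
    N = colsOf w

  covered⁻ : ∀ i r y → iCovered w Q i r y ≡ true →
    ∃ λ r' → r ≡ suc r' × 1 ≤ i × i ≤ r' × suc r' ≤ L × pos i (suc r') < y × y ≤ pos i r'
  covered⁻ i r y eq with _ , eq₁ ← ∧-true⁻ {not (ball Q r y)} eq
    with eq₂ , _ ← ∧-true⁻ eq₁
    with (l , r' , y') , t∈ , eq₃ ← any-true⁻ _ (trav (bully Q L N)) eq₂
    with e₁ , eq₄ ← ∧-true⁻ {l ≡ᵇ i} eq₃
    with e₂ , e₃ ← ∧-true⁻ {r' ≡ᵇ r} eq₄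
    with refl ← ≡ᵇ-true⁻ {l} {i} e₁ with refl ← ≡ᵇ-true⁻ {r'} {r} e₂ with refl ← ≡ᵇ-true⁻ {y'} {y} e₃
    = traversed⁻ t∈

  -- Two traversed intervals of a row cannot meet: the one starting further
  -- left would contain the ball that ends the other.
  disjoint : 1 ≤ i → i ≤ r → 1 ≤ j → j ≤ r → suc r ≤ L → pos i (suc r) < y → y ≤ pos i r →
    pos j (suc r) < y → y ≤ pos j r → i ≡ j
  disjoint {i} {r} {j} 1≤i i≤r 1≤j j≤r r<L a<y y≤b a'<y y≤b' with <-cmp (pos i (suc r)) (pos j (suc r))
  ... | tri≈ _ e _ = injective 1≤i (m≤n⇒m≤1+n i≤r) 1≤j (m≤n⇒m≤1+n j≤r) r<L e
  ... | tri< lt _ _ = contradiction (<-trans (gap 1≤i i≤r r<L 1≤j (m≤n⇒m≤1+n j≤r) lt) (<-≤-trans a'<y y≤b)) (<-irrefl refl)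
  ... | tri> _ _ gt = contradiction (<-trans (gap 1≤j j≤r r<L 1≤i (m≤n⇒m≤1+n i≤r) gt) (<-≤-trans a<y y≤b')) (<-irrefl refl)

  covered⁺ : ∀ {i r y} → 1 ≤ i → i ≤ r → suc r ≤ L → pos i (suc r) < y → y ≤ pos i r → iCovered w Q i (suc r) y ≡ true
  covered⁺ {i} {r} {y} 1≤i i≤r r<L a<y y≤b =
    ∧-true⁺ (not-true⁺ (vacant 1≤i i≤r r<L a<y y≤b))
      (∧-true⁺ (any-true⁺ _ (traversed⁺ 1≤i i≤r r<L a<y y≤b)
                 (∧-true⁺ (≡ᵇ-true⁺ {i} refl) (∧-true⁺ (≡ᵇ-true⁺ {r} refl) (≡ᵇ-true⁺ {y} refl))))
               (not-true⁺ not-earlier))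
    where
    not-earlier : ¬ _ ≡ true
    not-earlier eq with (l , r' , y') , t∈ , eq₁ ← any-true⁻ _ (trav (bully Q L N)) eq
      with l<i , eq₂ ← ∧-true⁻ {l <ᵇ i} eq₁
      with e₂ , e₃ ← ∧-true⁻ {r' ≡ᵇ suc r} eq₂
      with refl ← ≡ᵇ-true⁻ {r'} {suc r} e₂ with refl ← ≡ᵇ-true⁻ {y'} {y} e₃
      with _ , refl , 1≤l , l≤r , _ , a'<y , y≤b' ← traversed⁻ t∈
      = <⇒≢ (<ᵇ-true⁻ {l} {i} l<i) (disjoint 1≤l l≤r 1≤i i≤r r<L a'<y y≤b' a<y y≤b)

  numCovered-in : 1 ≤ i → i ≤ r → suc r ≤ L → numCovered w Q i (suc r) ≡ pos i r ∸ pos i (suc r)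
  numCovered-in {i} {r} 1≤i i≤r r<L =
    trans (count-interval (iCovered w Q i (suc r)) (weak 1≤i i≤r r<L)
            (λ {y} e → only (covered⁻ i (suc r) y e)) (covered⁺ 1≤i i≤r r<L) N)
          (cong (_∸ pos i (suc r)) (m≥n⇒m⊓n≡n (proj₂ (in-range 1≤i i≤r (<⇒≤ r<L)))))
    where
    only : ∀ {y} → (∃ λ r' → suc r ≡ suc r' × 1 ≤ i × i ≤ r' × suc r' ≤ L × pos i (suc r') < y × y ≤ pos i r') →
           pos i (suc r) < y × y ≤ pos i r
    only (_ , refl , _ , _ , _ , bd) = bd

  numCovered-out : ∀ i r → ¬ (1 ≤ i × i < r × r ≤ L) → numCovered w Q i r ≡ 0
  numCovered-out i r out = trans
    -- The empty interval `(0 , 0]`, as nothing is to be counted.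
    (count-interval {0} {0} (iCovered w Q i r) z≤n
      (λ {y} e → let _ , e' , 1≤i , i≤r , r<L , _ = covered⁻ i r y e in
        ⊥-elim (out (1≤i , subst (i <_) (sym e') (s≤s i≤r) , subst (_≤ L) (sym e') r<L)))
      (λ 0<y y≤0 → contradiction (<-≤-trans 0<y y≤0) (<-irrefl refl)) N)
    (⊓-zeroʳ N)

-- The boundary word w(λ;n)

at-++ˡ : ∀ {d : A} xs {ys} → q < length xs → at d (xs ++ ys) q ≡ at d xs q
at-++ˡ {q = zero}  (x ∷ xs) _ = refl
at-++ˡ {q = suc q} (x ∷ xs) q< = at-++ˡ xs (s≤s⁻¹ q<)

at-++ʳ : ∀ {d : A} xs {ys} q → at d (xs ++ ys) (length xs + q) ≡ at d ys q
at-++ʳ []       q = refl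
at-++ʳ (x ∷ xs) q = at-++ʳ xs q

at-applyUpTo : ∀ {d : A} (f : ℕ → A) n → q < n → at d (applyUpTo f n) q ≡ f q
at-applyUpTo {q = zero}  f (suc n) _  = refl
at-applyUpTo {q = suc q} f (suc n) q< = at-applyUpTo (f ∘ suc) n (s≤s⁻¹ q<)

at-beyond : ∀ {d : A} xs → length xs ≤ q → at d xs q ≡ d
at-beyond []       _ = refl
at-beyond {q = suc q} (x ∷ xs) le = at-beyond xs (s≤s⁻¹ le)

at-≤-maxL : ∀ w q → at 0 w q ≤ maxL w
at-≤-maxL []      q       = z≤n
at-≤-maxL (x ∷ w) zero    = m≤m⊔n x (maxL w)
at-≤-maxL (x ∷ w) (suc q) = ≤-trans (at-≤-maxL w q) (m≤n⊔m x (maxL w))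

maxL-≤ : ∀ w → (∀ {q} → q < length w → at 0 w q ≤ m) → maxL w ≤ m
maxL-≤ []      h = z≤n
maxL-≤ (x ∷ w) h = ⊔-lub (h z<s) (maxL-≤ w (h ∘ s≤s))

Decreasing : List ℕ → Set
Decreasing = Linked _≥_

decreasing-at-suc : ∀ {xs} → Decreasing xs → ∀ q → at 0 xs (suc q) ≤ at 0 xs q
decreasing-at-suc []        q       = z≤n
decreasing-at-suc [-]       zero    = z≤n
decreasing-at-suc [-]       (suc q) = z≤n
decreasing-at-suc (p ∷ l)   zero    = p
decreasing-at-suc (p ∷ l)   (suc q) = decreasing-at-suc l q

decreasing-at : ∀ {xs} → Decreasing xs → ∀ q d → at 0 xs (q + d) ≤ at 0 xs q
decreasing-at {xs} dec q zero    = ≤-reflexive (cong (at 0 xs) (+-identityʳ q))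
decreasing-at {xs} dec q (suc d) = ≤-trans (≤-reflexive (cong (at 0 xs) (+-suc q d)))
  (≤-trans (decreasing-at-suc dec (q + d)) (decreasing-at dec q d))

decreasing-at-≤ : ∀ {xs q q'} → Decreasing xs → q ≤ q' → at 0 xs q' ≤ at 0 xs q
decreasing-at-≤ dec q≤q' with d , refl ← m≤n⇒∃[o]m+o≡n q≤q' = decreasing-at dec _ d

-- For weakly decreasing `ms` this is a part of the conjugate partition: the number of vertical
-- steps before the horizontal step that starts at abscissa `x`.
countGE : ℕ → List ℕ → ℕ
countGE x ms = length (filter (x ≤?_) ms)

countGE-accept : ∀ {ms} → x ≤ m → countGE x (m ∷ ms) ≡ suc (countGE x ms)
countGE-accept {x} x≤m = cong length (filter-accept (x ≤?_) x≤m)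

countGE-none : ∀ {ms} → Decreasing (c ∷ ms) → c < x → countGE x ms ≡ 0
countGE-none {c} {x} {ms} dec c<x = cong length (filter-none (x ≤?_) (all dec c<x))
  where
  all : ∀ {c ms} → Decreasing (c ∷ ms) → c < x → All (λ m → ¬ x ≤ m) ms
  all [-]         _   = []
  all (m≤c ∷ dec) c<x = (λ x≤m → <-irrefl refl (<-≤-trans c<x (≤-trans x≤m m≤c))) ∷ all dec (≤-<-trans m≤c c<x)

countGE-anti : ∀ ms → x ≤ y → countGE y ms ≤ countGE x ms
countGE-anti []       _   = z≤n
countGE-anti {x} {y} (m ∷ ms) x≤y with y ≤? m | x ≤? m
... | yes y≤m | yes x≤m rewrite filter-accept (y ≤?_) {xs = ms} y≤m | filter-accept (x ≤?_) {xs = ms} x≤m = s≤s (countGE-anti ms x≤y)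
... | yes y≤m | no ¬x≤m = contradiction (≤-trans x≤y y≤m) ¬x≤m
... | no ¬y≤m | yes x≤m rewrite filter-reject (y ≤?_) {xs = ms} ¬y≤m | filter-accept (x ≤?_) {xs = ms} x≤m = m≤n⇒m≤1+n (countGE-anti ms x≤y)
... | no ¬y≤m | no ¬x≤m rewrite filter-reject (y ≤?_) {xs = ms} ¬y≤m | filter-reject (x ≤?_) {xs = ms} ¬x≤m = countGE-anti ms x≤y

countGE-lower : ∀ {ms t} → Decreasing ms → t < length ms → x ≤ at 0 ms t → suc t ≤ countGE x ms
countGE-lower {x} {m ∷ ms} {zero}  dec _  x≤ = subst (1 ≤_) (sym (countGE-accept x≤)) (s≤s z≤n)
countGE-lower {x} {m ∷ ms} {suc t} dec t< x≤ =
  subst (suc (suc t) ≤_) (sym (countGE-accept (≤-trans x≤ (decreasing-at-≤ dec (z≤n {suc t})))))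
    (s≤s (countGE-lower (Linked.tail dec) (s≤s⁻¹ t<) x≤))

countGE-upper : ∀ {ms t} → Decreasing ms → t < length ms → at 0 ms t < x → countGE x ms ≤ t
countGE-upper {x} {m ∷ ms} {zero}  dec _ m<x =
  ≤-reflexive (trans (cong length (filter-reject (x ≤?_) (<⇒≱ m<x))) (countGE-none dec m<x))
countGE-upper {x} {m ∷ ms} {suc t} dec t< at<x with x ≤? m
... | yes x≤m = subst (_≤ suc t) (sym (countGE-accept x≤m)) (s≤s (countGE-upper (Linked.tail dec) (s≤s⁻¹ t<) at<x))
... | no ¬x≤m = subst (_≤ suc t) (sym (trans (cong length (filter-reject (x ≤?_) ¬x≤m)) (countGE-none dec (≰⇒> ¬x≤m)))) z≤n

length-hsteps : ∀ n c k → length (hsteps n c k) ≡ k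
length-hsteps n c zero    = refl
length-hsteps n c (suc k) = cong suc (length-hsteps n (c ∸ 1) k)

at-hsteps : ∀ n c k {q} → q < k → at 0 (hsteps n c k) q ≡ suc n ∸ (c ∸ q)
at-hsteps n c (suc k) {zero}  _  = refl
at-hsteps n c (suc k) {suc q} q< = trans (at-hsteps n (c ∸ 1) k (s≤s⁻¹ q<)) (cong (suc n ∸_) (∸-+-assoc c 1 q))

length-wgo : ∀ n c i {ms} → Decreasing (c ∷ ms) → length (wgo n c i ms) ≡ c + length ms
length-wgo n c i {[]}     dec = trans (length-hsteps n c c) (sym (+-identityʳ c))
length-wgo n c i {m ∷ ms} (m≤c ∷ dec) = begin
  length (hsteps n c (c ∸ m) ++ (i ∷ wgo n m (suc i) ms))           ≡⟨ length-++ (hsteps n c (c ∸ m)) ⟩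
  length (hsteps n c (c ∸ m)) + suc (length (wgo n m (suc i) ms))   ≡⟨ cong₂ (λ u v → u + suc v) (length-hsteps n c (c ∸ m)) (length-wgo n m (suc i) dec) ⟩
  (c ∸ m) + suc (m + length ms)                                     ≡⟨ +-suc (c ∸ m) (m + length ms) ⟩
  suc ((c ∸ m) + (m + length ms))                                   ≡⟨ cong suc (+-assoc (c ∸ m) m (length ms)) ⟨
  suc ((c ∸ m) + m + length ms)                                     ≡⟨ cong (λ u → suc (u + length ms)) (m∸n+n≡m m≤c) ⟩
  suc (c + length ms)                                               ≡⟨ +-suc c (length ms) ⟨
  c + suc (length ms)                                               ∎
  where open ≡-Reasoning

at-wgo-rest : ∀ n c i m ms q → at 0 (wgo n c i (m ∷ ms)) ((c ∸ m) + q) ≡ at 0 (i ∷ wgo n m (suc i) ms) q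
at-wgo-rest n c i m ms q = trans (cong (λ u → at 0 (wgo n c i (m ∷ ms)) (u + q)) (sym (length-hsteps n c (c ∸ m))))
  (at-++ʳ (hsteps n c (c ∸ m)) q)

∸-split : x ≤ m → m ≤ c → c ∸ x ≡ (c ∸ m) + (m ∸ x)
∸-split {x} {m} {c} x≤m m≤c = trans (cong (_∸ x) (sym (m∸n+n≡m m≤c))) (+-∸-assoc (c ∸ m) x≤m)

-- Shifts an index past the first block of the word, which consists of `c ∸ m` horizontal steps and
-- one vertical step.
vertical-index : x ≤ m → m ≤ c → suc t + (c ∸ x) ≡ (c ∸ m) + suc (t + (m ∸ x))
vertical-index {x} {m} {c} {t} x≤m m≤c = begin
  suc t + (c ∸ x)               ≡⟨ cong (suc t +_) (∸-split x≤m m≤c) ⟩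
  suc t + ((c ∸ m) + (m ∸ x))   ≡⟨ +-assoc (suc t) (c ∸ m) (m ∸ x) ⟨
  suc t + (c ∸ m) + (m ∸ x)     ≡⟨ cong (_+ (m ∸ x)) (+-comm (suc t) (c ∸ m)) ⟩
  (c ∸ m) + suc t + (m ∸ x)     ≡⟨ +-assoc (c ∸ m) (suc t) (m ∸ x) ⟩
  (c ∸ m) + suc (t + (m ∸ x))   ∎
  where open ≡-Reasoning

horizontal-index : ∀ {ms} → x ≤ m → m ≤ c →
  (c ∸ x) + countGE x (m ∷ ms) ≡ (c ∸ m) + suc ((m ∸ x) + countGE x ms)
horizontal-index {x} {m} {c} {ms} x≤m m≤c = begin
  (c ∸ x) + countGE x (m ∷ ms)                ≡⟨ cong₂ _+_ (∸-split x≤m m≤c) (countGE-accept x≤m) ⟩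
  (c ∸ m) + (m ∸ x) + suc (countGE x ms)      ≡⟨ +-assoc (c ∸ m) (m ∸ x) (suc (countGE x ms)) ⟩
  (c ∸ m) + ((m ∸ x) + suc (countGE x ms))    ≡⟨ cong ((c ∸ m) +_) (+-suc (m ∸ x) (countGE x ms)) ⟩
  (c ∸ m) + suc ((m ∸ x) + countGE x ms)      ∎
  where open ≡-Reasoning

wgo-vertical : ∀ n c i {ms} → Decreasing (c ∷ ms) → t < length ms →
  at 0 (wgo n c i ms) (t + (c ∸ at 0 ms t)) ≡ i + t
wgo-vertical {zero} n c i {m ∷ ms} (m≤c ∷ dec) _ =
  trans (cong (at 0 (wgo n c i (m ∷ ms))) (sym (+-identityʳ (c ∸ m))))
  (trans (at-wgo-rest n c i m ms 0) (sym (+-identityʳ i)))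
wgo-vertical {suc t} n c i {m ∷ ms} (m≤c ∷ dec) t< =
  trans (cong (at 0 (wgo n c i (m ∷ ms))) (vertical-index (decreasing-at-≤ dec (z≤n {suc t})) m≤c))
  (trans (at-wgo-rest n c i m ms (suc (t + (m ∸ at 0 ms t))))
  (trans (wgo-vertical n m (suc i) dec (s≤s⁻¹ t<)) (sym (+-suc i t))))

-- The step starting at `x` comes after the horizontal steps that start at `c, …, x + 1` and the
-- vertical steps of all rows of length at least `x`.
wgo-horizontal : ∀ n c i {ms} → Decreasing (c ∷ ms) → 1 ≤ x → x ≤ c →
  at 0 (wgo n c i ms) ((c ∸ x) + countGE x ms) ≡ suc n ∸ x
wgo-horizontal {x} n c i {[]} dec 1≤x x≤c = trans (cong (at 0 (hsteps n c c)) (+-identityʳ (c ∸ x)))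
  (trans (at-hsteps n c c (∸-monoʳ-< 1≤x x≤c)) (cong (suc n ∸_) (m∸[m∸n]≡n x≤c)))
wgo-horizontal {x} n c i {m ∷ ms} (m≤c ∷ dec) 1≤x x≤c with x ≤? m
... | yes x≤m = trans (cong (at 0 (wgo n c i (m ∷ ms))) (horizontal-index {ms = ms} x≤m m≤c))
  (trans (at-wgo-rest n c i m ms (suc ((m ∸ x) + countGE x ms))) (wgo-horizontal n m (suc i) dec 1≤x x≤m))
... | no ¬x≤m = begin
  at 0 (wgo n c i (m ∷ ms)) ((c ∸ x) + countGE x (m ∷ ms))  ≡⟨ cong (λ u → at 0 (wgo n c i (m ∷ ms)) ((c ∸ x) + u)) none ⟩
  at 0 (wgo n c i (m ∷ ms)) ((c ∸ x) + 0)                   ≡⟨ cong (at 0 (wgo n c i (m ∷ ms))) (+-identityʳ (c ∸ x)) ⟩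
  at 0 (wgo n c i (m ∷ ms)) (c ∸ x)                         ≡⟨ at-++ˡ (hsteps n c (c ∸ m)) (subst (c ∸ x <_) (sym (length-hsteps n c (c ∸ m))) lt) ⟩
  at 0 (hsteps n c (c ∸ m)) (c ∸ x)                         ≡⟨ at-hsteps n c (c ∸ m) lt ⟩
  suc n ∸ (c ∸ (c ∸ x))                                     ≡⟨ cong (suc n ∸_) (m∸[m∸n]≡n x≤c) ⟩
  suc n ∸ x                                                 ∎
  where
  open ≡-Reasoning
  m<x = ≰⇒> ¬x≤m
  none : countGE x (m ∷ ms) ≡ 0
  none = trans (cong length (filter-reject (x ≤?_) ¬x≤m)) (countGE-none dec m<x)
  lt : c ∸ x < c ∸ m
  lt = ∸-monoʳ-< m<x x≤c

wgo-onto : ∀ c {ms} → Decreasing (c ∷ ms) → q < c + length ms →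
  (∃ λ t → t < length ms × q ≡ t + (c ∸ at 0 ms t)) ⊎ (∃ λ x → 1 ≤ x × x ≤ c × q ≡ (c ∸ x) + countGE x ms)
wgo-onto {q} c {[]} dec q< = inj₂ (c ∸ q , m<n⇒0<n∸m q<c , m∸n≤m c q ,
  trans (sym (m∸[m∸n]≡n (<⇒≤ q<c))) (sym (+-identityʳ _)))
  where q<c = subst (q <_) (+-identityʳ c) q<
wgo-onto {q} c {m ∷ ms} (m≤c ∷ dec) q< with q <? c ∸ m
... | yes q<c∸m = inj₂ (c ∸ q , m<n⇒0<n∸m q<c , m∸n≤m c q ,
        trans (sym (m∸[m∸n]≡n (<⇒≤ q<c))) (trans (sym (+-identityʳ _)) (cong ((c ∸ (c ∸ q)) +_) (sym none))))
  where
  q<c = <-≤-trans q<c∸m (m∸n≤m c m)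
  m<c∸q : m < c ∸ q
  m<c∸q = subst (_< c ∸ q) (m∸[m∸n]≡n m≤c) (∸-monoʳ-< q<c∸m (m∸n≤m c m))
  none : countGE (c ∸ q) (m ∷ ms) ≡ 0
  none = trans (cong length (filter-reject ((c ∸ q) ≤?_) (<⇒≱ m<c∸q))) (countGE-none dec m<c∸q)
... | no ¬q< with m≤n⇒∃[o]m+o≡n (≮⇒≥ ¬q<)
...   | zero , refl = inj₁ (0 , z<s , +-identityʳ (c ∸ m))
...   | suc q' , refl with wgo-onto {q'} m dec (+-cancelˡ-< (c ∸ m) _ _ (s≤s⁻¹ (subst₂ _<_ (+-suc (c ∸ m) q') total q<)))
  where
  total : c + suc (length ms) ≡ suc ((c ∸ m) + (m + length ms))
  total = trans (+-suc c (length ms)) (cong suc (trans (cong (_+ length ms) (sym (m∸n+n≡m m≤c))) (+-assoc (c ∸ m) m (length ms))))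
...     | inj₁ (t , t< , refl) = inj₁ (suc t , s≤s t< , sym (vertical-index (decreasing-at-≤ dec (z≤n {suc t})) m≤c))
...     | inj₂ (x , 1≤x , x≤m , refl) = inj₂ (x , 1≤x , ≤-trans x≤m m≤c , sym (horizontal-index {ms = ms} x≤m m≤c))

module Word (L : ℕ) (p : List ℕ) (val : Val (suc L) p) where

  lam : ℕ → ℕ
  lam = part p

  k : ℕ
  k = suc L ∸ lam 1

  w : List ℕ
  w = wperm (suc L) p

  private
    n : ℕ
    n = suc L

    ms : List ℕ
    ms = applyUpTo (λ q → part p (suc q)) k

    dec-p : Decreasing p
    dec-p = proj₁ (proj₁ val)

  1≤lam : 1 ≤ lam 1
  1≤lam = head-positive p (proj₂ (proj₁ val)) (proj₁ (proj₂ val))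
    where
    head-positive : ∀ p → All (1 ≤_) p → 1 ≤ length p → 1 ≤ part p 1
    head-positive (_ ∷ _) (1≤x ∷ _) _ = 1≤x

  lam≤n∸len : lam 1 ≤ suc L ∸ length p
  lam≤n∸len = proj₁ (proj₂ (proj₂ val))

  1≤len : 1 ≤ length p
  1≤len = proj₁ (proj₂ val)

  lam≤L : lam 1 ≤ L
  lam≤L = ≤-trans lam≤n∸len (∸-monoʳ-≤ (suc L) 1≤len)

  lam≤n : lam 1 ≤ suc L
  lam≤n = m≤n⇒m≤1+n lam≤L

  total : lam 1 + k ≡ suc L
  total = m+[n∸m]≡n lam≤n

  k≤L : k ≤ L
  k≤L = ∸-monoʳ-≤ (suc L) 1≤lam

  1≤k : 1 ≤ k
  1≤k = m<n⇒0<n∸m (s≤s lam≤L)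

  -- A greater length would truncate the bound in `Val` to `lam 1 ≤ 0`.
  len≤n : length p ≤ suc L
  len≤n = ≮⇒≥ (λ n<len → <-irrefl refl (≤-trans 1≤lam (≤-trans lam≤n∸len (≤-reflexive (m≤n⇒m∸n≡0 (<⇒≤ n<len))))))

  len≤k : length p ≤ k
  len≤k = ≤-trans (≤-reflexive (sym (m∸[m∸n]≡n len≤n))) (∸-monoʳ-≤ (suc L) lam≤n∸len)

  lam-anti : 1 ≤ i → i ≤ j → lam j ≤ lam i
  lam-anti 1≤i i≤j = decreasing-at-≤ dec-p (∸-monoˡ-≤ 1 i≤j)

  private
    length-ms : length ms ≡ k
    length-ms = length-applyUpTo (λ q → part p (suc q)) k

    at-ms : q < k → at 0 ms q ≡ lam (suc q)
    at-ms q<k = at-applyUpTo (λ q → part p (suc q)) k q<k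

    dec-ms : Decreasing ms
    dec-ms = Linked.applyUpTo⁺₂ (λ q → part p (suc q)) k (λ q → decreasing-at-suc dec-p q)

    cons-dec : ∀ {xs} → at 0 xs 0 ≤ c → Decreasing xs → Decreasing (c ∷ xs)
    cons-dec {xs = []}    _ _   = [-]
    cons-dec {xs = _ ∷ _} h dec = h ∷ dec

    dec : Decreasing (lam 1 ∷ ms)
    dec = cons-dec (≤-reflexive (at-ms 1≤k)) dec-ms

  -- The position of `j` in `w` in closed form, counted from 1. In the second case `suc (suc L) ∸ j`
  -- is the abscissa where horizontal step `j` starts.
  col : ℕ → ℕ
  col j with j ≤? k
  ... | yes _ = j + (lam 1 ∸ lam j)
  ... | no _  = suc ((lam 1 ∸ (suc (suc L) ∸ j)) + countGE (suc (suc L) ∸ j) ms)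

  col-vert : j ≤ k → col j ≡ j + (lam 1 ∸ lam j)
  col-vert {j} j≤k with j ≤? k
  ... | yes _   = refl
  ... | no ¬j≤k = contradiction j≤k ¬j≤k

  col-hor : k < j → col j ≡ suc ((lam 1 ∸ (suc n ∸ j)) + countGE (suc n ∸ j) ms)
  col-hor {j} k<j with j ≤? k
  ... | yes j≤k = contradiction (<-≤-trans k<j j≤k) (<-irrefl refl)
  ... | no _    = refl

  private
    step≤ : k < j → suc n ∸ j ≤ lam 1
    step≤ k<j = ≤-trans (∸-monoʳ-≤ (suc n) k<j) (≤-reflexive (m∸[m∸n]≡n lam≤n))

    step≥ : j ≤ n → 1 ≤ suc n ∸ j
    step≥ j≤n = m<n⇒0<n∸m (s≤s j≤n)

  length-w : length w ≡ suc L
  length-w = trans (length-wgo n (lam 1) 1 dec) (trans (cong (lam 1 +_) length-ms) total)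

  w-at-col : 1 ≤ j → j ≤ suc L → at 0 w (col j ∸ 1) ≡ j
  w-at-col {suc j} _ j≤n with suc j ≤? k
  ... | yes j<k = trans (cong (λ u → at 0 w (j + (lam 1 ∸ u))) (sym (at-ms j<k)))
                        (wgo-vertical n (lam 1) 1 dec (subst (j <_) (sym length-ms) j<k))
  ... | no ¬j<k = trans (wgo-horizontal n (lam 1) 1 dec (step≥ j≤n) (step≤ (≰⇒> ¬j<k)))
                        (m∸[m∸n]≡n (m≤n⇒m≤1+n j≤n))

  private
    onto : q < suc L → ∃ λ j → 1 ≤ j × j ≤ suc L × suc q ≡ col j
    onto {q} q<n with wgo-onto (lam 1) dec (subst (q <_) (sym (trans (cong (lam 1 +_) length-ms) total)) q<n)
    ... | inj₁ (t , t< , refl) = suc t , s≤s z≤n , ≤-trans t<k (m∸n≤m n (lam 1)) ,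
            trans (cong (λ u → suc (t + (lam 1 ∸ u))) (at-ms t<k)) (sym (col-vert t<k))
      where t<k = subst (t <_) length-ms t<
    ... | inj₂ (x , 1≤x , x≤lam , refl) = suc n ∸ x , step≥ (≤-trans x≤lam lam≤n) , ∸-monoʳ-≤ (suc n) 1≤x ,
            trans (cong (λ u → suc ((lam 1 ∸ u) + countGE u ms)) (sym (m∸[m∸n]≡n (m≤n⇒m≤1+n (≤-trans x≤lam lam≤n)))))
                  (sym (col-hor (subst (_≤ suc n ∸ x) (+-∸-assoc 1 lam≤n) (∸-monoʳ-≤ (suc n) x≤lam))))

  col-onto : 1 ≤ x → x ≤ suc L → ∃ λ j → 1 ≤ j × j ≤ suc L × x ≡ col j
  col-onto {suc q} _ q<n = onto q<n

  maxL-w : maxL w ≡ suc L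
  maxL-w = ≤-antisym (maxL-≤ w (λ {q} q< → bound q (onto (subst (q <_) length-w q<))))
    (subst (_≤ maxL w) (w-at-col (s≤s z≤n) ≤-refl) (at-≤-maxL w (col (suc L) ∸ 1)))
    where
    bound : ∀ q → (∃ λ j → 1 ≤ j × j ≤ suc L × suc q ≡ col j) → at 0 w q ≤ suc L
    bound q (j , 1≤j , j≤n , e) = subst (_≤ suc L) (sym (trans (cong (λ u → at 0 w (u ∸ 1)) e) (w-at-col 1≤j j≤n))) j≤n

  col-positive : 1 ≤ j → ∃ λ q → col j ≡ suc q
  col-positive {suc j} _ with suc j ≤? k
  ... | yes _ = _ , refl
  ... | no _  = _ , refl

  col-range : 1 ≤ j → j ≤ suc L → 1 ≤ col j × col j ≤ suc L
  col-range {j} 1≤j j≤n with q , e ← col-positive 1≤j with q <? length w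
  ... | yes q< = subst (λ u → 1 ≤ u × u ≤ suc L) (sym e) (s≤s z≤n , subst (suc q ≤_) length-w q<)
  -- Beyond the end of the word `at` returns the default 0, but `w-at-col` finds `j ≥ 1` there.
  ... | no ¬q< = contradiction (trans (sym (at-beyond w (≮⇒≥ ¬q<)))
                   (trans (cong (λ u → at 0 w (u ∸ 1)) (sym e)) (w-at-col 1≤j j≤n))) (<⇒≢ 1≤j)

  col-horiz : k < i → i < j → j ≤ suc L → col i < col j
  col-horiz {i} {j} k<i i<j j≤n = subst₂ _<_ (sym (col-hor k<i)) (sym (col-hor (<-trans k<i i<j)))
    (s≤s (+-mono-<-≤ (∸-monoʳ-< x<x (step≤ k<i)) (countGE-anti ms (<⇒≤ x<x))))
    where
    x<x : suc n ∸ j < suc n ∸ i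
    x<x = ∸-monoʳ-< i<j (m≤n⇒m≤1+n j≤n)

  col-before : 1 ≤ i → i ≤ k → k < j → j ≤ suc L → suc L < j + lam i → col i < col j
  col-before {suc t} {j} _ t<k k<j j≤n lt = subst₂ _<_ (sym (col-vert t<k)) (sym (col-hor k<j))
    (s≤s (≤-trans (+-mono-≤ cnt (∸-monoʳ-≤ (lam 1) x≤lam)) (≤-reflexive (+-comm (countGE (suc n ∸ j) ms) _))))
    where
    x≤lam : suc n ∸ j ≤ lam (suc t)
    x≤lam = m≤n+o⇒m∸n≤o (suc n) j lt
    cnt : suc t ≤ countGE (suc n ∸ j) ms
    cnt = countGE-lower dec-ms (subst (t <_) (sym length-ms) t<k) (subst (_ ≤_) (sym (at-ms t<k)) x≤lam)

  col-after : 1 ≤ i → i ≤ k → k < j → j ≤ suc L → j + lam i ≤ suc L → col j < col i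
  col-after {suc t} {j} _ t<k k<j j≤n le = subst₂ _<_ (sym (col-hor k<j)) (sym (col-vert t<k))
    (s≤s (<-≤-trans (+-mono-<-≤ (∸-monoʳ-< lam<x (step≤ k<j)) cnt) (≤-reflexive (+-comm _ t))))
    where
    lam<x : lam (suc t) < suc n ∸ j
    lam<x = m+n≤o⇒m≤o∸n (suc (lam (suc t))) (s≤s (subst (_≤ n) (+-comm j _) le))
    cnt : countGE (suc n ∸ j) ms ≤ t
    cnt = countGE-upper dec-ms (subst (t <_) (sym length-ms) t<k) (subst (_< _) (sym (at-ms t<k)) lam<x)

  boundary : BoundaryWord L k lam col
  boundary = record
    { total = total ; lam-anti = lam-anti
    ; c-vertical = λ {i} 1≤i i≤k → trans (cong (_+ lam i) (col-vert i≤k))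
        (trans (+-assoc i _ _) (cong (i +_) (m∸n+n≡m (lam-anti ≤-refl 1≤i))))
    ; c-range = col-range ; c-horiz = col-horiz ; c-before = col-before ; c-after = col-after ; c-onto = col-onto }

-- Rows of a tableau

at-ext : ∀ {δ : A} (xs ys : List A) → length xs ≡ length ys → (∀ {q} → q < length xs → at δ xs q ≡ at δ ys q) → xs ≡ ys
at-ext []       []       _  _ = refl
at-ext (x ∷ xs) (y ∷ ys) le h = cong₂ _∷_ (h z<s) (at-ext xs ys (suc-injective le) (h ∘ s≤s))

All-at⁻ : ∀ {P : A → Set} (δ : A) {xs : List A} → All P xs → q < length xs → P (at δ xs q)
All-at⁻ {q = zero}  δ (p ∷ _)  _  = p
All-at⁻ {q = suc q} δ (_ ∷ ps) q< = All-at⁻ δ ps (s≤s⁻¹ q<)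

All-at⁺ : ∀ {P : ℕ → Set} R → (∀ {q} → q < length R → P (at 0 R q)) → All P R
All-at⁺ []      h = []
All-at⁺ (x ∷ R) h = h z<s ∷ All-at⁺ R (h ∘ s≤s)

-- Over all rows and all `e` these are the entries of the Gelfand-Tsetlin pattern, and they
-- determine each sorted row.
below : ℕ → List ℕ → ℕ
below e R = length (filter (_≤? e) R)

count : ℕ → List ℕ → ℕ
count r R = length (filter (_≟ r) R)

below-++ : ∀ e R R' → below e (R ++ R') ≡ below e R + below e R'
below-++ e R R' = trans (cong length (filter-++ (_≤? e) R R')) (length-++ (filter (_≤? e) R))

count-++ : ∀ r R R' → count r (R ++ R') ≡ count r R + count r R'
count-++ r R R' = trans (cong length (filter-++ (_≟ r) R R')) (length-++ (filter (_≟ r) R))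

below-≤-length : ∀ e R → below e R ≤ length R
below-≤-length e = length-filter (_≤? e)

below-all⁺ : All (_≤ e) R → below e R ≡ length R
below-all⁺ {e} all = cong length (filter-all (_≤? e) all)

below-all⁻ : ∀ R → below e R ≡ length R → All (_≤ e) R
below-all⁻ []      _  = []
below-all⁻ {e} (x ∷ R) eq with x ≤? e
... | yes x≤e = x≤e ∷ below-all⁻ R (suc-injective (trans (sym (cong length (filter-accept (_≤? e) {xs = R} x≤e))) eq))
... | no ¬x≤e = contradiction (trans (sym (cong length (filter-reject (_≤? e) {xs = R} ¬x≤e))) eq)
                  (<⇒≢ (s≤s (below-≤-length e R)))

below-none : All (e <_) R → below e R ≡ 0
below-none {e} all = cong length (filter-none (_≤? e) (All.map <⇒≱ all))

count-none : All (_≢ r) R → count r R ≡ 0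
count-none {r} all = cong length (filter-none (_≟ r) all)

below-accept : x ≤ e → below e (x ∷ R) ≡ suc (below e R)
below-accept {e = e} x≤e = cong length (filter-accept (_≤? e) x≤e)

below-reject : e < x → below e (x ∷ R) ≡ below e R
below-reject {e} e<x = cong length (filter-reject (_≤? e) (<⇒≱ e<x))

below-suc : ∀ e R → below (suc e) R ≡ below e R + count (suc e) R
below-suc e []      = refl
below-suc e (x ∷ R) with x ≤? e | x ≟ suc e
... | yes x≤e | yes refl = contradiction x≤e (<-irrefl refl)
... | yes x≤e | no x≢   rewrite filter-accept (_≤? e) {xs = R} x≤e | filter-accept (_≤? suc e) {xs = R} (m≤n⇒m≤1+n x≤e)
                               | filter-reject (_≟ suc e) {xs = R} x≢ = cong suc (below-suc e R)
... | no ¬x≤e | yes refl rewrite filter-reject (_≤? e) {xs = R} ¬x≤e | filter-accept (_≤? suc e) {xs = R} (≤-refl {suc e})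
                               | filter-accept (_≟ suc e) {xs = R} refl = trans (cong suc (below-suc e R)) (sym (+-suc _ _))
... | no ¬x≤e | no x≢   rewrite filter-reject (_≤? e) {xs = R} ¬x≤e
                               | filter-reject (_≤? suc e) {xs = R} (λ x≤ → x≢ (≤-antisym x≤ (≰⇒> ¬x≤e)))
                               | filter-reject (_≟ suc e) {xs = R} x≢ = below-suc e R

-- An entry of `R'` that is at most `suc e` stands under an entry of `R` that is at most `e`.
below-colStrict : ∀ R R' → length R' ≤ length R → ColStrict R R' → below (suc e) R' ≤ below e R
below-colStrict R []       _  _  = z≤n
below-colStrict {e} (x ∷ R) (y ∷ R') le cs with y ≤? suc e
... | yes y≤ = subst₂ _≤_ (sym (below-accept y≤)) (sym (below-accept (s≤s⁻¹ (≤-trans (cs 0 z<s) y≤))))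
                 (s≤s (below-colStrict R R' (s≤s⁻¹ le) (λ j j< → cs (suc j) (s≤s j<))))
... | no ¬y≤ = ≤-trans (≤-reflexive (below-reject (≰⇒> ¬y≤)))
                 (≤-trans (below-colStrict R R' (s≤s⁻¹ le) (λ j j< → cs (suc j) (s≤s j<))) weaken)
  where
  weaken : below e R ≤ below e (x ∷ R)
  weaken with x ≤? e
  ... | yes x≤ = ≤-trans (n≤1+n _) (≤-reflexive (sym (below-accept x≤)))
  ... | no ¬x≤ = ≤-reflexive (sym (below-reject (≰⇒> ¬x≤)))

sorted-pairs : Linked _≤_ R → AllPairs _≤_ R
sorted-pairs = Linked.Linked⇒AllPairs ≤-trans

-- In a sorted row the entries at most `e` form a prefix.
at-≤-below : AllPairs _≤_ R → j < below e R → at 0 R j ≤ e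
at-≤-below {x ∷ R} {j} {e} (x≤ ∷ ap) j< with x ≤? e
at-≤-below {x ∷ R} {zero}  (x≤ ∷ ap) j< | yes x≤e = x≤e
at-≤-below {x ∷ R} {suc j} (x≤ ∷ ap) j< | yes x≤e = at-≤-below ap (s≤s⁻¹ (subst (suc j <_) (below-accept {R = R} x≤e) j<))
... | no ¬x≤e = contradiction (subst (j <_) (below-none (≰⇒> ¬x≤e ∷ All.map (<-≤-trans (≰⇒> ¬x≤e)) x≤)) j<) (λ ())

at-below : AllPairs _≤_ R → j < length R → j < below (at 0 R j) R
at-below {x ∷ R} {zero}  (x≤ ∷ ap) j< = subst (0 <_) (sym (below-accept {R = R} (≤-refl {x}))) z<s
at-below {x ∷ R} {suc j} (x≤ ∷ ap) j< = subst (suc j <_) (sym (below-accept {R = R} (All-at⁻ 0 x≤ (s≤s⁻¹ j<))))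
  (s≤s (at-below ap (s≤s⁻¹ j<)))

-- It is enough to compare `below` at values that occur, since each entry is the least `e` at which
-- `below` exceeds its index.
sorted-≡ : Linked _≤_ R → Linked _≤_ R' → length R ≡ length R' →
  All (λ e → below e R ≡ below e R') R → All (λ e → below e R ≡ below e R') R' → R ≡ R'
sorted-≡ {R} {R'} s s' le h h' = at-ext R R' le λ {q} q< →
  let q<' = subst (q <_) le q< in
  ≤-antisym (at-≤-below (sorted-pairs s) (subst (q <_) (sym (All-at⁻ 0 h' q<')) (at-below (sorted-pairs s') q<')))
            (at-≤-below (sorted-pairs s') (subst (q <_) (All-at⁻ 0 h q<) (at-below (sorted-pairs s) q<)))

blocks : (ℕ → ℕ) → ℕ → ℕ → List ℕ
blocks μ r zero    = []
blocks μ r (suc d) = replicate (μ r) r ++ blocks μ (suc r) d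

blocks-bounds : ∀ μ r d → All (λ e → r ≤ e × e < r + d) (blocks μ r d)
blocks-bounds μ r zero    = []
blocks-bounds μ r (suc d) = All.++⁺ (All.replicate⁺ (μ r) (≤-refl , m<m+n r z<s))
  (All.map (λ {x} (p , q) → <⇒≤ p , subst (x <_) (sym (+-suc r d)) q) (blocks-bounds μ (suc r) d))

replicate-++-sorted : All (x ≤_) R → AllPairs _≤_ R → ∀ m → AllPairs _≤_ (replicate m x ++ R)
replicate-++-sorted h ap zero    = ap
replicate-++-sorted h ap (suc m) = All.++⁺ (All.replicate⁺ m ≤-refl) h ∷ replicate-++-sorted h ap m

blocks-sorted : ∀ μ r d → AllPairs _≤_ (blocks μ r d)
blocks-sorted μ r zero    = []
blocks-sorted μ r (suc d) = replicate-++-sorted (All.map (<⇒≤ ∘ proj₁) (blocks-bounds μ (suc r) d)) (blocks-sorted μ (suc r) d) (μ r)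

count-replicate : ∀ m → count r (replicate m r) ≡ m
count-replicate {r} m = trans (cong length (filter-all (_≟ r) (All.replicate⁺ m refl))) (length-replicate m)

count-blocks : ∀ μ r d → r ≤ x → x < r + d → count x (blocks μ r d) ≡ μ x
count-blocks μ r zero    r≤x x< = contradiction (≤-<-trans r≤x (subst (_ <_) (+-identityʳ r) x<)) (<-irrefl refl)
count-blocks {x} μ r (suc d) r≤x x< with r ≟ x
... | yes refl = trans (count-++ r (replicate (μ r) r) _)
       (trans (cong₂ _+_ (count-replicate (μ r)) (count-none (All.map (λ (p , _) e → <-irrefl (sym e) p) (blocks-bounds μ (suc r) d))))
              (+-identityʳ (μ r)))
... | no r≢x = trans (count-++ x (replicate (μ r) r) _)
       (trans (cong (_+ count x (blocks μ (suc r) d)) (count-none (All.replicate⁺ (μ r) r≢x)))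
              (count-blocks μ (suc r) d (≤∧≢⇒< r≤x r≢x) (subst (x <_) (+-suc r d) x<)))

-- A telescoping sum, `μ (suc s)` being the drop of `f` from `s` to `suc s`. Later `f` is `pos i`,
-- and the drops are counts of covered vacancies.
length-blocks : ∀ μ (f : ℕ → ℕ) r d → (∀ {s} → r ≤ s → s < r + d → μ (suc s) + f (suc s) ≡ f s) →
  length (blocks μ (suc r) d) + f (r + d) ≡ f r
length-blocks μ f r zero    h = cong f (+-identityʳ r)
length-blocks μ f r (suc d) h = begin
  length (replicate (μ (suc r)) (suc r) ++ B) + f (r + suc d)          ≡⟨ cong₂ _+_ (length-++ (replicate (μ (suc r)) (suc r))) (cong f (+-suc r d)) ⟩
  length (replicate (μ (suc r)) (suc r)) + length B + f (suc r + d)    ≡⟨ cong (λ u → u + length B + f (suc r + d)) (length-replicate (μ (suc r))) ⟩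
  μ (suc r) + length B + f (suc r + d)                                 ≡⟨ +-assoc (μ (suc r)) (length B) _ ⟩
  μ (suc r) + (length B + f (suc r + d))                               ≡⟨ cong (μ (suc r) +_) (length-blocks μ f (suc r) d (λ {s} p q → h (<⇒≤ p) (subst (s <_) (sym (+-suc r d)) q))) ⟩
  μ (suc r) + f (suc r)                                                ≡⟨ h ≤-refl (m<m+n r z<s) ⟩
  f r                                                                  ∎
  where
  open ≡-Reasoning
  B = blocks μ (suc (suc r)) d

below-blocks : ∀ μ (f : ℕ → ℕ) r d → (∀ {s} → r ≤ s → s < r + d → μ (suc s) + f (suc s) ≡ f s) →
  r ≤ e → e ≤ r + d → below e (blocks μ (suc r) d) + f e ≡ f r
below-blocks {e} μ f r zero    h r≤e e≤ = cong f (≤-antisym (subst (e ≤_) (+-identityʳ r) e≤) r≤e)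
below-blocks {e} μ f r (suc d) h r≤e e≤ with r ≟ e
... | yes refl = cong (_+ f r) (below-none (All.map proj₁ (blocks-bounds μ (suc r) (suc d))))
... | no r≢e = begin
  below e (replicate (μ (suc r)) (suc r) ++ B) + f e            ≡⟨ cong (_+ f e) (below-++ e (replicate (μ (suc r)) (suc r)) B) ⟩
  below e (replicate (μ (suc r)) (suc r)) + below e B + f e     ≡⟨ cong (λ u → u + below e B + f e) (trans (below-all⁺ (All.replicate⁺ (μ (suc r)) r<e)) (length-replicate (μ (suc r)))) ⟩
  μ (suc r) + below e B + f e                                   ≡⟨ +-assoc (μ (suc r)) (below e B) (f e) ⟩
  μ (suc r) + (below e B + f e)                                 ≡⟨ cong (μ (suc r) +_) (below-blocks μ f (suc r) d (λ {s} p q → h (<⇒≤ p) (subst (s <_) (sym (+-suc r d)) q)) r<e (subst (e ≤_) (+-suc r d) e≤)) ⟩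
  μ (suc r) + f (suc r)                                         ≡⟨ h ≤-refl (m<m+n r z<s) ⟩
  f r                                                           ∎
  where
  open ≡-Reasoning
  B = blocks μ (suc (suc r)) d
  r<e = ≤∧≢⇒< r≤e r≢e

-- The multiplicity of i is not μ i but whatever is missing to length l.
paddedRow : ℕ → ℕ → (ℕ → ℕ) → ℕ → List ℕ
paddedRow L i μ l = replicate (l ∸ length R₀) i ++ R₀
  where R₀ = blocks μ (suc i) (L ∸ i)

count-paddedRow : ∀ {L} i μ l → i < x → x ≤ L → count x (paddedRow L i μ l) ≡ μ x
count-paddedRow {x} {L} i μ l i<x x≤L = trans (count-++ x (replicate (l ∸ length (blocks μ (suc i) (L ∸ i))) i) (blocks μ (suc i) (L ∸ i)))
  (trans (cong (_+ count x (blocks μ (suc i) (L ∸ i))) (count-none (All.replicate⁺ (l ∸ length (blocks μ (suc i) (L ∸ i))) (<⇒≢ i<x))))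
         (count-blocks μ (suc i) (L ∸ i) i<x (s≤s (subst (x ≤_) (sym (m+[n∸m]≡n (<⇒≤ (<-≤-trans i<x x≤L)))) x≤L))))

paddedRow-bounds : ∀ {L} i μ l → i ≤ L → All (λ e → i ≤ e × e ≤ L) (paddedRow L i μ l)
paddedRow-bounds {L} i μ l i≤L = All.++⁺ (All.replicate⁺ _ (≤-refl , i≤L))
  (All.map (λ (p , q) → <⇒≤ p , subst (_ ≤_) (m+[n∸m]≡n i≤L) (s≤s⁻¹ q)) (blocks-bounds μ (suc i) (L ∸ i)))

paddedRow-sorted : ∀ L i μ l → Linked _≤_ (paddedRow L i μ l)
paddedRow-sorted L i μ l = Linked.AllPairs⇒Linked
  (replicate-++-sorted (All.map (<⇒≤ ∘ proj₁) (blocks-bounds μ (suc i) (L ∸ i))) (blocks-sorted μ (suc i) (L ∸ i)) _)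

-- To be read with `f = pos i`, `l = lam i` and `s = i + lam 1`. The hypothesis `top` ensures that
-- the blocks alone do not exceed length `l`, so the padding is genuine.
module _ {L i l s : ℕ} {μ f : ℕ → ℕ} (i≤L : i ≤ L) (tele : ∀ {r} → i ≤ r → r < L → μ (suc r) + f (suc r) ≡ f r)
  (bottom : f L + l ≡ s) (top : f i ≤ s) where

  private
    R₀ : List ℕ
    R₀ = blocks μ (suc i) (L ∸ i)

    L≡ : i + (L ∸ i) ≡ L
    L≡ = m+[n∸m]≡n i≤L

    tele' : ∀ {r} → i ≤ r → r < i + (L ∸ i) → μ (suc r) + f (suc r) ≡ f r
    tele' {r} p q = tele p (subst (r <_) L≡ q)

    R₀-length : length R₀ + f L ≡ f i
    R₀-length = trans (cong (λ u → length R₀ + f u) (sym L≡)) (length-blocks μ f i (L ∸ i) tele')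

    R₀≤l : length R₀ ≤ l
    R₀≤l = +-cancelʳ-≤ (f L) (length R₀) l (≤-trans (≤-reflexive R₀-length) (≤-trans top (≤-reflexive (trans (sym bottom) (+-comm (f L) l)))))

  length-paddedRow : length (paddedRow L i μ l) ≡ l
  length-paddedRow = trans (length-++ (replicate (l ∸ length R₀) i))
    (trans (cong (_+ length R₀) (length-replicate (l ∸ length R₀))) (m∸n+n≡m R₀≤l))

  below-paddedRow : i ≤ e → e ≤ L → below e (paddedRow L i μ l) + f e ≡ s
  below-paddedRow {e} i≤e e≤L = begin
    below e (replicate (l ∸ length R₀) i ++ R₀) + f e         ≡⟨ cong (_+ f e) (below-++ e (replicate (l ∸ length R₀) i) R₀) ⟩
    below e (replicate (l ∸ length R₀) i) + below e R₀ + f e  ≡⟨ cong (λ u → u + below e R₀ + f e) (trans (below-all⁺ (All.replicate⁺ (l ∸ length R₀) i≤e)) (length-replicate (l ∸ length R₀))) ⟩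
    (l ∸ length R₀) + below e R₀ + f e                        ≡⟨ +-assoc (l ∸ length R₀) _ _ ⟩
    (l ∸ length R₀) + (below e R₀ + f e)                      ≡⟨ cong ((l ∸ length R₀) +_) (below-blocks μ f i (L ∸ i) tele' i≤e (subst (e ≤_) (sym L≡) e≤L)) ⟩
    (l ∸ length R₀) + f i                                     ≡⟨ cong ((l ∸ length R₀) +_) R₀-length ⟨
    (l ∸ length R₀) + (length R₀ + f L)                       ≡⟨ +-assoc (l ∸ length R₀) _ _ ⟨
    (l ∸ length R₀) + length R₀ + f L                         ≡⟨ cong (_+ f L) (m∸n+n≡m R₀≤l) ⟩
    l + f L                                                   ≡⟨ +-comm l (f L) ⟩
    f L + l                                                   ≡⟨ bottom ⟩
    s                                                         ∎
    where open ≡-Reasoning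

at-map : ∀ {δ : A} (g : A → A') xs q → at (g δ) (map g xs) q ≡ g (at δ xs q)
at-map g []       q       = refl
at-map g (x ∷ xs) zero    = refl
at-map g (x ∷ xs) (suc q) = at-map g xs q

at-map-< : ∀ {δ : A} {δ' : A'} (g : A → A') xs → q < length xs → at δ' (map g xs) q ≡ g (at δ xs q)
at-map-< {q = zero}  g (x ∷ xs) _  = refl
at-map-< {q = suc q} g (x ∷ xs) q< = at-map-< g xs (s≤s⁻¹ q<)

linked-at : ∀ {S : A → A → Set} {δ xs} → Linked S xs → suc q < length xs → S (at δ xs q) (at δ xs (suc q))
linked-at {q = zero}  (s ∷ _) _  = s
linked-at {q = suc q} (_ ∷ l) q< = linked-at l (s≤s⁻¹ q<)
linked-at [-] (s≤s ())

-- The type of a queue, letter by letter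

labelAt : ℕ → Bool → Maybe ℕ → ℕ
labelAt L false _        = suc L
labelAt L true  (just l) = l
labelAt L true  nothing  = 0

length-typeOf : ∀ w Q → length (typeOf w Q) ≡ colsOf w
length-typeOf w Q = trans (length-map _ (applyUpTo suc (colsOf w))) (length-applyUpTo suc (colsOf w))

-- The labeling function of `typeOf` is local to it; `refl` makes it available as an inferred
-- witness, which `typeLabel-≡` then identifies with `labelAt`.
typeLabel : ∀ w Q → Σ (ℕ → ℕ) λ g → typeOf w Q ≡ map g (applyUpTo suc (colsOf w))
typeLabel w Q = _ , refl

typeLabel-≡ : ∀ w Q j → proj₁ (typeLabel w Q) j ≡
  labelAt (rowsOf w) (ball Q (rowsOf w) j) (labelOf (labs (bully Q (rowsOf w) (colsOf w))) (rowsOf w) j)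
typeLabel-≡ w Q j with ball Q (rowsOf w) j | labelOf (labs (bully Q (rowsOf w) (colsOf w))) (rowsOf w) j
... | false | _       = refl
... | true  | just _  = refl
... | true  | nothing = refl

at-typeOf : ∀ {L N} w Q → rowsOf w ≡ L → colsOf w ≡ N → q < N →
  at 0 (typeOf w Q) q ≡ labelAt L (ball Q L (suc q)) (labelOf (labs (bully Q L N)) L (suc q))
at-typeOf {q} w Q refl refl q< = trans
  (at-map-< {δ = 0} (proj₁ (typeLabel w Q)) (applyUpTo suc (colsOf w)) (subst (q <_) (sym (length-applyUpTo suc (colsOf w))) q<))
  (trans (cong (proj₁ (typeLabel w Q)) (at-applyUpTo suc (colsOf w) q<)) (typeLabel-≡ w Q (suc q)))

-- The bijection

-- Speaks of the set of balls only: range, injectivity and the shape of the paths come from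
-- `Interlacing`.
record Occupies (Q : List (List Bool)) (L : ℕ) (pos : ℕ → ℕ → ℕ) : Set where
  field
    is-ball   : 1 ≤ i → i ≤ r → r ≤ L → ball Q r (pos i r) ≡ true
    all-balls : 1 ≤ r → r ≤ L → 1 ≤ x → x ≤ suc L → ball Q r x ≡ true → ∃ λ i → 1 ≤ i × i ≤ r × x ≡ pos i r

module Bijection (L : ℕ) (p : List ℕ) (val : Val (suc L) p) where
  open Word L p val
  open Combinatorics boundary
  open BoundaryWord boundary using (c-vertical)

  rows-w : rowsOf w ≡ L
  rows-w = cong (_∸ 1) maxL-w

  lam-beyond : length p < i → lam i ≡ 0
  lam-beyond {suc i} len≤i = at-beyond p (s≤s⁻¹ len≤i)

  lam-positive : q < length p → 1 ≤ lam (suc q)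
  lam-positive q< = All-at⁻ 0 (proj₂ (proj₁ val)) q<

  mlq-table : ∀ {Q} → IsMLQ w Q → ∃ λ pos → Interlacing L k lam col pos × Occupies Q L pos
  mlq-table {Q} (_ , _ , type≡) =
    let pos , lt , bot = FromType.table Q L (suc L) col typed⁺ typed⁻ in
    pos , Forward.interlacing lt bot k≤L ,
    record { is-ball = LabeledTable.is-ball lt ; all-balls = LabeledTable.all-balls lt }
    where
    final = labs (bully Q L (suc L))
    at-w : q < suc L → at 0 w q ≡ labelAt L (ball Q L (suc q)) (labelOf final L (suc q))
    at-w {q} q< = trans (cong (λ u → at 0 u q) (sym type≡)) (at-typeOf w Q rows-w length-w q<)
    -- A vacancy reads `suc L` and an unlabeled ball 0, both outside the range from 1 to `L`.
    labelAt-≤ : ∀ b v {j} → 1 ≤ j → j ≤ L → labelAt L b v ≡ j → v ≡ just j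
    labelAt-≤ false v        1≤j j≤L refl = contradiction j≤L (<-irrefl refl)
    labelAt-≤ true  (just l) 1≤j j≤L refl = refl
    labelAt-≤ true  nothing  1≤j j≤L refl = contradiction 1≤j (<-irrefl refl)
    typed⁺ : ∀ {j} → 1 ≤ j → j ≤ L → labelOf final L (col j) ≡ just j
    typed⁺ {j} 1≤j j≤L with q , e ← col-positive 1≤j = subst (λ u → labelOf final L u ≡ just j) (sym e)
      (labelAt-≤ (ball Q L (suc q)) (labelOf final L (suc q)) 1≤j j≤L
        (trans (sym (at-w (subst (_≤ suc L) e (proj₂ (col-range 1≤j (m≤n⇒m≤1+n j≤L))))))
               (trans (cong (λ u → at 0 w (u ∸ 1)) (sym e)) (w-at-col 1≤j (m≤n⇒m≤1+n j≤L)))))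
    typed⁻ : ∀ {j x} → 1 ≤ x → x ≤ suc L → ball Q L x ≡ true → labelOf final L x ≡ just j → x ≡ col j
    typed⁻ {j} {suc q} 1≤x x≤n b lab with j' , 1≤j' , j'≤n , e ← col-onto 1≤x x≤n =
      trans e (cong col (trans (sym (w-at-col 1≤j' j'≤n)) (trans (cong (λ u → at 0 w (u ∸ 1)) (sym e))
        (trans (at-w x≤n) (cong₂ (labelAt L) b lab)))))

  -- Built from the vacancy counts instead of `pos`, so the tableau depends on the queue alone and
  -- not on the proof that it has type `w`.
  row : List (List Bool) → ℕ → List ℕ
  row Q i = paddedRow L i (numCovered w Q i) (lam i)

  row-sorted : ∀ Q i → Linked _≤_ (row Q i)
  row-sorted Q i = paddedRow-sorted L i (numCovered w Q i) (lam i)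

  tableau : List (List Bool) → List (List ℕ)
  tableau Q = applyUpTo (row Q ∘ suc) (length p)

  tableau-at : ∀ Q → q < length p → at [] (tableau Q) q ≡ row Q (suc q)
  tableau-at Q = at-applyUpTo (row Q ∘ suc) (length p)

  -- The tableau of a queue

  module Table {Q : List (List Bool)} {pos : ℕ → ℕ → ℕ} (I : Interlacing L k lam col pos) (O : Occupies Q L pos) where
    open Interlacing I
    open Occupies O
    open Backward I

    unwrapped : UnwrappedTable Q L (suc L) pos
    unwrapped = record { in-range = pos-range ; is-ball = is-ball ; all-balls = all-balls
                       ; injective = pos-injective ; weak = weak ; gap = gap }

    open Covering {w} {Q} {pos} (subst₂ (λ a b → UnwrappedTable Q a b pos) (sym rows-w) (sym length-w) unwrapped)

    covered-in : 1 ≤ i → i ≤ r → suc r ≤ L → numCovered w Q i (suc r) ≡ pos i r ∸ pos i (suc r)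
    covered-in 1≤i i≤r r<L = numCovered-in 1≤i i≤r (subst (_ ≤_) (sym rows-w) r<L)

    covered-out : ∀ i r → ¬ (1 ≤ i × i < r × r ≤ L) → numCovered w Q i r ≡ 0
    covered-out i r out = numCovered-out i r (λ (a , b , c) → out (a , b , subst (_ ≤_) rows-w c))

    -- Label `k` cannot exceed the last column `suc L`, which is `k + lam 1`; along the diagonal
    -- `strict` lowers the bound by one with each smaller label.
    top : ∀ d → 1 ≤ i → i + d ≡ k → pos i i ≤ i + lam 1
    top {i} zero    1≤i eq with refl ← trans (sym eq) (+-identityʳ i) =
      ≤-trans (bounded 1≤i ≤-refl k≤L) (≤-reflexive (trans (sym total) (+-comm (lam 1) k)))
    top {i} (suc d) 1≤i eq = s≤s⁻¹ (≤-trans (strict 1≤i i<k ≤-refl (≤-trans i<k k≤L)) (top d (s≤s z≤n) (trans (sym (+-suc i d)) eq)))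
      where
      i<k : i < k
      i<k = subst (i <_) eq (m<m+n i z<s)

    pos-top : 1 ≤ i → i ≤ k → pos i i ≤ i + lam 1
    pos-top 1≤i i≤k = top _ 1≤i (m+[n∸m]≡n i≤k)

    descends : ∀ d → 1 ≤ i → i + d ≤ L → pos i (i + d) ≤ pos i i
    descends {i} zero    1≤i le = ≤-reflexive (cong (pos i) (+-identityʳ i))
    descends {i} (suc d) 1≤i le = ≤-trans (≤-reflexive (cong (pos i) (+-suc i d)))
      (≤-trans (weak 1≤i (m≤m+n i d) le') (descends d 1≤i (<⇒≤ le')))
      where le' = subst (_≤ L) (+-suc i d) le

    pos≤ : 1 ≤ i → i ≤ k → i ≤ r → r ≤ L → pos i r ≤ i + lam 1
    pos≤ 1≤i i≤k i≤r r≤L with d , refl ← m≤n⇒∃[o]m+o≡n i≤r = ≤-trans (descends d 1≤i r≤L) (pos-top 1≤i i≤k)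

    -- A vertical label with `lam i ≡ 0` is squeezed, because `col i ≡ i + lam 1` is both its least
    -- and its greatest possible column.
    immobile : 1 ≤ i → length p < i → i ≤ r → r ≤ L → pos i r ≡ col i
    immobile {i} 1≤i len<i i≤r r≤L with <-≤-connex k i
    ... | inj₁ k<i = horiz k<i i≤r r≤L
    ... | inj₂ i≤k = ≤-antisym (≤-trans (pos≤ 1≤i i≤k i≤r r≤L) (≤-reflexive (sym col≡))) (c≤pos 1≤i i≤r r≤L)
      where
      col≡ : col i ≡ i + lam 1
      col≡ = trans (sym (+-identityʳ (col i))) (trans (cong (col i +_) (sym (lam-beyond len<i))) (c-vertical 1≤i i≤k))

    module _ {i} (1≤i : 1 ≤ i) (i≤k : i ≤ k) where
      private
        i≤L : i ≤ L
        i≤L = ≤-trans i≤k k≤L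
        tele : ∀ {r} → i ≤ r → r < L → numCovered w Q i (suc r) + pos i (suc r) ≡ pos i r
        tele i≤r r<L = trans (cong (_+ pos i _) (covered-in 1≤i i≤r r<L)) (m∸n+n≡m (weak 1≤i i≤r r<L))
        bot : pos i L + lam i ≡ i + lam 1
        bot = trans (cong (_+ lam i) (bottom 1≤i i≤L)) (c-vertical 1≤i i≤k)

      row-length : length (row Q i) ≡ lam i
      row-length = length-paddedRow i≤L tele bot (pos-top 1≤i i≤k)

      row-below : i ≤ e → e ≤ L → below e (row Q i) + pos i e ≡ i + lam 1
      row-below = below-paddedRow i≤L tele bot (pos-top 1≤i i≤k)

      row-bounds : All (λ e → i ≤ e × e ≤ L) (row Q i)
      row-bounds = paddedRow-bounds i (numCovered w Q i) (lam i) i≤L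

      -- By `fixed`, label `i` has reached `col i` in row `D`. The pattern equation then counts
      -- `lam i` entries up to `D`, which is the whole row.
      row-bounded : 1 ≤ lam i → All (_≤ suc L ∸ lam i) (row Q i)
      row-bounded 1≤lam = below-all⁻ (row Q i) (trans below-D (sym row-length))
        where
        D = suc L ∸ lam i
        lam≤ : lam i ≤ lam 1
        lam≤ = lam-anti ≤-refl 1≤i
        D+lam : D + lam i ≡ suc L
        D+lam = m∸n+n≡m (≤-trans lam≤ lam≤n)
        i≤D : i ≤ D
        i≤D = m+n≤o⇒m≤o∸n i (≤-trans (+-mono-≤ i≤k lam≤) (≤-reflexive (trans (+-comm k (lam 1)) total)))
        D≤L : D ≤ L
        D≤L = ∸-monoʳ-≤ (suc L) 1≤lam
        below-D : below D (row Q i) ≡ lam i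
        below-D = +-cancelʳ-≡ (pos i D) (below D (row Q i)) (lam i)
          (trans (row-below i≤D D≤L) (trans (sym (c-vertical 1≤i i≤k))
            (trans (+-comm (col i) (lam i)) (cong (lam i +_) (sym (fixed 1≤i i≤k i≤D D≤L (≤-reflexive (sym D+lam))))))))

    -- Through the pattern equation `strict` says that row `suc i` has at most as many entries up to
    -- `suc e` as row `i` has up to `e`. With `suc e` the lower entry at index `j`, more than `j`
    -- entries of the upper row are at most `e`.
    row-colStrict : 1 ≤ i → suc i ≤ k → ColStrict (row Q i) (row Q (suc i))
    row-colStrict {i} 1≤i i<k j j< = strictly (at 0 (row Q (suc i)) j) refl (All-at⁻ 0 (row-bounds (s≤s z≤n) i<k) j<)
      where
      R₁ = row Q i
      R₂ = row Q (suc i)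
      strictly : ∀ e → at 0 R₂ j ≡ e → suc i ≤ e × e ≤ L → at 0 R₁ j < e
      strictly (suc e) eq (i<e , e<L) = s≤s (at-≤-below (sorted-pairs (row-sorted Q i))
        (<-≤-trans (subst (λ u → j < below u R₂) eq (at-below (sorted-pairs (row-sorted Q (suc i))) j<)) fewer))
        where
        open ≤-Reasoning hiding (strict)
        fewer : below (suc e) R₂ ≤ below e R₁
        fewer = +-cancelʳ-≤ (pos (suc i) (suc e)) _ _ (begin
          below (suc e) R₂ + pos (suc i) (suc e) ≡⟨ row-below (s≤s z≤n) i<k i<e e<L ⟩
          suc (i + lam 1)                        ≡⟨ cong suc (row-below 1≤i (<⇒≤ i<k) (s≤s⁻¹ i<e) (<⇒≤ e<L)) ⟨
          suc (below e R₁ + pos i e)              ≡⟨ +-suc (below e R₁) (pos i e) ⟨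
          below e R₁ + suc (pos i e)              ≤⟨ +-monoʳ-≤ (below e R₁) (strict 1≤i i<k (s≤s⁻¹ i<e) e<L) ⟩
          below e R₁ + pos (suc i) (suc e)        ∎)

    tableau-isSSYT : IsSSYT p (map (suc L ∸_) p) (tableau Q)
    tableau-isSSYT =
      trans (map-applyUpTo (row Q ∘ suc) length (length p))
        (at-ext {δ = 0} _ p (length-applyUpTo _ (length p)) (λ {q} q< →
          let q<len = subst (q <_) (length-applyUpTo _ (length p)) q< in
          trans (at-applyUpTo (length ∘ row Q ∘ suc) (length p) q<len) (row-length (s≤s z≤n) (≤-trans q<len len≤k)))) ,
      All.applyUpTo⁺₁ (row Q ∘ suc) (length p) (λ {q} _ → row-sorted Q (suc q)) ,
      Linked.applyUpTo⁺₁ (row Q ∘ suc) (length p) (λ {q} q< → row-colStrict (s≤s z≤n) (≤-trans q< len≤k)) ,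
      entries
      where
      entries : ∀ q → q < length (tableau Q) → All (λ e → 1 ≤ e × e ≤ at 0 (map (suc L ∸_) p) q) (at [] (tableau Q) q)
      entries q q< = subst (All _) (sym (tableau-at Q q<len))
        (All.zipWith (λ ((lo , _) , hi) → ≤-trans (s≤s z≤n) lo , subst (_ ≤_) (sym (at-map-< {δ = 0} (suc L ∸_) p q<len)) hi)
          (row-bounds (s≤s z≤n) q<k , row-bounded (s≤s z≤n) q<k (lam-positive q<len)))
        where
        q<len = subst (q <_) (length-applyUpTo (row Q ∘ suc) (length p)) q<
        q<k = ≤-trans q<len len≤k

    -- For `r ≡ i` the left side is 0, as path `i` only starts there, while the row may well begin
    -- with entries `i`; hence `r ≢ i`. Below the last row of `p` the labels are immobile and both
    -- sides vanish.
    entries-covered : ∀ i r → 1 ≤ i → 1 ≤ r → r ≢ i → numCovered w Q i r ≡ numEntries (tableau Q) i r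
    entries-covered (suc q) (suc r) 1≤i _ r≢i with suc q ≤? length p
    ... | no ¬i≤len = trans none (sym (cong (count (suc r)) (at-beyond (tableau Q)
            (subst (_≤ q) (sym (length-applyUpTo (row Q ∘ suc) (length p))) (s≤s⁻¹ (≰⇒> ¬i≤len))))))
      where
      none : numCovered w Q (suc q) (suc r) ≡ 0
      none with suc q ≤? r | suc r ≤? L
      ... | yes i≤r | yes r<L = trans (covered-in 1≤i i≤r r<L)
              (trans (cong₂ _∸_ (immobile 1≤i (≰⇒> ¬i≤len) i≤r (<⇒≤ r<L)) (immobile 1≤i (≰⇒> ¬i≤len) (m≤n⇒m≤1+n i≤r) r<L)) (n∸n≡0 (col (suc q))))
      ... | no ¬i≤r | _       = covered-out _ _ (λ (_ , i<r , _) → ¬i≤r (s≤s⁻¹ i<r))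
      ... | _       | no ¬r<L = covered-out _ _ (λ (_ , _ , r<L) → ¬r<L r<L)
    ... | yes i≤len = trans present (sym (cong (count (suc r)) (tableau-at Q i≤len)))
      where
      i≤k = ≤-trans i≤len len≤k
      outside : ¬ (suc q ≤ suc r × suc r ≤ L) → count (suc r) (row Q (suc q)) ≡ 0
      outside out = count-none (All.map (λ {e} bd eq → out (subst (λ u → suc q ≤ u × u ≤ L) eq bd)) (row-bounds 1≤i i≤k))
      present : numCovered w Q (suc q) (suc r) ≡ count (suc r) (row Q (suc q))
      present with suc q ≤? r | suc r ≤? L
      ... | yes i≤r | yes r<L = sym (count-paddedRow (suc q) (numCovered w Q (suc q)) (lam (suc q)) (s≤s i≤r) r<L)
      ... | no ¬i≤r | _       = trans (covered-out _ _ (λ (_ , i<r , _) → ¬i≤r (s≤s⁻¹ i<r)))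
              (sym (outside (λ (i≤r , _) → ¬i≤r (s≤s⁻¹ (≤∧≢⇒< i≤r (r≢i ∘ sym))))))
      ... | _       | no ¬r<L = trans (covered-out _ _ (λ (_ , _ , r<L) → ¬r<L r<L)) (sym (outside (¬r<L ∘ proj₂)))

  toSSYT : MLQ w → SSYT p (map (suc L ∸_) p)
  toSSYT (Q , mlq) = tableau Q , (let _ , I , O = mlq-table mlq in Table.tableau-isSSYT I O)

  same-balls : ∀ {Q Q' pos pos'} → Occupies Q L pos → Occupies Q' L pos' →
    (∀ {i r} → 1 ≤ i → i ≤ r → r ≤ L → pos i r ≡ pos' i r) →
    1 ≤ r → r ≤ L → 1 ≤ x → x ≤ suc L → ball Q r x ≡ true → ball Q' r x ≡ true
  same-balls {r} {Q' = Q'} O O' eq 1≤r r≤L 1≤x x≤n b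
    with i , 1≤i , i≤r , refl ← Occupies.all-balls O 1≤r r≤L 1≤x x≤n b =
    trans (cong (ball Q' r) (eq 1≤i i≤r r≤L)) (Occupies.is-ball O' 1≤i i≤r r≤L)

  mlq-ext : ∀ {Q Q'} → IsMLQ w Q → IsMLQ w Q' →
    (∀ {r x} → 1 ≤ r → r ≤ L → 1 ≤ x → x ≤ suc L → ball Q r x ≡ ball Q' r x) → Q ≡ Q'
  mlq-ext {Q} {Q'} (len , lens , _) (len' , lens' , _) h = at-ext {δ = []} Q Q' (trans len (sym len')) λ {r} r< →
    let r<L = subst (r <_) (trans len rows-w) r<
        cols = All-at⁻ [] lens r<
        cols' = All-at⁻ [] lens' (subst (r <_) (trans len (sym len')) r<) in
    at-ext {δ = false} (at [] Q r) (at [] Q' r) (trans cols (sym cols'))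
      (λ {x} x< → h (s≤s z≤n) r<L (s≤s z≤n) (subst (x <_) (trans cols length-w) x<))

  tableau-determines : ∀ {Q Q' pos pos'} → Interlacing L k lam col pos → Interlacing L k lam col pos' →
    Occupies Q L pos → Occupies Q' L pos' → tableau Q ≡ tableau Q' →
    1 ≤ i → i ≤ r → r ≤ L → pos i r ≡ pos' i r
  tableau-determines {suc q} {r} {Q} {Q'} {pos} {pos'} I I' O O' eq 1≤i i≤r r≤L with suc q ≤? length p
  ... | no ¬i≤len = trans (Table.immobile I O 1≤i (≰⇒> ¬i≤len) i≤r r≤L) (sym (Table.immobile I' O' 1≤i (≰⇒> ¬i≤len) i≤r r≤L))
  ... | yes i≤len = +-cancelˡ-≡ (below r (row Q (suc q))) _ _
          (trans (Table.row-below I O 1≤i i≤k i≤r r≤L)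
          (trans (sym (Table.row-below I' O' 1≤i i≤k i≤r r≤L)) (cong (λ R → below r R + pos' (suc q) r) (sym rows≡))))
    where
    i≤k = ≤-trans i≤len len≤k
    rows≡ : row Q (suc q) ≡ row Q' (suc q)
    rows≡ = trans (sym (tableau-at Q i≤len)) (trans (cong (λ T → at [] T q) eq) (tableau-at Q' i≤len))

  toSSYT-injective : ∀ {x y : MLQ w} → toSSYT x ≈₁ toSSYT y → x ≈₁ y
  toSSYT-injective {Q , mlq} {Q' , mlq'} eq =
    let pos , I , O = mlq-table mlq
        pos' , I' , O' = mlq-table mlq' in
    mlq-ext mlq mlq' λ 1≤r r≤L 1≤x x≤n → true-ext
      (same-balls O O' (tableau-determines I I' O O' eq) 1≤r r≤L 1≤x x≤n)
      (same-balls O' O (tableau-determines I' I O' O (sym eq)) 1≤r r≤L 1≤x x≤n)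

  -- The queue of a tableau

  module FromTableau (T : List (List ℕ)) (ssyt : IsSSYT p (map (suc L ∸_) p) T) where

    rowT : ℕ → List ℕ
    rowT i = at [] T (i ∸ 1)

    length-T : length T ≡ length p
    length-T = trans (sym (length-map length T)) (cong length (proj₁ ssyt))

    length-rowT : ∀ i → length (rowT i) ≡ lam i
    length-rowT i = trans (sym (at-map {δ = []} length T (i ∸ 1))) (cong (λ u → at 0 u (i ∸ 1)) (proj₁ ssyt))

    rowT-sorted : q < length p → Linked _≤_ (rowT (suc q))
    rowT-sorted q< = All-at⁻ [] (proj₁ (proj₂ ssyt)) (subst (_ <_) (sym length-T) q<)

    rowT-bounds : q < length p → All (λ e → 1 ≤ e × e ≤ suc L ∸ lam (suc q)) (rowT (suc q))
    rowT-bounds {q} q< = All.map (λ (a , b) → a , subst (_ ≤_) (at-map-< {δ = 0} (suc L ∸_) p q<) b)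
      (proj₂ (proj₂ (proj₂ ssyt)) q (subst (q <_) (sym length-T) q<))

    rowT-bounded : 1 ≤ i → All (_≤ suc L ∸ lam i) (rowT i)
    rowT-bounded {suc q} _ with suc q ≤? length p
    ... | yes q< = All.map proj₂ (rowT-bounds q<)
    ... | no ¬q< = subst (All _) (sym (at-beyond T (subst (_≤ q) (sym length-T) (s≤s⁻¹ (≰⇒> ¬q<))))) []

    rowT-colStrict : suc q < length p → ColStrict (rowT (suc q)) (rowT (suc (suc q)))
    rowT-colStrict q< = linked-at (proj₁ (proj₂ (proj₂ ssyt))) (subst (_ <_) (sym length-T) q<)

    rowT-shorter : 1 ≤ i → length (rowT (suc i)) ≤ length (rowT i)
    rowT-shorter {i} 1≤i = subst₂ _≤_ (sym (length-rowT (suc i))) (sym (length-rowT i)) (lam-anti 1≤i (n≤1+n i))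

    rowT-lower : ∀ q → q < length p → All (suc q ≤_) (rowT (suc q))
    rowT-lower zero    q< = All.map proj₁ (rowT-bounds q<)
    rowT-lower (suc q) q< = All-at⁺ (rowT (suc (suc q))) λ {j} j< →
      ≤-<-trans (All-at⁻ 0 (rowT-lower q (<⇒≤ q<)) (<-≤-trans j< (rowT-shorter (s≤s z≤n)))) (rowT-colStrict q< j j<)

    below≤lam : ∀ i r → below r (rowT i) ≤ lam i
    below≤lam i r = subst (below r (rowT i) ≤_) (length-rowT i) (below-≤-length r (rowT i))

    -- For vertical labels this is `i + lam 1` minus the number of entries up to `r`. Written with
    -- `col` it also gives the constant column of the labels with `lam i ≡ 0`, all horizontal ones
    -- included.
    pos : ℕ → ℕ → ℕ
    pos i r = col i + (lam i ∸ below r (rowT i))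

    pos-below : 1 ≤ i → i ≤ k → ∀ r → pos i r + below r (rowT i) ≡ i + lam 1
    pos-below {i} 1≤i i≤k r = trans (+-assoc (col i) _ _)
      (trans (cong (col i +_) (m∸n+n≡m (below≤lam i r))) (c-vertical 1≤i i≤k))

    pos-stuck : ∀ i r → lam i ≤ below r (rowT i) → pos i r ≡ col i
    pos-stuck i r le = trans (cong (col i +_) (m≤n⇒m∸n≡0 le)) (+-identityʳ (col i))

    -- The bound on row `i` is `suc L ∸ lam i ≤ r`, so all its entries are counted.
    pos-fixed : 1 ≤ i → suc L ≤ r + lam i → pos i r ≡ col i
    pos-fixed {i} {r} 1≤i le = pos-stuck i r (≤-reflexive (trans (sym (length-rowT i)) (sym (below-all⁺
      (All.map (λ e≤ → ≤-trans e≤ (m≤n+o⇒m∸n≤o (suc L) (lam i) (≤-trans le (≤-reflexive (+-comm r (lam i)))))) (rowT-bounded 1≤i))))))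

    pos-strict : 1 ≤ i → i < k → ∀ r → pos i r < pos (suc i) (suc r)
    pos-strict {suc q} 1≤i i<k r = +-cancelʳ-≤ (below r (rowT (suc q))) _ _ (begin
      suc (pos (suc q) r) + below r (rowT (suc q))                          ≡⟨ cong suc (pos-below 1≤i (<⇒≤ i<k) r) ⟩
      suc (suc q + lam 1)                                                   ≡⟨ pos-below (s≤s z≤n) i<k (suc r) ⟨
      pos (suc (suc q)) (suc r) + below (suc r) (rowT (suc (suc q)))        ≤⟨ +-monoʳ-≤ (pos (suc (suc q)) (suc r)) fewer ⟩
      pos (suc (suc q)) (suc r) + below r (rowT (suc q))                    ∎)
      where
      open ≤-Reasoning
      fewer : below (suc r) (rowT (suc (suc q))) ≤ below r (rowT (suc q))
      fewer with suc (suc q) ≤? length p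
      ... | yes q< = below-colStrict (rowT (suc q)) (rowT (suc (suc q))) (rowT-shorter (s≤s z≤n)) (rowT-colStrict q<)
      ... | no ¬q< = ≤-trans (below≤lam (suc (suc q)) (suc r)) (≤-trans (≤-reflexive (lam-beyond (≰⇒> ¬q<))) z≤n)

    interlacing : Interlacing L k lam col pos
    interlacing = record
      { bottom  = λ {i} 1≤i i≤L → bot i 1≤i
      ; weak    = λ {i} {r} _ _ _ → +-monoʳ-≤ (col i) (∸-monoʳ-≤ (lam i)
                    (≤-trans (m≤m+n (below r (rowT i)) (count (suc r) (rowT i))) (≤-reflexive (sym (below-suc r (rowT i))))))
      ; strict  = λ {i} {r} 1≤i i<k _ _ → pos-strict 1≤i i<k r
      ; fixed   = λ 1≤i _ _ _ → pos-fixed 1≤i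
      ; horiz   = λ {j} {r} k<j _ _ → pos-stuck j r (≤-trans (≤-reflexive (lam-beyond (≤-<-trans len≤k k<j))) z≤n)
      ; bounded = bnd }
      where
      bot : ∀ i → 1 ≤ i → pos i L ≡ col i
      bot i 1≤i with lam i ≟ 0
      ... | yes lam≡0 = pos-stuck i L (≤-trans (≤-reflexive lam≡0) z≤n)
      ... | no lam≢0  = pos-fixed 1≤i (m<m+n L (n≢0⇒n>0 lam≢0))
      bnd : ∀ {i r} → 1 ≤ i → i ≤ r → r ≤ L → pos i r ≤ suc L
      bnd {i} {r} 1≤i i≤r r≤L with <-≤-connex k i
      ... | inj₁ k<i = subst (_≤ suc L) (sym (pos-stuck i r (≤-trans (≤-reflexive (lam-beyond (≤-<-trans len≤k k<i))) z≤n)))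
                         (proj₂ (col-range 1≤i (m≤n⇒m≤1+n (≤-trans i≤r r≤L))))
      ... | inj₂ i≤k = ≤-trans (m≤m+n (pos i r) (below r (rowT i))) (≤-trans (≤-reflexive (pos-below 1≤i i≤k r))
                         (≤-trans (+-monoˡ-≤ (lam 1) i≤k) (≤-reflexive (trans (+-comm k (lam 1)) total))))

    occupied : ℕ → ℕ → Bool
    occupied r x = any (λ i → pos (suc i) r ≡ᵇ x) (upTo r)

    queue : List (List Bool)
    queue = applyUpTo (λ r → applyUpTo (λ x → occupied (suc r) (suc x)) (suc L)) L

    ball-queue : 1 ≤ r → r ≤ L → 1 ≤ x → x ≤ suc L → ball queue r x ≡ occupied r x
    ball-queue {suc r} {suc x} _ r<L _ x<n =
      trans (cong (λ row → at false row x) (at-applyUpTo (λ r → applyUpTo (λ x → occupied (suc r) (suc x)) (suc L)) L r<L))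
            (at-applyUpTo (λ x → occupied (suc r) (suc x)) (suc L) x<n)

    occupies : Occupies queue L pos
    occupies = record { is-ball = isb ; all-balls = allb }
      where
      isb : ∀ {i r} → 1 ≤ i → i ≤ r → r ≤ L → ball queue r (pos i r) ≡ true
      isb {suc i} {r} 1≤i i≤r r≤L =
        let 1≤x , x≤n = Backward.pos-range interlacing 1≤i i≤r r≤L in
        trans (ball-queue (≤-trans 1≤i i≤r) r≤L 1≤x x≤n)
          (any-true⁺ (λ j → pos (suc j) r ≡ᵇ pos (suc i) r) (∈-upTo⁺ i≤r) (≡ᵇ-true⁺ {pos (suc i) r} refl))
      allb : ∀ {r x} → 1 ≤ r → r ≤ L → 1 ≤ x → x ≤ suc L → ball queue r x ≡ true → ∃ λ i → 1 ≤ i × i ≤ r × x ≡ pos i r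
      allb {r} {x} 1≤r r≤L 1≤x x≤n b
        with i , i∈ , e ← any-true⁻ (λ j → pos (suc j) r ≡ᵇ x) (upTo r) (trans (sym (ball-queue 1≤r r≤L 1≤x x≤n)) b) =
        suc i , s≤s z≤n , ∈-upTo⁻ i∈ , sym (≡ᵇ-true⁻ {pos (suc i) r} {x} e)

    queue-isMLQ : IsMLQ w queue
    queue-isMLQ = trans (length-applyUpTo _ L) (sym rows-w) ,
      All.applyUpTo⁺₂ _ L (λ r → trans (length-applyUpTo (λ x → occupied (suc r) (suc x)) (suc L)) (sym length-w)) ,
      at-ext {δ = 0} (typeOf w queue) w (length-typeOf w queue) (λ {q} q< →
        let q<n = subst (q <_) (trans (length-typeOf w queue) length-w) q<
            j , 1≤j , j≤n , e = col-onto (s≤s z≤n) q<n in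
        trans (at-typeOf w queue rows-w length-w q<n) (trans (label j 1≤j j≤n e)
          (trans (sym (w-at-col 1≤j j≤n)) (cong (λ u → at 0 w (u ∸ 1)) (sym e)))))
      where
      open Interlacing interlacing using (bottom)
      final = labs (bully queue L (suc L))
      vacancy : 1 ≤ L → suc q ≡ col (suc L) → ball queue L (suc q) ≢ true
      vacancy {q} 1≤L e b
        with i , 1≤i , i≤L , e' ← Occupies.all-balls occupies 1≤L ≤-refl (s≤s z≤n)
               (subst (_≤ suc L) (sym e) (proj₂ (col-range (s≤s z≤n) ≤-refl))) b
        = <⇒≢ (s≤s i≤L) (c-injective 1≤i (m≤n⇒m≤1+n i≤L) (s≤s z≤n) ≤-refl (trans (sym (bottom 1≤i i≤L)) (trans (sym e') e)))
      label : ∀ j → 1 ≤ j → j ≤ suc L → suc q ≡ col j → labelAt L (ball queue L (suc q)) (labelOf final L (suc q)) ≡ j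
      label {q} j 1≤j j≤n e with j ≟ suc L
      ... | no ne = cong₂ (labelAt L)
              (trans (cong (ball queue L) q≡) (Occupies.is-ball occupies 1≤j j≤L ≤-refl))
              (trans (cong (labelOf final L) q≡) (Simulation.final-label (Table.unwrapped interlacing occupies) 1≤j j≤L))
        where
        j≤L = s≤s⁻¹ (≤∧≢⇒< j≤n ne)
        q≡ : suc q ≡ pos j L
        q≡ = trans e (sym (bottom 1≤j j≤L))
      ... | yes refl = cong (λ b → labelAt L b (labelOf final L (suc q))) (not-true⁻ (not-true⁺ (vacancy (≤-trans 1≤k k≤L) e)))

    -- Both rows satisfy the same equation with `pos`, hence agree in `below e` for `i ≤ e ≤ L`;
    -- column strictness and the row bound place all entries of `T` in that range.
    tableau-queue : tableau queue ≡ T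
    tableau-queue = at-ext {δ = []} (tableau queue) T (trans (length-applyUpTo _ (length p)) (sym length-T)) λ {q} q< →
      let q<len = subst (q <_) (length-applyUpTo (row queue ∘ suc) (length p)) q< in
      trans (tableau-at queue q<len) (row≡ q<len)
      where
      module Tb = Table interlacing occupies
      row≡ : q < length p → row queue (suc q) ≡ rowT (suc q)
      row≡ {q} q< = sorted-≡ (row-sorted queue (suc q)) (rowT-sorted q<)
        (trans (Tb.row-length (s≤s z≤n) q<k) (sym (length-rowT (suc q))))
        (All.map same-below (Tb.row-bounds (s≤s z≤n) q<k))
        (All.map same-below (All.zipWith (λ (lo , hi) → lo , ≤-trans hi (∸-monoʳ-≤ (suc L) (lam-positive q<)))
          (rowT-lower q q< , rowT-bounded (s≤s z≤n))))
        where
        q<k = ≤-trans q< len≤k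
        same-below : suc q ≤ e × e ≤ L → below e (row queue (suc q)) ≡ below e (rowT (suc q))
        same-below {e} (i≤e , e≤L) = +-cancelʳ-≡ (pos (suc q) e) _ _
          (trans (Tb.row-below (s≤s z≤n) q<k i≤e e≤L)
            (trans (sym (pos-below (s≤s z≤n) q<k e)) (+-comm (pos (suc q) e) _)))

  toSSYT-surjective : ∀ (y : SSYT p (map (suc L ∸_) p)) → ∃ λ (x : MLQ w) → ∀ {z} → z ≈₁ x → toSSYT z ≈₁ y
  toSSYT-surjective (T , ssyt) = (queue , queue-isMLQ) , λ e → trans (cong tableau e) tableau-queue
    where open FromTableau T ssyt

  toSSYT-entries : ∀ (x : MLQ w) i r → 1 ≤ i → 1 ≤ r → r ≢ i → numCovered w (proj₁ x) i r ≡ numEntries (proj₁ (toSSYT x)) i r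
  toSSYT-entries (Q , mlq) = let _ , I , O = mlq-table mlq in Table.entries-covered I O

theorem8p5 : (n : ℕ) (p : List ℕ) → Val n p →
    Σ (MLQ (wperm n p) → SSYT p (map (n ∸_) p)) (λ f →
    IsBijection f
    × ((Q : MLQ (wperm n p)) (i r : ℕ) → 1 ≤ i → 1 ≤ r → r ≢ i →
    numCovered (wperm n p) (proj₁ Q) i r ≡ numEntries (proj₁ (f Q)) i r))
-- `Val 0` is empty: the first part would be positive and at most `0 ∸ length p`, which is 0.
theorem8p5 zero    []      (_ , () , _)
theorem8p5 zero    (_ ∷ _) ((_ , 1≤x ∷ _) , _ , x≤0 , _) = contradiction (≤-trans 1≤x x≤0) (λ ())
theorem8p5 (suc L) p val = toSSYT , ((λ {x} {y} → toSSYT-injective {x} {y}) , toSSYT-surjective) , toSSYT-entries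
  where open Bijection L p val
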